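{- Let $X$ be a smooth projective split toric variety over $\mathbb{Q}$ with $-K_X$ globally generated, $r=\operatorname{rank}\operatorname{Pic}(X)$, $n=\#\Delta(1)$. Let $f,g\in\mathbb{Z}[x_\rho:\rho\in\Delta(1)]$ be coprime, i.e. the subscheme $f=g=0$ has codimension $2$ in $\mathbb{A}^n_\mathbb{Q}$. Then uniformly for $N\ge2$, $$\#\{\mathbf{X}\in\mathcal{A}(B):\exists\text{ prime }p\ge N,\ p\mid\gcd(f(\mathbf{X}),g(\mathbf{X}))\}\ll_{f,g}\frac{B(\log B)^{r-1}}{N\log N}+B(\log B)^{r-2}\log\log B.$$
   Context: $X$ is defined by a complete regular fan $\Delta$ in $N_\mathbb{R}$ ($M$ the dual lattice); $\Delta(1)$ is the set of rays with primitive generators $n_\rho$, $\Delta_{\max}$ the maximal cones. For $\sigma\in\Delta_{\max}$, $m_\sigma\in M$ is the unique element with $\langle m_\sigma,n_\rho\rangle=1$ for all rays $\rho$ of $\sigma$, and $a_\rho(\sigma)=1-\langle m_\sigma,n_\rho\rangle\ge0$. For $\mathbf{X}=(X_\rho)$ with positive entries, $\mathbf{X}^{D_0(\sigma)}=\prod_\rho X_\rho^{a_\rho(\sigma)}$, and $\mathcal{A}(B)=\{\mathbf{X}\in\mathbb{Z}_{\ge1}^{\Delta(1)}:\max_{\sigma\in\Delta_{\max}}\mathbf{X}^{D_0(\sigma)}\le B\}$. -}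

module Defs where

open import Data.Bool.Base using (if_then_else_)
open import Data.Fin.Base using (Fin; toℕ)
open import Data.Fin.Subset using (Subset; _∈_; _∉_; _∩_)
open import Data.Integer.Base as ℤ using (ℤ; +_; -[1+_]; 0ℤ; 1ℤ)
import Data.Integer.Properties as ℤ
import Data.Integer.Divisibility as ℤ
import Data.Integer.GCD as ℤ
open import Data.List.Base using (List; [_]; foldr; map; cartesianProductWith; length)
open import Data.List.Relation.Unary.All using (All)
open import Data.List.Relation.Unary.Unique.Propositional using (Unique)
open import Data.Nat.Base as ℕ using (ℕ; suc)
import Data.Nat.Properties as ℕ
open import Data.Nat.Primality using (Prime)
open import Data.Product.Base using (_×_; _,_; ∃; ∃-syntax; Σ-syntax; map₁)
open import Data.Rational.Base as ℚ using (ℚ; 0ℚ; 1ℚ)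
import Data.Rational.Properties as ℚ
open import Data.Vec.Base as Vec using (Vec)
import Data.Vec.Functional as VecF
open VecF using (Vector)
open import Data.Vec.Properties using (≡-dec)
open import Relation.Binary.PropositionalEquality.Core using (_≡_)
open import Relation.Nullary using (¬_; does; yes; no)

import Algebra.Properties.CommutativeMonoid.Sum as Sum
open Sum ℤ.+-0-commutativeMonoid using () renaming (sum to ∑ℤ)
open Sum ℚ.+-0-commutativeMonoid using () renaming (sum to ∑ℚ)
open Sum ℕ.*-1-commutativeMonoid using () renaming (sum to ∏ℕ)
open import Algebra.Bundles using (module CommutativeRing)
open import Algebra.Properties.Semiring.Exp
  (CommutativeRing.semiring ℚ.+-*-commutativeRing) using () renaming (_^_ to _^ℚ_)

------------------------------------------------------------------------
-- Real numbers

-- A real number is a Cauchy sequence of rationals; real-valued expressions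
-- are evaluated term by term on the sequences.

Seq : Set
Seq = ℕ → ℚ

IsCauchy : Seq → Set
IsCauchy x = ∀ ε → 0ℚ ℚ.< ε →
  ∃[ K ] ∀ i j → K ℕ.≤ i → K ℕ.≤ j → ℚ.∣ x i ℚ.- x j ∣ ℚ.≤ ε

record ℝ : Set where
  field
    seq    : Seq
    cauchy : IsCauchy seq

open ℝ public

infix 4 _≤ℝ_

-- For Cauchy sequences this is ≤ of the limits.
_≤ℝ_ : Seq → Seq → Set
x ≤ℝ y = ∀ ε → 0ℚ ℚ.< ε → ∃[ K ] ∀ k → K ℕ.≤ k → x k ℚ.≤ y k ℚ.+ ε

ℕ→ℚ : ℕ → ℚ
ℕ→ℚ m = + m ℚ./ 1

ι : ℕ → Seq
ι m _ = ℕ→ℚ m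

-- Totalised by inv 0 = 0.
inv : ℚ → ℚ
inv q with q ℚ.≟ 0ℚ
... | yes _   = 0ℚ
... | no  q≢0 = ℚ.1/_ q {{ℚ.≢-nonZero q≢0}}

infixr 8 _^ℤ_

_^ℤ_ : ℚ → ℤ → ℚ
q ^ℤ (+ n)    = q ^ℚ n
q ^ℤ -[1+ n ] = inv (q ^ℚ suc n)

-- Partial sums of log q = 2 artanh z = 2 ∑ z²ⁱ⁺¹/(2i+1), z = (q-1)/(q+1).
logSum : ℕ → ℚ → ℚ
logSum k q = ℕ→ℚ 2 ℚ.* ∑ℚ {k} λ i →
    z ^ℚ suc (2 ℕ.* toℕ i) ℚ.* (+ 1 ℚ./ suc (2 ℕ.* toℕ i))
  where
  z : ℚ
  z = (q ℚ.- 1ℚ) ℚ.* inv (q ℚ.+ 1ℚ)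

-- The partial sums converge locally uniformly on (0,∞), so this diagonal
-- sequence represents log x whenever x represents a positive real number.
log : Seq → Seq
log x k = logSum k (x k)

-- C (B (log B)^(r-1) / (N log N) + B (log B)^(r-2) log log B), where the
-- exponents are integers (r-2 is negative for r ≤ 1).  For B ≥ 3 and N ≥ 2
-- the quantities inverted are eventually bounded away from 0.
bound : ℕ → ℕ → Seq → Seq → Seq
bound C r B N k = ℕ→ℚ C ℚ.*
  (B k ℚ.* log B k ^ℤ (r ℤ.⊖ 1) ℚ.* inv (N k ℚ.* log N k)
   ℚ.+ B k ℚ.* log B k ^ℤ (r ℤ.⊖ 2) ℚ.* log (log B) k)

-- #{a : P a} ≤ x; this includes finiteness when x is bounded.
Card≤ : {A : Set} → (A → Set) → Seq → Set
Card≤ P x = ∀ as → Unique as → All P as → ι (length as) ≤ℝ x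

------------------------------------------------------------------------
-- Polynomials in x_ρ, ρ ∈ Fin n

-- Formal sums of terms (coefficient , exponents); exponents may repeat.
Poly : Set → ℕ → Set
Poly A n = List (A × Vec ℕ n)

monomial : ∀ {n} → Vec ℕ n → Vec ℕ n → ℕ
monomial X e = ∏ℕ λ ρ → Vec.lookup X ρ ℕ.^ Vec.lookup e ρ

eval : ∀ {n} → Poly ℤ n → Vec ℕ n → ℤ
eval f X = foldr (λ (c , e) s → c ℤ.* + monomial X e ℤ.+ s) 0ℤ f

coeff : ∀ {n} → Poly ℚ n → Vec ℕ n → ℚ
coeff f e = foldr
  (λ (c , e′) s → if does (≡-dec ℕ._≟_ e′ e) then c ℚ.+ s else s) 0ℚ f

infix 4 _≈ₚ_ _∣ₚ_
infixl 7 _*ₚ_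

_≈ₚ_ : ∀ {n} → Poly ℚ n → Poly ℚ n → Set
f ≈ₚ g = ∀ e → coeff f e ≡ coeff g e

_*ₚ_ : ∀ {n} → Poly ℚ n → Poly ℚ n → Poly ℚ n
_*ₚ_ = cartesianProductWith λ (c , e) (c′ , e′) → c ℚ.* c′ , Vec.zipWith ℕ._+_ e e′

1ₚ : ∀ {n} → Poly ℚ n
1ₚ = [ (1ℚ , Vec.replicate _ 0) ]

_∣ₚ_ : ∀ {n} → Poly ℚ n → Poly ℚ n → Set
h ∣ₚ f = ∃[ q ] (h *ₚ q ≈ₚ f)

overℚ : ∀ {n} → Poly ℤ n → Poly ℚ n
overℚ = map (map₁ (ℚ._/ 1))

-- Every common divisor in ℚ[x_ρ] is a unit; as ℚ[x_ρ] is factorial, this says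
-- that f = g = 0 contains no hypersurface and is not all of affine n-space.
Coprime : ∀ {n} → Poly ℤ n → Poly ℤ n → Set
Coprime f g = ∀ h → h ∣ₚ overℚ f → h ∣ₚ overℚ g → h ∣ₚ 1ₚ

------------------------------------------------------------------------
-- Fans.  The lattice N is ℤᵈ, M is its dual, identified with ℤᵈ by ⟨_,_⟩.

Lattice : ℕ → Set
Lattice d = Vector ℤ d

⟨_,_⟩ : ∀ {d} → Lattice d → Lattice d → ℤ
⟨ m , v ⟩ = ∑ℤ λ i → m i ℤ.* v i

-- Rational points of the cone generated by the gen ρ with ρ ∈ S.
InCone : ∀ {d n} → Vector (Lattice d) n → Subset n → Vector ℚ d → Set
InCone {n = n} gen S v = Σ[ c ∈ Vector ℚ n ]
    (∀ ρ → 0ℚ ℚ.≤ c ρ)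
  × (∀ ρ → ρ ∉ S → c ρ ≡ 0ℚ)
  × (∀ i → v i ≡ ∑ℚ λ ρ → c ρ ℚ.* (gen ρ i ℚ./ 1))

-- A fan is given by its maximal cones.  In a complete fan these are the
-- d-dimensional cones, so regularity says that the generators of each form a
-- basis of N.  It also makes the generators primitive, and makes the faces of a
-- cone σ the cones on the subsets of rays σ; hence `intersect` says that two
-- cones meet in a common face.  In particular the generators are distinct.
-- Completeness over ℚ is equivalent to completeness over the reals, the cones
-- being closed, rational and finite in number.
record CompleteRegularFan (d n : ℕ) : Set where
  field
    gen       : Vector (Lattice d) n
    numMax    : ℕ
    rays      : Vector (Subset n) numMax
    ray-used  : ∀ ρ → ∃[ σ ] ρ ∈ rays σ
    spanning  : ∀ σ (v : Lattice d) → Σ[ c ∈ Vector ℤ n ]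
                  (∀ ρ → ρ ∉ rays σ → c ρ ≡ 0ℤ)
                × (∀ i → v i ≡ ∑ℤ λ ρ → c ρ ℤ.* gen ρ i)
    independent : ∀ σ (c : Vector ℤ n) →
                  (∀ ρ → ρ ∉ rays σ → c ρ ≡ 0ℤ) →
                  (∀ i → (∑ℤ λ ρ → c ρ ℤ.* gen ρ i) ≡ 0ℤ) →
                  ∀ ρ → c ρ ≡ 0ℤ
    intersect : ∀ σ τ v → InCone gen (rays σ) v → InCone gen (rays τ) v →
                  InCone gen (rays σ ∩ rays τ) v
    complete  : ∀ v → ∃[ σ ] InCone gen (rays σ) v

module _ {d n : ℕ} (Δ : CompleteRegularFan d n) where
  open CompleteRegularFan Δ

  -- D stands for the torus-invariant divisor ∑ D_ρ D_ρ.
  Divisor : Set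
  Divisor = Vector ℤ n

  -K : Divisor
  -K _ = 1ℤ

  -- The character m is a section of O(D) on X, resp. on the chart U_σ.
  Section : Divisor → Lattice d → Set
  Section D m = ∀ ρ → ℤ.- D ρ ℤ.≤ ⟨ m , gen ρ ⟩

  LocalSection : Divisor → Fin numMax → Lattice d → Set
  LocalSection D σ m = ∀ ρ → ρ ∈ rays σ → ℤ.- D ρ ℤ.≤ ⟨ m , gen ρ ⟩

  -- Global sections generate O(D) on each U_σ: every local character section is
  -- a global one times a character regular on U_σ.  The modules of sections
  -- are spanned by characters and M-graded, so characters suffice.
  GloballyGenerated : Divisor → Set
  GloballyGenerated D = ∀ σ m → LocalSection D σ m → ∃[ m′ ]
    Section D m′ × (∀ ρ → ρ ∈ rays σ → ⟨ m′ , gen ρ ⟩ ℤ.≤ ⟨ m , gen ρ ⟩)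

  -- D has a strictly convex support function; equivalently, for every σ some
  -- character section of O(D) has non-vanishing locus exactly U_σ.
  Ample : Divisor → Set
  Ample D = ∀ σ → ∃[ u ]
      (∀ ρ → ρ ∈ rays σ → ⟨ u , gen ρ ⟩ ≡ ℤ.- D ρ)
    × (∀ ρ → ρ ∉ rays σ → ℤ.- D ρ ℤ.< ⟨ u , gen ρ ⟩)

  Projective : Set
  Projective = ∃ Ample

  Principal : Divisor → Set
  Principal D = ∃[ m ] ∀ ρ → D ρ ≡ ⟨ m , gen ρ ⟩

  -- ℤ-linear independence of classes in Pic X = ℤ^Δ(1) / principal divisors.
  PicIndependent : ∀ {k} → Vector Divisor k → Set
  PicIndependent {k} D = (c : Vector ℤ k) →
    Principal (λ ρ → ∑ℤ λ i → c i ℤ.* D i ρ) → ∀ i → c i ≡ 0ℤ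

  RankPic : ℕ → Set
  RankPic r = ∃ (PicIndependent {r}) × (∀ D → ¬ PicIndependent {suc r} D)

  IsDualFamily : Vector (Lattice d) numMax → Set
  IsDualFamily m = ∀ σ ρ → ρ ∈ rays σ → ⟨ m σ , gen ρ ⟩ ≡ 1ℤ

  module _ (m : Vector (Lattice d) numMax) where

    -- a_ρ(σ) is non-negative when -K is globally generated and m is the dual
    -- family, so taking the absolute value in D₀-power only changes its type.
    a : Fin numMax → Fin n → ℤ
    a σ ρ = 1ℤ ℤ.- ⟨ m σ , gen ρ ⟩

    D₀-power : Vec ℕ n → Fin numMax → ℕ
    D₀-power X σ = ∏ℕ λ ρ → Vec.lookup X ρ ℕ.^ ℤ.∣ a σ ρ ∣

    height : Vec ℕ n → ℕ
    height X = VecF.foldr ℕ._⊔_ 0 (D₀-power X)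

    𝓐 : ℝ → Vec ℕ n → Set
    𝓐 B X = (∀ ρ → 1 ℕ.≤ Vec.lookup X ρ) × ι (height X) ≤ℝ seq B

LargeCommonPrime : ∀ {n} → Poly ℤ n → Poly ℤ n → ℝ → Vec ℕ n → Set
LargeCommonPrime f g N X = ∃[ p ]
  Prime p × seq N ≤ℝ ι p × + p ℤ.∣ ℤ.gcd (eval f X) (eval g X)

{-# OPTIONS --safe #-}

module Submission where

-- Cut the region into dyadic boxes X_ρ ∈ [2^k_ρ , 2^(k_ρ+1)), and let 2^L be the
-- size of B.  The vector -∑ k_ρ n_ρ lies in some maximal cone τ, with
-- coordinates c; then e = k + c is a relation between the n_ρ with
-- ∑ e_ρ = ∑ a_ρ(τ) k_ρ ≤ L.  A relation is determined by its coordinates outside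
-- a maximal cone, so there are at most (L+1)^(r-1) of them of given degree, and
-- as ∑_c 2^(-∑ c) converges the boxes have total volume ≪ 2^L L^(r-1).
-- For the boxes with some k_ρ₀ < K, where 2^K is about L², either one more
-- coordinate of e is confined to K values, or ∑ e is proportional to e_ρ₀, which
-- saves a power of 2^L; this gives the term with log log B.
--
-- In the remaining boxes all sides are at least 2^K.  For p ≤ 2^K the common
-- zeros of f and g modulo p have density ≪ 1/p², and Chebyshev's bound makes the
-- sum over p ≥ N of these ≪ 1/(N log N).  The primes p > 2^K divide the value of
-- an eliminant R(x₂,…,xₙ) in the ideal (f , g): either R vanishes, or it has ≪ L
-- prime factors, each leaving ≪ 1/2^K of the values of x₁, unless all coefficients
-- with respect to x₁ vanish modulo p; these coefficients are again jointly coprime,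
-- which allows induction on the number of variables.  The eliminant exists as
-- ℤ[x₂,…,xₙ] has greatest common divisors, by Gauss' lemma.

open import Algebra.Bundles using (CommutativeRing)
open import Level using (0ℓ)
open import Relation.Binary.Bundles using (Setoid)
open import Data.Empty using (⊥-elim)
open import Data.List.Base as List using (List; []; _∷_; length)
open import Data.Nat.Base as ℕ using (ℕ; zero; suc; z≤n; s≤s)
open import Data.Product.Base using (_×_; _,_; ∃-syntax; proj₁; proj₂)
open import Data.Sum.Base using (_⊎_; inj₁; inj₂; [_,_]′)
open import Relation.Nullary using (¬_; Dec; yes; no)
open import Relation.Binary.PropositionalEquality as ≡ using (_≡_)
open import Data.List.Properties using (length-map)
import Algebra.Properties.Ring as RingProperties
import Data.Nat.Properties as ℕ
import Relation.Binary.Reasoning.Setoid as SetoidReasoning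

module Divide (R : CommutativeRing 0ℓ 0ℓ) where
  open CommutativeRing R hiding (zero)
  open RingProperties ring using (-‿distribʳ-*; x+x≈x⇒x≈0) public
  open SetoidReasoning setoid

  infix 4 _∣_
  _∣_ : Carrier → Carrier → Set
  c ∣ x = ∃[ q ] c * q ≈ x

  ∣-resp : ∀ {c x y} → x ≈ y → c ∣ x → c ∣ y
  ∣-resp x≈y (q , e) = q , trans e x≈y

  ∣-refl : ∀ {c} → c ∣ c
  ∣-refl = 1# , *-identityʳ _

  ∣-0 : ∀ {c} → c ∣ 0#
  ∣-0 = 0# , zeroʳ _

  ∣-+ : ∀ {c x y} → c ∣ x → c ∣ y → c ∣ x + y
  ∣-+ (q , e) (r , f) = q + r , trans (distribˡ _ _ _) (+-cong e f)

  ∣-*ˡ : ∀ {c x} y → c ∣ x → c ∣ y * x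
  ∣-*ˡ {c} {x} y (q , e) = q * y , (begin
    c * (q * y)  ≈⟨ *-assoc c q y ⟨
    c * q * y    ≈⟨ *-congʳ e ⟩
    x * y        ≈⟨ *-comm x y ⟩
    y * x        ∎)

  ∣-*ʳ : ∀ {c x} y → c ∣ x → c ∣ x * y
  ∣-*ʳ y d = ∣-resp (*-comm _ _) (∣-*ˡ y d)

  ∣-trans : ∀ {a b c} → a ∣ b → b ∣ c → a ∣ c
  ∣-trans {a} (q , e) (r , f) = q * r , trans (sym (*-assoc a q r)) (trans (*-congʳ e) f)

  ∣-- : ∀ {c x} → c ∣ x → c ∣ - x
  ∣-- (q , e) = - q , trans (sym (-‿distribʳ-* _ _)) (-‿cong e)

  ∣-cancel : ∀ {c x y} → c ∣ x → c ∣ x + y → c ∣ y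
  ∣-cancel {c} {x} {y} d e = ∣-resp eq (∣-+ (∣-- d) e)
    where
    eq : - x + (x + y) ≈ y
    eq = begin
      - x + (x + y)  ≈⟨ +-assoc (- x) x y ⟨
      - x + x + y    ≈⟨ +-congʳ (-‿inverseˡ x) ⟩
      0# + y         ≈⟨ +-identityˡ y ⟩
      y              ∎

  -- The constructive form of coprimality, used in place of gcd (s u , s v) = s.
  Coprime₂ : Carrier → Carrier → Set
  Coprime₂ u v = ∀ c s → c ∣ s * u → c ∣ s * v → c ∣ s

record GCDDomain : Set₁ where
  field
    commutativeRing : CommutativeRing 0ℓ 0ℓ
  open CommutativeRing commutativeRing public hiding (zero)
  open Divide commutativeRing public
  field
    zero?      : ∀ x → Dec (x ≈ 0#)
    1≉0        : ¬ 1# ≈ 0#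
    integral   : ∀ {x y} → ¬ x ≈ 0# → x * y ≈ 0# → y ≈ 0#
    reduce     : ∀ a b → ∃[ d ] ∃[ u ] ∃[ v ] d * u ≈ a × d * v ≈ b × Coprime₂ u v

module Polynomial (R : CommutativeRing 0ℓ 0ℓ) where
  open CommutativeRing R hiding (zero)

  coef : List Carrier → ℕ → Carrier
  coef []      _       = 0#
  coef (a ∷ f) zero    = a
  coef (a ∷ f) (suc i) = coef f i

  infix 4 _≋_
  record _≋_ (f g : List Carrier) : Set where
    constructor mk
    field at : ∀ i → coef f i ≈ coef g i
  open _≋_ public

  ≋-refl : ∀ {f} → f ≋ f
  ≋-refl = mk λ i → refl

  ≋-sym : ∀ {f g} → f ≋ g → g ≋ f
  ≋-sym e = mk λ i → sym (at e i)

  ≋-trans : ∀ {f g h} → f ≋ g → g ≋ h → f ≋ h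
  ≋-trans d e = mk λ i → trans (at d i) (at e i)

  ∷-cong : ∀ {a b f g} → a ≈ b → f ≋ g → a ∷ f ≋ b ∷ g
  ∷-cong e d = mk λ { zero → e ; (suc i) → at d i }

  ∷-injʳ : ∀ {a b f g} → a ∷ f ≋ b ∷ g → f ≋ g
  ∷-injʳ e = mk λ i → at e (suc i)

  0∷≋[] : ∀ {a f} → a ≈ 0# → f ≋ [] → a ∷ f ≋ []
  0∷≋[] e d = mk λ { zero → e ; (suc i) → at d i }

  infixl 6 _⊕_
  infixl 7 _⊛_ _·_
  _⊕_ : List Carrier → List Carrier → List Carrier
  []      ⊕ g       = g
  (a ∷ f) ⊕ []      = a ∷ f
  (a ∷ f) ⊕ (b ∷ g) = (a + b) ∷ (f ⊕ g)

  _·_ : Carrier → List Carrier → List Carrier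
  a · f = List.map (a *_) f

  _⊛_ : List Carrier → List Carrier → List Carrier
  []      ⊛ g = []
  (a ∷ f) ⊛ g = a · g ⊕ (0# ∷ f ⊛ g)

  ⊝_ : List Carrier → List Carrier
  ⊝ f = List.map -_ f

  coef-⊕ : ∀ f g i → coef (f ⊕ g) i ≈ coef f i + coef g i
  coef-⊕ []      g       i       = sym (+-identityˡ _)
  coef-⊕ (a ∷ f) []      i       = sym (+-identityʳ _)
  coef-⊕ (a ∷ f) (b ∷ g) zero    = refl
  coef-⊕ (a ∷ f) (b ∷ g) (suc i) = coef-⊕ f g i

  coef-· : ∀ a f i → coef (a · f) i ≈ a * coef f i
  coef-· a []      i       = sym (zeroʳ a)
  coef-· a (b ∷ f) zero    = refl
  coef-· a (b ∷ f) (suc i) = coef-· a f i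

  coef-⊝ : ∀ f i → coef (⊝ f) i ≈ - coef f i
  coef-⊝ []      i       = sym -0#≈0#
    where open RingProperties ring using (-0#≈0#)
  coef-⊝ (b ∷ f) zero    = refl
  coef-⊝ (b ∷ f) (suc i) = coef-⊝ f i

  ⊕-cong : ∀ {f f′ g g′} → f ≋ f′ → g ≋ g′ → f ⊕ g ≋ f′ ⊕ g′
  ⊕-cong {f} {f′} {g} {g′} d e = mk λ i →
    trans (coef-⊕ f g i) (trans (+-cong (at d i) (at e i)) (sym (coef-⊕ f′ g′ i)))

  ·-cong : ∀ {a b f g} → a ≈ b → f ≋ g → a · f ≋ b · g
  ·-cong {a} {b} {f} {g} d e = mk λ i →
    trans (coef-· a f i) (trans (*-cong d (at e i)) (sym (coef-· b g i)))

  ⊝-cong : ∀ {f g} → f ≋ g → ⊝ f ≋ ⊝ g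
  ⊝-cong {f} {g} e = mk λ i →
    trans (coef-⊝ f i) (trans (-‿cong (at e i)) (sym (coef-⊝ g i)))

  ⊕-assoc : ∀ f g h → (f ⊕ g) ⊕ h ≋ f ⊕ (g ⊕ h)
  ⊕-assoc f g h = mk λ i → begin
    coef ((f ⊕ g) ⊕ h) i               ≈⟨ coef-⊕ (f ⊕ g) h i ⟩
    coef (f ⊕ g) i + coef h i          ≈⟨ +-congʳ (coef-⊕ f g i) ⟩
    coef f i + coef g i + coef h i     ≈⟨ +-assoc _ _ _ ⟩
    coef f i + (coef g i + coef h i)   ≈⟨ +-congˡ (coef-⊕ g h i) ⟨
    coef f i + coef (g ⊕ h) i          ≈⟨ coef-⊕ f (g ⊕ h) i ⟨
    coef (f ⊕ (g ⊕ h)) i               ∎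
    where open SetoidReasoning setoid

  ⊕-comm : ∀ f g → f ⊕ g ≋ g ⊕ f
  ⊕-comm f g = mk λ i →
    trans (coef-⊕ f g i) (trans (+-comm _ _) (sym (coef-⊕ g f i)))

  ⊕-identityʳ : ∀ f → f ⊕ [] ≋ f
  ⊕-identityʳ []      = ≋-refl
  ⊕-identityʳ (a ∷ f) = ≋-refl

  ⊝-inverseʳ : ∀ f → f ⊕ ⊝ f ≋ []
  ⊝-inverseʳ f = mk λ i →
    trans (coef-⊕ f (⊝ f) i) (trans (+-congˡ (coef-⊝ f i)) (-‿inverseʳ _))

  ⊝-inverseˡ : ∀ f → ⊝ f ⊕ f ≋ []
  ⊝-inverseˡ f = ≋-trans (⊕-comm (⊝ f) f) (⊝-inverseʳ f)

  0·f≋[] : ∀ f → 0# · f ≋ []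
  0·f≋[] f = mk λ i → trans (coef-· 0# f i) (zeroˡ _)

  0∷[]≋[] : 0# ∷ [] ≋ []
  0∷[]≋[] = 0∷≋[] refl ≋-refl

  ·-distrib-⊕ : ∀ a f g → a · (f ⊕ g) ≋ a · f ⊕ a · g
  ·-distrib-⊕ a []      g       = ≋-refl
  ·-distrib-⊕ a (b ∷ f) []      = ≋-refl
  ·-distrib-⊕ a (b ∷ f) (c ∷ g) = ∷-cong (distribˡ a b c) (·-distrib-⊕ a f g)

  +-distrib-· : ∀ a b f → (a + b) · f ≋ a · f ⊕ b · f
  +-distrib-· a b []      = ≋-refl
  +-distrib-· a b (c ∷ f) = ∷-cong (distribʳ c a b) (+-distrib-· a b f)

  *-· : ∀ a b f → (a * b) · f ≋ a · (b · f)
  *-· a b []      = ≋-refl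
  *-· a b (c ∷ f) = ∷-cong (*-assoc a b c) (*-· a b f)

  1· : ∀ f → 1# · f ≋ f
  1· []      = ≋-refl
  1· (c ∷ f) = ∷-cong (*-identityˡ c) (1· f)

  ≋-setoid : Setoid 0ℓ 0ℓ
  ≋-setoid = record { Carrier = List Carrier ; _≈_ = _≋_
    ; isEquivalence = record { refl = ≋-refl ; sym = ≋-sym ; trans = ≋-trans } }

  open SetoidReasoning ≋-setoid

  interchange : ∀ f g h k → (f ⊕ g) ⊕ (h ⊕ k) ≋ (f ⊕ h) ⊕ (g ⊕ k)
  interchange f g h k = begin
    (f ⊕ g) ⊕ (h ⊕ k)  ≈⟨ ⊕-assoc f g (h ⊕ k) ⟩
    f ⊕ (g ⊕ (h ⊕ k))  ≈⟨ ⊕-cong (≋-refl {f}) (⊕-assoc g h k) ⟨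
    f ⊕ ((g ⊕ h) ⊕ k)  ≈⟨ ⊕-cong (≋-refl {f}) (⊕-cong (⊕-comm g h) (≋-refl {k})) ⟩
    f ⊕ ((h ⊕ g) ⊕ k)  ≈⟨ ⊕-cong (≋-refl {f}) (⊕-assoc h g k) ⟩
    f ⊕ (h ⊕ (g ⊕ k))  ≈⟨ ⊕-assoc f h (g ⊕ k) ⟨
    (f ⊕ h) ⊕ (g ⊕ k)  ∎

  ⊛-congˡ : ∀ f {g g′} → g ≋ g′ → f ⊛ g ≋ f ⊛ g′
  ⊛-congˡ []      e = ≋-refl
  ⊛-congˡ (a ∷ f) e = ⊕-cong (·-cong refl e) (∷-cong refl (⊛-congˡ f e))

  ⊛-[] : ∀ f → f ⊛ [] ≋ []
  ⊛-[] []      = ≋-refl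
  ⊛-[] (a ∷ f) = 0∷≋[] refl (⊛-[] f)

  ⊛-∷ : ∀ g a f → g ⊛ (a ∷ f) ≋ a · g ⊕ (0# ∷ g ⊛ f)
  ⊛-∷ []      a f = ≋-sym 0∷[]≋[]
  ⊛-∷ (b ∷ g) a f = ∷-cong (+-congʳ (*-comm b a)) (begin
    b · f ⊕ g ⊛ (a ∷ f)              ≈⟨ ⊕-cong (≋-refl {b · f}) (⊛-∷ g a f) ⟩
    b · f ⊕ (a · g ⊕ (0# ∷ g ⊛ f))   ≈⟨ ⊕-assoc (b · f) (a · g) _ ⟨
    b · f ⊕ a · g ⊕ (0# ∷ g ⊛ f)     ≈⟨ ⊕-cong (⊕-comm (b · f) (a · g)) ≋-refl ⟩
    a · g ⊕ b · f ⊕ (0# ∷ g ⊛ f)     ≈⟨ ⊕-assoc (a · g) (b · f) _ ⟩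
    a · g ⊕ (b · f ⊕ (0# ∷ g ⊛ f))   ∎)

  ⊛-comm : ∀ f g → f ⊛ g ≋ g ⊛ f
  ⊛-comm []      g = ≋-sym (⊛-[] g)
  ⊛-comm (a ∷ f) g = begin
    a · g ⊕ (0# ∷ f ⊛ g)  ≈⟨ ⊕-cong (≋-refl {a · g}) (∷-cong refl (⊛-comm f g)) ⟩
    a · g ⊕ (0# ∷ g ⊛ f)  ≈⟨ ⊛-∷ g a f ⟨
    g ⊛ (a ∷ f)           ∎

  ⊛-cong : ∀ {f f′ g g′} → f ≋ f′ → g ≋ g′ → f ⊛ g ≋ f′ ⊛ g′
  ⊛-cong {f} {f′} {g} {g′} d e = begin
    f ⊛ g    ≈⟨ ⊛-congˡ f e ⟩
    f ⊛ g′   ≈⟨ ⊛-comm f g′ ⟩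
    g′ ⊛ f   ≈⟨ ⊛-congˡ g′ d ⟩
    g′ ⊛ f′  ≈⟨ ⊛-comm g′ f′ ⟩
    f′ ⊛ g′  ∎

  ⊛-distribʳ : ∀ h f g → (f ⊕ g) ⊛ h ≋ f ⊛ h ⊕ g ⊛ h
  ⊛-distribʳ h []      g       = ≋-refl
  ⊛-distribʳ h (a ∷ f) []      = ≋-sym (⊕-identityʳ _)
  ⊛-distribʳ h (a ∷ f) (b ∷ g) = begin
    (a + b) · h ⊕ (0# ∷ (f ⊕ g) ⊛ h)
      ≈⟨ ⊕-cong (+-distrib-· a b h) (∷-cong (sym (+-identityˡ 0#)) (⊛-distribʳ h f g)) ⟩
    (a · h ⊕ b · h) ⊕ ((0# ∷ f ⊛ h) ⊕ (0# ∷ g ⊛ h))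
      ≈⟨ interchange (a · h) (b · h) _ _ ⟩
    (a · h ⊕ (0# ∷ f ⊛ h)) ⊕ (b · h ⊕ (0# ∷ g ⊛ h))  ∎

  ⊛-distribˡ : ∀ h f g → h ⊛ (f ⊕ g) ≋ h ⊛ f ⊕ h ⊛ g
  ⊛-distribˡ h f g = begin
    h ⊛ (f ⊕ g)    ≈⟨ ⊛-comm h (f ⊕ g) ⟩
    (f ⊕ g) ⊛ h    ≈⟨ ⊛-distribʳ h f g ⟩
    f ⊛ h ⊕ g ⊛ h  ≈⟨ ⊕-cong (⊛-comm f h) (⊛-comm g h) ⟩
    h ⊛ f ⊕ h ⊛ g  ∎

  ·-⊛ : ∀ a f g → (a · f) ⊛ g ≋ a · (f ⊛ g)
  ·-⊛ a []      g = ≋-refl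
  ·-⊛ a (b ∷ f) g = begin
    (a * b) · g ⊕ (0# ∷ (a · f) ⊛ g)   ≈⟨ ⊕-cong (*-· a b g) (∷-cong (sym (zeroʳ a)) (·-⊛ a f g)) ⟩
    a · (b · g) ⊕ a · (0# ∷ f ⊛ g)     ≈⟨ ·-distrib-⊕ a (b · g) _ ⟨
    a · (b · g ⊕ (0# ∷ f ⊛ g))         ∎

  0∷-⊛ : ∀ f g → (0# ∷ f) ⊛ g ≋ 0# ∷ f ⊛ g
  0∷-⊛ f g = ⊕-cong (0·f≋[] g) ≋-refl

  ⊛-assoc : ∀ f g h → (f ⊛ g) ⊛ h ≋ f ⊛ (g ⊛ h)
  ⊛-assoc []      g h = ≋-refl
  ⊛-assoc (a ∷ f) g h = begin
    (a · g ⊕ (0# ∷ f ⊛ g)) ⊛ h          ≈⟨ ⊛-distribʳ h (a · g) _ ⟩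
    (a · g) ⊛ h ⊕ (0# ∷ f ⊛ g) ⊛ h      ≈⟨ ⊕-cong (·-⊛ a g h) (0∷-⊛ (f ⊛ g) h) ⟩
    a · (g ⊛ h) ⊕ (0# ∷ (f ⊛ g) ⊛ h)    ≈⟨ ⊕-cong (≋-refl {a · (g ⊛ h)}) (∷-cong refl (⊛-assoc f g h)) ⟩
    a · (g ⊛ h) ⊕ (0# ∷ f ⊛ (g ⊛ h))    ∎

  const : Carrier → List Carrier
  const a = a ∷ []

  const-⊛ : ∀ a f → const a ⊛ f ≋ a · f
  const-⊛ a f = ≋-trans (⊕-cong (≋-refl {a · f}) 0∷[]≋[]) (⊕-identityʳ _)

  ⊛-identityˡ : ∀ f → const 1# ⊛ f ≋ f
  ⊛-identityˡ f = ≋-trans (const-⊛ 1# f) (1· f)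

  polynomialRing : CommutativeRing 0ℓ 0ℓ
  polynomialRing = record
    { Carrier = List Carrier ; _≈_ = _≋_ ; _+_ = _⊕_ ; _*_ = _⊛_ ; -_ = ⊝_
    ; 0# = [] ; 1# = const 1#
    ; isCommutativeRing = record
      { isRing = record
        { +-isAbelianGroup = record
          { isGroup = record
            { isMonoid = record
              { isSemigroup = record
                { isMagma = record
                  { isEquivalence = record { refl = ≋-refl ; sym = ≋-sym ; trans = ≋-trans }
                  ; ∙-cong = ⊕-cong }
                ; assoc = ⊕-assoc }
              ; identity = (λ f → ≋-refl) , ⊕-identityʳ }
            ; inverse = ⊝-inverseˡ , ⊝-inverseʳ
            ; ⁻¹-cong = ⊝-cong }
          ; comm = ⊕-comm }
        ; *-cong = ⊛-cong
        ; *-assoc = ⊛-assoc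
        ; *-identity = ⊛-identityˡ , λ f → ≋-trans (⊛-comm f (const 1#)) (⊛-identityˡ f)
        ; distrib = ⊛-distribˡ , ⊛-distribʳ }
      ; *-comm = ⊛-comm } }

  coef-const-⊛ : ∀ a f i → coef (const a ⊛ f) i ≈ a * coef f i
  coef-const-⊛ a f i = trans (at (const-⊛ a f) i) (coef-· a f i)

  const-cong : ∀ {a b} → a ≈ b → const a ≋ const b
  const-cong e = ∷-cong e ≋-refl

  const-* : ∀ a b → const a ⊛ const b ≋ const (a * b)
  const-* a b = const-⊛ a (const b)

module Bézout (R : CommutativeRing 0ℓ 0ℓ) where
  open CommutativeRing R
  open import Algebra.Solver.Ring.NaturalCoefficients.Default commutativeSemiring using (solve; _:+_; _:*_; _:=_)

  combine : ∀ α m z f g → α * (f + m * g) + z * g ≈ α * f + (z + α * m) * g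
  combine = solve 5 (λ α m z f g → α :* (f :+ m :* g) :+ z :* g := α :* f :+ (z :+ α :* m) :* g) refl

  combine′ : ∀ α b m z u v → (α * b) * (u + m * v) + z * (b * v) ≈ b * (α * u + (z + α * m) * v)
  combine′ = solve 6 (λ α b m z u v → (α :* b) :* (u :+ m :* v) :+ z :* (b :* v) := b :* (α :* u :+ (z :+ α :* m) :* v)) refl

  expand : ∀ c f g m → c * (f + m * g) ≈ c * f + m * (c * g)
  expand = solve 4 (λ c f g m → c :* (f :+ m :* g) := c :* f :+ m :* (c :* g)) refl

  factor : ∀ h m u v → h * u + m * (h * v) ≈ h * (u + m * v)
  factor = solve 4 (λ h m u v → h :* u :+ m :* (h :* v) := h :* (u :+ m :* v)) refl

  swap : ∀ a b c → a * (b * c) ≈ b * (a * c)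
  swap = solve 3 (λ a b c → a :* (b :* c) := b :* (a :* c)) refl

  pull : ∀ k α β u v → α * (k * u) + β * (k * v) ≈ k * (α * u + β * v)
  pull = solve 5 (λ k α β u v → α :* (k :* u) :+ β :* (k :* v) := k :* (α :* u :+ β :* v)) refl

  collect : ∀ α β p q u → (α * p + β * q) * u ≈ α * (p * u) + β * (u * q)
  collect = solve 5 (λ α β p q u → (α :* p :+ β :* q) :* u := α :* (p :* u) :+ β :* (u :* q)) refl

  collect′ : ∀ α β p u v → α * (p * u) + β * (v * p) ≈ (α * u + β * v) * p
  collect′ = solve 5 (λ α β p u v → α :* (p :* u) :+ β :* (v :* p) := (α :* u :+ β :* v) :* p) refl

  gather : ∀ e α β p q → e * (α * p + β * q) ≈ α * (e * p) + β * (e * q)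
  gather = solve 5 (λ e α β p q → e :* (α :* p :+ β :* q) := α :* (e :* p) :+ β :* (e :* q)) refl

  rotate : ∀ s u v → (s * u) * v ≈ (s * v) * u
  rotate = solve 3 (λ s u v → (s :* u) :* v := (s :* v) :* u) refl

  open SetoidReasoning setoid

  record Relation (f g c : Carrier) : Set where
    field
      h α β u v : Carrier
      h-def  : α * f + β * g ≈ h
      f-mult : c * f ≈ h * u
      g-mult : c * g ≈ h * v
      unit   : α * u + β * v ≈ c

  relation-swap : ∀ {f g c} → Relation f g c → Relation g f c
  relation-swap r = record { h = h ; α = β ; β = α ; u = v ; v = u
    ; h-def = trans (+-comm _ _) h-def ; f-mult = g-mult ; g-mult = f-mult
    ; unit = trans (+-comm _ _) unit }
    where open Relation r

  relation-0 : ∀ {f g} → f ≈ 0# → Relation f g 1#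
  relation-0 {f} {g} e = record { h = g ; α = 0# ; β = 1# ; u = 0# ; v = 1#
    ; h-def = trans (+-cong (zeroˡ f) (*-identityˡ g)) (+-identityˡ g)
    ; f-mult = trans (*-identityˡ f) (trans e (sym (zeroʳ g)))
    ; g-mult = *-comm 1# g
    ; unit = trans (+-cong (zeroˡ 0#) (*-identityˡ 1#)) (+-identityˡ 1#) }

  relation-resp : ∀ {f g c c′} → c ≈ c′ → Relation f g c → Relation f g c′
  relation-resp e r = record { h = h ; α = α ; β = β ; u = u ; v = v ; h-def = h-def
    ; f-mult = trans (*-congʳ (sym e)) f-mult ; g-mult = trans (*-congʳ (sym e)) g-mult
    ; unit = trans unit e }
    where open Relation r

  relation-step : ∀ {f f₁ g b c} m → f₁ + m * g ≈ b * f → Relation f₁ g c → Relation f g (b * c)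
  relation-step {f} {f₁} {g} {b} {c} m e r = record
    { h = h ; α = α * b ; β = z ; u = u + m * v ; v = b * v
    ; h-def = begin
        (α * b) * f + z * g           ≈⟨ +-congʳ (trans (*-assoc α b f) (*-congˡ (sym e))) ⟩
        α * (f₁ + m * g) + z * g      ≈⟨ combine α m z f₁ g ⟩
        α * f₁ + (z + α * m) * g      ≈⟨ +-congˡ (*-congʳ zβ) ⟩
        α * f₁ + β * g                ≈⟨ h-def ⟩
        h                             ∎
    ; f-mult = begin
        (b * c) * f                   ≈⟨ trans (*-assoc b c f) (swap b c f) ⟩
        c * (b * f)                   ≈⟨ *-congˡ e ⟨
        c * (f₁ + m * g)              ≈⟨ expand c f₁ g m ⟩
        c * f₁ + m * (c * g)          ≈⟨ +-cong f-mult (*-congˡ g-mult) ⟩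
        h * u + m * (h * v)           ≈⟨ factor h m u v ⟩
        h * (u + m * v)               ∎
    ; g-mult = begin
        (b * c) * g                   ≈⟨ *-assoc b c g ⟩
        b * (c * g)                   ≈⟨ *-congˡ g-mult ⟩
        b * (h * v)                   ≈⟨ swap b h v ⟩
        h * (b * v)                   ∎
    ; unit = begin
        (α * b) * (u + m * v) + z * (b * v)  ≈⟨ combine′ α b m z u v ⟩
        b * (α * u + (z + α * m) * v)        ≈⟨ *-congˡ (+-congˡ (*-congʳ zβ)) ⟩
        b * (α * u + β * v)                  ≈⟨ *-congˡ unit ⟩
        b * c                                ∎ }
    where
    open Relation r
    z = β + - (α * m)
    zβ : z + α * m ≈ β
    zβ = trans (+-assoc _ _ _) (trans (+-congˡ (-‿inverseˡ _)) (+-identityʳ β))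

module PolynomialGCD (D : GCDDomain) where
  open GCDDomain D
  open Polynomial commutativeRing
  private module P = CommutativeRing polynomialRing
  private module PB = Bézout polynomialRing
  open Divide polynomialRing using () renaming (_∣_ to _∣ₗ_; Coprime₂ to Coprimeₗ)

  cancel : ∀ {c x y} → ¬ c ≈ 0# → c * x ≈ c * y → x ≈ y
  cancel {c} {x} {y} c≉0 e = begin
    x              ≈⟨ +-identityʳ x ⟨
    x + 0#         ≈⟨ +-congˡ (-‿inverseˡ y) ⟨
    x + (- y + y)  ≈⟨ +-assoc x (- y) y ⟨
    x + - y + y    ≈⟨ +-congʳ (integral c≉0 x-y) ⟩
    0# + y         ≈⟨ +-identityˡ y ⟩
    y              ∎
    where
    open SetoidReasoning setoid
    x-y : c * (x + - y) ≈ 0#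
    x-y = begin
      c * (x + - y)      ≈⟨ distribˡ c x (- y) ⟩
      c * x + c * - y    ≈⟨ +-cong e (sym (-‿distribʳ-* c y)) ⟩
      c * y + - (c * y)  ≈⟨ -‿inverseʳ _ ⟩
      0#                 ∎

  const-cancel : ∀ {c f g} → ¬ c ≈ 0# → const c ⊛ f ≋ const c ⊛ g → f ≋ g
  const-cancel {c} {f} {g} c≉0 e = mk λ i → cancel c≉0
    (trans (sym (coef-const-⊛ c f i)) (trans (at e i) (coef-const-⊛ c g i)))

  ≋[]? : ∀ f → Dec (f ≋ [])
  ≋[]? [] = yes ≋-refl
  ≋[]? (a ∷ f) with zero? a | ≋[]? f
  ... | yes a≈0 | yes f≋[] = yes (0∷≋[] a≈0 f≋[])
  ... | no a≉0  | _        = no λ e → a≉0 (at e 0)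
  ... | _       | no f≢[]  = no λ e → f≢[] (mk λ i → at e (suc i))

  integralₗ : ∀ {f g} → ¬ f ≋ [] → f ⊛ g ≋ [] → g ≋ []
  integralₗ {[]} f≢[] e = ⊥-elim (f≢[] ≋-refl)
  integralₗ {a ∷ f} {g} f≢[] e with zero? a
  ... | yes a≈0 = integralₗ {f} (λ f≋[] → f≢[] (0∷≋[] a≈0 f≋[])) (mk λ i → at e′ (suc i))
    where
    e′ : 0# ∷ f ⊛ g ≋ []
    e′ = ≋-trans (≋-sym (⊕-cong (≋-trans (·-cong a≈0 ≋-refl) (0·f≋[] g)) (≋-refl {0# ∷ f ⊛ g}))) e
  ... | no a≉0 = go g e
    where
    go : ∀ g → (a ∷ f) ⊛ g ≋ [] → g ≋ []
    go []      e = ≋-refl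
    go (b ∷ g) e = 0∷≋[] b≈0 (go g (mk λ i → at e′ (suc i)))
      where
      b≈0 : b ≈ 0#
      b≈0 = integral a≉0 (trans (sym (+-identityʳ _)) (at e 0))
      e′ : 0# ∷ (a ∷ f) ⊛ g ≋ []
      e′ = ≋-trans (≋-sym (⊕-cong (≋-trans (·-cong b≈0 ≋-refl) (0·f≋[] (a ∷ f))) (≋-refl {0# ∷ (a ∷ f) ⊛ g})))
                   (≋-trans (≋-sym (⊛-∷ (a ∷ f) b g)) e)

  _∣ᶜ_ : Carrier → List Carrier → Set
  c ∣ᶜ f = ∀ i → c ∣ coef f i

  ∣ᶜ-resp : ∀ {c f g} → f ≋ g → c ∣ᶜ f → c ∣ᶜ g
  ∣ᶜ-resp e d i = ∣-resp (at e i) (d i)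

  ∣ᶜ-cancel : ∀ {c} f g → c ∣ᶜ f → c ∣ᶜ (f ⊕ g) → c ∣ᶜ g
  ∣ᶜ-cancel f g d e i = ∣-cancel (d i) (∣-resp (coef-⊕ f g i) (e i))

  ∣ᶜ-·ˡ : ∀ {c a} f → c ∣ a → c ∣ᶜ (a · f)
  ∣ᶜ-·ˡ f d i = ∣-resp (sym (coef-· _ f i)) (∣-*ʳ _ d)

  ∣ᶜ-·ʳ : ∀ {c} a f → c ∣ᶜ f → c ∣ᶜ (a · f)
  ∣ᶜ-·ʳ a f d i = ∣-resp (sym (coef-· _ f i)) (∣-*ˡ a (d i))

  ∣ᶜ-quotient : ∀ {c} f → c ∣ᶜ f → ∃[ q ] const c ⊛ q ≋ f
  ∣ᶜ-quotient {c} f d = go f d .proj₁ , ≋-trans (const-⊛ c _) (go f d .proj₂)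
    where
    go : ∀ f → c ∣ᶜ f → ∃[ q ] c · q ≋ f
    go []      d = [] , ≋-refl
    go (a ∷ f) d with d 0 | go f (λ i → d (suc i))
    ... | q , e | qs , es = q ∷ qs , ∷-cong e es

  const-∣ᶜ : ∀ {c f} q → const c ⊛ q ≋ f → c ∣ᶜ f
  const-∣ᶜ {c} q e i = coef q i , trans (sym (coef-const-⊛ c q i)) (at e i)

  Primitive : List Carrier → Set
  Primitive U = ∀ c s → (∀ i → c ∣ s * coef U i) → c ∣ s

  content : ∀ U → ∃[ κ ] ∃[ V ] κ · V ≋ U × Primitive V
  content [] = 0# , 1# ∷ [] , 0∷≋[] (zeroˡ 1#) ≋-refl , λ c s d → ∣-resp (*-identityʳ s) (d 0)
  content (a ∷ U) with content U
  ... | κ , V , e , prim with reduce a κ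
  ... | d , u , v , du , dv , cop = d , u ∷ v · V
    , ∷-cong du (≋-trans (≋-sym (*-· d v V)) (≋-trans (·-cong dv ≋-refl) e))
    , λ c s div → cop c s (div 0) (prim c (s * v) λ i →
        ∣-resp (trans (*-congˡ (coef-· v V i)) (sym (*-assoc s v _))) (div (suc i)))

  -- If t₀ v and c are such that c ∣ t₀ v, then modulo c the product v t U only
  -- involves the shorter polynomial v (t - t₀); so c ∣ v t for the coefficients
  -- v of U one after the other, and U is primitive.
  gauss : ∀ {U} → Primitive U → ∀ t {c} → c ∣ᶜ (t ⊛ U) → c ∣ᶜ t
  gauss {U} prim t = go (length t) t ≡.refl
    where
    go : ∀ n t → length t ≡ n → ∀ {c} → c ∣ᶜ (t ⊛ U) → c ∣ᶜ t
    go n       []       _      d i = ∣-0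
    go (suc n) (t₀ ∷ t) len {c} d i = prim c _ λ j →
        ∣-resp (trans (coef-· _ (t₀ ∷ t) i) (*-comm _ _)) (suffix U d j i)
      where
      one : ∀ v → c ∣ t₀ * v → c ∣ᶜ (v · (t₀ ∷ t))
      one v cv zero    = ∣-resp (*-comm t₀ v) cv
      one v cv (suc i) = go n (v · t) (≡.trans (length-map (v *_) t) (ℕ.suc-injective len)) (∣ᶜ-resp (≋-sym (·-⊛ v t U)) λ i → tail (suc i)) i
        where
        tail : c ∣ᶜ (v · (0# ∷ t ⊛ U))
        tail = ∣ᶜ-cancel (v · (t₀ · U)) _
          (∣ᶜ-resp (≋-trans (·-cong (*-comm t₀ v) ≋-refl) (*-· v t₀ U)) (∣ᶜ-·ˡ U cv))
          (∣ᶜ-resp (·-distrib-⊕ v (t₀ · U) _) (∣ᶜ-·ʳ v ((t₀ ∷ t) ⊛ U) d))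
      suffix : ∀ V → c ∣ᶜ ((t₀ ∷ t) ⊛ V) → ∀ j → c ∣ᶜ (coef V j · (t₀ ∷ t))
      suffix []      d j i = ∣-resp (sym (trans (coef-· 0# (t₀ ∷ t) i) (zeroˡ _))) ∣-0
      suffix (v ∷ V) d zero    = one v (∣-resp (+-identityʳ _) (d 0))
      suffix (v ∷ V) d (suc j) = suffix V (λ i →
        ∣ᶜ-cancel (v · (t₀ ∷ t)) (0# ∷ (t₀ ∷ t) ⊛ V) (one v (∣-resp (+-identityʳ _) (d 0)))
          (∣ᶜ-resp (⊛-∷ (t₀ ∷ t) v V) d) (suc i)) j

  X^ : ℕ → List Carrier
  X^ zero    = const 1#
  X^ (suc k) = 0# ∷ X^ k

  coef-X^ : ∀ k g i → coef (X^ k ⊛ g) (k ℕ.+ i) ≈ coef g i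
  coef-X^ zero    g i = at (⊛-identityˡ g) i
  coef-X^ (suc k) g i = trans (at (0∷-⊛ (X^ k) g) (suc (k ℕ.+ i))) (coef-X^ k g i)

  _<deg_ : List Carrier → ℕ → Set
  f <deg p = ∀ i → p ℕ.≤ i → coef f i ≈ 0#

  <deg-length : ∀ f → f <deg length f
  <deg-length []      i       p≤i       = refl
  <deg-length (a ∷ f) (suc i) (s≤s p≤i) = <deg-length f i p≤i

  <deg-pred : ∀ {f p} → f <deg suc p → coef f p ≈ 0# → f <deg p
  <deg-pred {f} {p} d e i p≤i with ℕ.m≤n⇒m<n∨m≡n p≤i
  ... | inj₁ p<i    = d i p<i
  ... | inj₂ ≡.refl = e

  divisionStep : ∀ {f g p q} → f <deg suc p → g <deg suc q → q ℕ.≤ p →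
    ∃[ f₁ ] ∃[ m ] (f₁ ⊕ m ⊛ g ≋ const (coef g q) ⊛ f) × f₁ <deg p
  divisionStep {f} {g} {p} {q} df dg q≤p =
    bf ⊕ ⊝ mg , m , eq , bound
    where
    a = coef f p
    b = coef g q
    k = p ℕ.∸ q
    m = const a ⊛ X^ k
    bf = const b ⊛ f
    mg = m ⊛ g
    k+q : k ℕ.+ q ≡ p
    k+q = ℕ.m∸n+n≡m q≤p
    eq : (bf ⊕ ⊝ mg) ⊕ mg ≋ bf
    eq = ≋-trans (⊕-assoc bf (⊝ mg) mg)
           (≋-trans (⊕-cong (≋-refl {bf}) (⊝-inverseˡ mg)) (⊕-identityʳ bf))
    coef-mg : ∀ j → coef mg (k ℕ.+ j) ≈ a * coef g j
    coef-mg j = trans (at (⊛-assoc (const a) (X^ k) g) (k ℕ.+ j))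
      (trans (coef-const-⊛ a (X^ k ⊛ g) _) (*-congˡ (coef-X^ k g j)))
    minus : ∀ {i x} → coef bf i ≈ x → coef mg i ≈ x → coef (bf ⊕ ⊝ mg) i ≈ 0#
    minus {i} d e = trans (coef-⊕ bf (⊝ mg) i) (trans (+-cong d (trans (coef-⊝ mg i) (-‿cong e))) (-‿inverseʳ _))
    top : coef (bf ⊕ ⊝ mg) p ≈ 0#
    top = minus {p} (trans (coef-const-⊛ b f p) (*-comm b a))
      (≡.subst (λ j → coef mg j ≈ a * b) k+q (coef-mg q))
    bound : (bf ⊕ ⊝ mg) <deg p
    bound = <deg-pred {bf ⊕ ⊝ mg} (λ i p<i → let i≡ = ℕ.m+[n∸m]≡n (ℕ.≤-trans (ℕ.m∸n≤m p q) (ℕ.<⇒≤ p<i)) in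
      minus {i} (trans (coef-const-⊛ b f i) (trans (*-congˡ (df i p<i)) (zeroʳ b)))
        (≡.subst (λ j → coef mg j ≈ 0#) i≡
          (trans (coef-mg (i ℕ.∸ k)) (trans (*-congˡ (dg (i ℕ.∸ k)
            (ℕ.+-cancelˡ-≤ k (suc q) (i ℕ.∸ k) (≡.subst₂ ℕ._≤_ (≡.trans (≡.cong suc (≡.sym k+q)) (≡.sym (ℕ.+-suc k q))) (≡.sym i≡) p<i)))) (zeroʳ a)))))
      top

  euclid : ∀ n {p q f g} → f <deg p → g <deg q → p ℕ.+ q ℕ.≤ n →
    ∃[ c ] (¬ c ≈ 0#) × PB.Relation f g (const c)
  euclid n {zero}  {q} {f} df dg le = 1# , 1≉0 , PB.relation-0 {f} (mk λ i → df i z≤n)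
  euclid n {suc p} {zero} {f} {g} df dg le = 1# , 1≉0 , PB.relation-swap (PB.relation-0 {g} (mk λ i → dg i z≤n))
  euclid (suc n) {suc p} {suc q} {f} {g} df dg (s≤s le) with zero? (coef f p) | zero? (coef g q)
  ... | yes a≈0 | _       = euclid n (<deg-pred {f} df a≈0) dg le
  ... | no _    | yes b≈0 = euclid n df (<deg-pred {g} dg b≈0) (ℕ.≤-trans (ℕ.≤-reflexive (≡.sym (ℕ.+-suc p q))) le)
  ... | no a≉0  | no b≉0 with ℕ.≤-total q p
  ... | inj₁ q≤p with divisionStep {f} {g} df dg q≤p
  ... | f₁ , m , eq , d₁ with euclid n d₁ dg le
  ... | c , c≉0 , r = coef g q * c , (λ e → c≉0 (integral b≉0 e)) ,
    PB.relation-resp {f} {g} (const-* (coef g q) c) (PB.relation-step {f} {f₁} {g} {const (coef g q)} m eq r)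
  euclid (suc n) {suc p} {suc q} {f} {g} df dg (s≤s le) | no a≉0 | no b≉0 | inj₂ p≤q with divisionStep {g} {f} dg df p≤q
  ... | g₁ , m , eq , d₁ with euclid n df d₁ (ℕ.≤-trans (ℕ.≤-reflexive (≡.sym (ℕ.+-suc p q))) le)
  ... | c , c≉0 , r = coef f p * c , (λ e → c≉0 (integral a≉0 e)) ,
    PB.relation-resp {f} {g} (const-* (coef f p) c) (PB.relation-swap (PB.relation-step {g} {g₁} {f} {const (coef f p)} m eq (PB.relation-swap r)))

  -- The data of `Relation` after removal of the content of (u , v); it makes
  -- f = d u and g = d v a reduction to coprime cofactors.
  record Reduced (f g : List Carrier) : Set where
    field
      d u v α β : List Carrier
      c         : Carrier
      c≉0       : ¬ c ≈ 0#
      unit      : α ⊛ u ⊕ β ⊛ v ≋ const c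
      f-mult    : d ⊛ u ≋ f
      g-mult    : d ⊛ v ≋ g
      coprime   : Coprimeₗ u v

  reduced : ∀ f g → Reduced f g
  reduced f g with euclid _ (<deg-length f) (<deg-length g) ℕ.≤-refl
  ... | c , c≉0 , r with content (PB.Relation.u r) | content (PB.Relation.v r)
  ... | κ₁ , U₁ , κ₁U₁ , prim₁ | κ₂ , V₂ , κ₂V₂ , prim₂ with reduce κ₁ κ₂
  ... | k , s , t , ks , kt , cop = record
    { d = d ; u = u ; v = v ; α = α ; β = β ; c = c₀ ; c≉0 = c₀≉0 ; unit = w≋c₀
    ; f-mult = quotient f-mult k·u ; g-mult = quotient g-mult k·v ; coprime = coprime }
    where
    open PB.Relation r using (h; α; β; f-mult; g-mult) renaming (unit to unit′; u to ku; v to kv)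
    u = const s ⊛ U₁
    v = const t ⊛ V₂
    w = α ⊛ u ⊕ β ⊛ v
    c₀ = coef w 0
    primitivePart : ∀ {κ σ W z} → k * σ ≈ κ → κ · W ≋ z → const k ⊛ (const σ ⊛ W) ≋ z
    primitivePart {κ} {σ} {W} {z} e e′ = begin
      const k ⊛ (const σ ⊛ W)  ≈⟨ ⊛-assoc (const k) (const σ) W ⟨
      const k ⊛ const σ ⊛ W    ≈⟨ P.*-congʳ {W} (P.trans (const-* k σ) (const-cong e)) ⟩
      const κ ⊛ W              ≈⟨ const-⊛ κ W ⟩
      κ · W                    ≈⟨ e′ ⟩
      z                        ∎
      where open SetoidReasoning ≋-setoid
    k·u : const k ⊛ u ≋ ku
    k·u = primitivePart ks κ₁U₁
    k·v : const k ⊛ v ≋ kv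
    k·v = primitivePart kt κ₂V₂
    k·w : const k ⊛ w ≋ const c
    k·w = P.trans (P.sym (PB.pull (const k) α β u v))
      (P.trans (⊕-cong (⊛-congˡ α k·u) (⊛-congˡ β k·v)) unit′)
    kw≈c : k * c₀ ≈ c
    kw≈c = trans (sym (coef-const-⊛ k w 0)) (at k·w 0)
    c₀≉0 : ¬ c₀ ≈ 0#
    c₀≉0 e = c≉0 (trans (sym kw≈c) (trans (*-congˡ e) (zeroʳ k)))
    k≉0 : ¬ k ≈ 0#
    k≉0 e = c≉0 (trans (sym kw≈c) (trans (*-congʳ e) (zeroˡ c₀)))
    w≋c₀ : w ≋ const c₀
    w≋c₀ = const-cancel k≉0 (P.trans k·w (P.sym (P.trans (const-* k c₀) (const-cong kw≈c))))
    kc₀ : const k ⊛ const c₀ ≋ const c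
    kc₀ = P.trans (const-* k c₀) (const-cong kw≈c)

    divide : ∀ x → c₀ ∣ᶜ (x ⊛ u) → c₀ ∣ᶜ (x ⊛ v) → ∃[ y ] const c₀ ⊛ y ≋ x
    divide x du dv = ∣ᶜ-quotient x λ i → cop c₀ (coef x i) (one prim₁ du i) (one prim₂ dv i)
      where
      one : ∀ {σ W} → Primitive W → c₀ ∣ᶜ (x ⊛ (const σ ⊛ W)) → ∀ i → c₀ ∣ coef x i * σ
      one {σ} {W} prim div i = ∣-resp (trans (coef-const-⊛ σ x i) (*-comm σ _))
        (gauss {W} prim (const σ ⊛ x) (∣ᶜ-resp
          (P.trans (PB.swap x (const σ) W) (P.sym (⊛-assoc (const σ) x W))) div) i)

    scaled : ∀ {x z zk} → const c ⊛ x ≋ h ⊛ zk → const k ⊛ z ≋ zk → const c₀ ⊛ x ≋ h ⊛ z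
    scaled {x} {z} {zk} e e′ = const-cancel k≉0 (begin
      const k ⊛ (const c₀ ⊛ x)  ≈⟨ ⊛-assoc (const k) (const c₀) x ⟨
      const k ⊛ const c₀ ⊛ x    ≈⟨ P.*-congʳ {x} kc₀ ⟩
      const c ⊛ x               ≈⟨ e ⟩
      h ⊛ zk                    ≈⟨ ⊛-congˡ h e′ ⟨
      h ⊛ (const k ⊛ z)         ≈⟨ PB.swap h (const k) z ⟩
      const k ⊛ (h ⊛ z)         ∎)
      where open SetoidReasoning ≋-setoid

    d,eq = divide h (const-∣ᶜ f (scaled f-mult k·u)) (const-∣ᶜ g (scaled g-mult k·v))
    d = d,eq .proj₁

    quotient : ∀ {x z zk} → const c ⊛ x ≋ h ⊛ zk → const k ⊛ z ≋ zk → d ⊛ z ≋ x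
    quotient {x} {z} e e′ = const-cancel c₀≉0 (P.trans (P.sym (⊛-assoc (const c₀) d z))
      (P.trans (P.*-congʳ {z} (d,eq .proj₂)) (P.sym (scaled {x} {z} e e′))))

    coprime : Coprimeₗ u v
    coprime e S (q₁ , e₁) (q₂ , e₂) with ≋[]? e
    ... | yes e≋[] = [] , P.trans (⊛-[] e) (P.sym (integralₗ {const c₀} (λ c≋[] → c₀≉0 (at c≋[] 0)) (begin
      const c₀ ⊛ S               ≈⟨ P.*-congʳ {S} w≋c₀ ⟨
      w ⊛ S                      ≈⟨ ⊛-comm w S ⟩
      S ⊛ w                      ≈⟨ PB.pull S α β u v ⟨
      α ⊛ (S ⊛ u) ⊕ β ⊛ (S ⊛ v)  ≈⟨ ⊕-cong (vanish α e₁) (vanish β e₂) ⟩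
      []                         ∎)))
      where
      open SetoidReasoning ≋-setoid
      vanish : ∀ {q z} γ → e ⊛ q ≋ z → γ ⊛ z ≋ []
      vanish {q} γ eq = P.trans (⊛-congˡ γ (P.trans (P.sym eq) (P.*-congʳ {q} e≋[]))) (⊛-[] γ)
    ... | no e≢[] = γ′ .proj₁ , const-cancel c₀≉0 (begin
      const c₀ ⊛ (e ⊛ γ′ .proj₁)  ≈⟨ PB.swap (const c₀) e _ ⟩
      e ⊛ (const c₀ ⊛ γ′ .proj₁)  ≈⟨ ⊛-congˡ e (γ′ .proj₂) ⟩
      e ⊛ γ                       ≈⟨ PB.gather e α β q₁ q₂ ⟩
      α ⊛ (e ⊛ q₁) ⊕ β ⊛ (e ⊛ q₂) ≈⟨ ⊕-cong (⊛-congˡ α e₁) (⊛-congˡ β e₂) ⟩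
      α ⊛ (S ⊛ u) ⊕ β ⊛ (S ⊛ v)   ≈⟨ PB.pull S α β u v ⟩
      S ⊛ w                       ≈⟨ ⊛-comm S w ⟩
      w ⊛ S                       ≈⟨ P.*-congʳ {S} w≋c₀ ⟩
      const c₀ ⊛ S                ∎)
      where
      open SetoidReasoning ≋-setoid
      γ = α ⊛ q₁ ⊕ β ⊛ q₂
      cross : q₁ ⊛ v ≋ q₂ ⊛ u
      cross = cancelₗ (begin
        e ⊛ (q₁ ⊛ v)  ≈⟨ ⊛-assoc e q₁ v ⟨
        e ⊛ q₁ ⊛ v    ≈⟨ P.*-congʳ {v} e₁ ⟩
        S ⊛ u ⊛ v     ≈⟨ PB.rotate S u v ⟩
        S ⊛ v ⊛ u     ≈⟨ P.*-congʳ {u} e₂ ⟨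
        e ⊛ q₂ ⊛ u    ≈⟨ ⊛-assoc e q₂ u ⟩
        e ⊛ (q₂ ⊛ u)  ∎)
        where
        cancelₗ : ∀ {x y} → e ⊛ x ≋ e ⊛ y → x ≋ y
        cancelₗ {x} {y} eq = begin
          x               ≈⟨ P.+-identityʳ x ⟨
          x ⊕ []          ≈⟨ P.+-congˡ {x} (⊝-inverseˡ y) ⟨
          x ⊕ (⊝ y ⊕ y)   ≈⟨ ⊕-assoc x (⊝ y) y ⟨
          x ⊕ ⊝ y ⊕ y     ≈⟨ P.+-congʳ {y} (integralₗ e≢[] zero′) ⟩
          y               ∎
          where
          zero′ : e ⊛ (x ⊕ ⊝ y) ≋ []
          zero′ = P.trans (⊛-distribˡ e x (⊝ y)) (P.trans (⊕-cong eq (P.sym (RingProperties.-‿distribʳ-* P.ring e y))) (⊝-inverseʳ (e ⊛ y)))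
      γu : const c₀ ⊛ q₁ ≋ γ ⊛ u
      γu = P.sym (begin
        γ ⊛ u                        ≈⟨ PB.collect α β q₁ q₂ u ⟩
        α ⊛ (q₁ ⊛ u) ⊕ β ⊛ (u ⊛ q₂)  ≈⟨ ⊕-cong (P.refl {α ⊛ (q₁ ⊛ u)}) (⊛-congˡ β (P.trans (⊛-comm u q₂) (P.trans (P.sym cross) (⊛-comm q₁ v)))) ⟩
        α ⊛ (q₁ ⊛ u) ⊕ β ⊛ (v ⊛ q₁)  ≈⟨ PB.collect′ α β q₁ u v ⟩
        w ⊛ q₁                       ≈⟨ P.*-congʳ {q₁} w≋c₀ ⟩
        const c₀ ⊛ q₁                ∎)
      γv : const c₀ ⊛ q₂ ≋ γ ⊛ v
      γv = P.sym (begin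
        γ ⊛ v                        ≈⟨ PB.collect α β q₁ q₂ v ⟩
        α ⊛ (q₁ ⊛ v) ⊕ β ⊛ (v ⊛ q₂)  ≈⟨ ⊕-cong (⊛-congˡ α cross) (P.refl {β ⊛ (v ⊛ q₂)}) ⟩
        α ⊛ (q₂ ⊛ u) ⊕ β ⊛ (v ⊛ q₂)  ≈⟨ PB.collect′ α β q₂ u v ⟩
        w ⊛ q₂                       ≈⟨ P.*-congʳ {q₂} w≋c₀ ⟩
        const c₀ ⊛ q₂                ∎)
      γ′ = divide γ (const-∣ᶜ q₁ γu) (const-∣ᶜ q₂ γv)

  polynomialGCD : GCDDomain
  polynomialGCD = record
    { commutativeRing = polynomialRing
    ; zero?    = ≋[]?
    ; 1≉0      = λ e → 1≉0 (at e 0)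
    ; integral = integralₗ
    ; reduce   = reduce′ }
    where
    reduce′ : ∀ f g → ∃[ d ] ∃[ u ] ∃[ v ] d ⊛ u ≋ f × d ⊛ v ≋ g × Coprimeₗ u v
    reduce′ f g = d , u , v , f-mult , g-mult , coprime
      where open Reduced (reduced f g)

open import Data.Integer.Base as ℤ using (ℤ; +_; 0ℤ; 1ℤ)
open import Data.List.Base using (concat; _++_)
open import Data.List.Relation.Unary.All as All using (All; []; _∷_)
open import Data.Vec.Base as Vec using (Vec; []; _∷_)
open import Relation.Binary.PropositionalEquality using (refl; sym; trans; cong; cong₂; subst)
import Data.Integer.Properties as ℤ
import Data.Integer.Divisibility.Signed as Signed
import Data.List.Relation.Unary.All.Properties as All
import Data.Nat.Divisibility as ℕ
import Data.Nat.GCD as ℕ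

module Resultant (D : GCDDomain) where
  open GCDDomain D hiding (refl; sym; trans)
  open Polynomial commutativeRing
  open PolynomialGCD D
  private module P = CommutativeRing polynomialRing
  private module PB = Bézout polynomialRing
  open Divide polynomialRing using () renaming (_∣_ to _∣ₗ_; ∣-trans to ∣ₗ-trans)

  record IsIdeal (I : List Carrier → Set) : Set where
    field
      resp : ∀ {f g} → f ≋ g → I f → I g
      nil  : I []
      add  : ∀ {f g} → I f → I g → I (f ⊕ g)
      mult : ∀ h {f} → I f → I (h ⊛ f)

  -- Membership of x in the ideal generated by F, in its impredicative form.
  Generates : List (List Carrier) → List Carrier → Set₁
  Generates F x = ∀ I → IsIdeal I → All I F → I x

  gcd-combination : ∀ F → ∃[ d ] ∃[ c ] (¬ c ≈ 0#) × All (d ∣ₗ_) F × Generates F (const c ⊛ d)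
  gcd-combination [] = [] , 1# , 1≉0 , [] , λ I i _ → IsIdeal.resp i (≋-sym (⊛-[] (const 1#))) (IsIdeal.nil i)
  gcd-combination (f ∷ F) with gcd-combination F
  ... | d′ , c′ , c′≉0 , divs , gen = d , c′ * c , (λ e → c≉0 (integral c′≉0 e)) ,
    (u , f-mult) ∷ All.map (λ {x} → ∣ₗ-trans {d} {d′} {x} (v , g-mult)) divs ,
    λ { I i (If ∷ IF) → IsIdeal.resp i eq (IsIdeal.add i
          (IsIdeal.mult i (α ⊛ const c′) If) (IsIdeal.mult i β (gen I i IF))) }
    where
    open Reduced (reduced f d′)
    C = const c′
    eq : α ⊛ C ⊛ f ⊕ β ⊛ (C ⊛ d′) ≋ const (c′ * c) ⊛ d
    eq = begin
      α ⊛ C ⊛ f ⊕ β ⊛ (C ⊛ d′)             ≈⟨ ⊕-cong (P.trans (⊛-assoc α C f) (⊛-congˡ α (⊛-congˡ C (P.sym f-mult)))) (⊛-congˡ β (⊛-congˡ C (P.sym g-mult))) ⟩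
      α ⊛ (C ⊛ (d ⊛ u)) ⊕ β ⊛ (C ⊛ (d ⊛ v)) ≈⟨ PB.pull C α β (d ⊛ u) (d ⊛ v) ⟩
      C ⊛ (α ⊛ (d ⊛ u) ⊕ β ⊛ (d ⊛ v))      ≈⟨ ⊛-congˡ C (PB.pull d α β u v) ⟩
      C ⊛ (d ⊛ (α ⊛ u ⊕ β ⊛ v))            ≈⟨ ⊛-congˡ C (⊛-congˡ d unit) ⟩
      C ⊛ (d ⊛ const c)                    ≈⟨ ⊛-congˡ C (⊛-comm d (const c)) ⟩
      C ⊛ (const c ⊛ d)                    ≈⟨ ⊛-assoc C (const c) d ⟨
      C ⊛ const c ⊛ d                      ≈⟨ P.*-congʳ {d} (const-* c′ c) ⟩
      const (c′ * c) ⊛ d                   ∎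
      where open SetoidReasoning ≋-setoid

  resultant : ∀ F → (∀ h → All (h ∣ₗ_) F → ∃[ m ] (¬ m ≈ 0#) × h ∣ₗ const m) →
    ∃[ r ] (¬ r ≈ 0#) × Generates F (const r)
  resultant F cop with gcd-combination F
  ... | d , c , c≉0 , divs , gen with cop d divs
  ... | m , m≉0 , q , dq = c * m , (λ e → m≉0 (integral c≉0 e)) , λ I i IF →
    IsIdeal.resp i (begin
      q ⊛ (const c ⊛ d)  ≈⟨ PB.swap q (const c) d ⟩
      const c ⊛ (q ⊛ d)  ≈⟨ ⊛-congˡ (const c) (P.trans (⊛-comm q d) dq) ⟩
      const c ⊛ const m  ≈⟨ const-* c m ⟩
      const (c * m)      ∎) (IsIdeal.mult i q (gen I i IF))
    where open SetoidReasoning ≋-setoid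

  const-divides : ∀ {h} f → All (h ∣_) f → const h ∣ₗ f
  const-divides {h} f divs = ∣ᶜ-quotient f (all⇒ divs)
    where
    all⇒ : ∀ {f} → All (h ∣_) f → h ∣ᶜ f
    all⇒ []       i       = ∣-0
    all⇒ (d ∷ ds) zero    = d
    all⇒ (d ∷ ds) (suc i) = all⇒ ds i

ℤ-GCDDomain : GCDDomain
ℤ-GCDDomain = record
  { commutativeRing = ℤ.+-*-commutativeRing
  ; zero? = ℤ._≟ 0ℤ
  ; 1≉0 = λ ()
  ; integral = λ {x} x≢0 e → [ (λ x≡0 → ⊥-elim (x≢0 x≡0)) , (λ y≡0 → y≡0) ]′ (ℤ.i*j≡0⇒i≡0∨j≡0 x e)
  ; reduce = reduce }
  where
  open Divide ℤ.+-*-commutativeRing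
  ∣⇒ : ∀ {c x} → c ∣ x → ℤ.∣ c ∣ ℕ.∣ ℤ.∣ x ∣
  ∣⇒ {c} (q , e) = Signed.∣⇒∣ᵤ (Signed.divides q (trans (sym e) (ℤ.*-comm c q)))
  ⇒∣ : ∀ {c x} → ℤ.∣ c ∣ ℕ.∣ ℤ.∣ x ∣ → c ∣ x
  ⇒∣ {c} {x} d with Signed.∣ᵤ⇒∣ {c} {x} d
  ... | Signed.divides q e = q , trans (ℤ.*-comm c q) (sym e)
  reduce : ∀ a b → ∃[ d ] ∃[ u ] ∃[ v ] d ℤ.* u ≡ a × d ℤ.* v ≡ b × Coprime₂ u v
  reduce a b with ℕ.gcd ℤ.∣ a ∣ ℤ.∣ b ∣ in eq
  ... | zero = 0ℤ , 1ℤ , 1ℤ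
    , sym (ℤ.∣i∣≡0⇒i≡0 (ℕ.gcd[m,n]≡0⇒m≡0 eq)) , sym (ℤ.∣i∣≡0⇒i≡0 (ℕ.gcd[m,n]≡0⇒n≡0 ℤ.∣ a ∣ eq))
    , λ c s d _ → ∣-resp {c} (ℤ.*-identityʳ s) d
  ... | g@(suc _) = + g , u .proj₁ , v .proj₁ , u .proj₂ , v .proj₂ , cop
    where
    u = ⇒∣ {+ g} {a} (subst (ℕ._∣ ℤ.∣ a ∣) eq (ℕ.gcd[m,n]∣m ℤ.∣ a ∣ ℤ.∣ b ∣))
    v = ⇒∣ {+ g} {b} (subst (ℕ._∣ ℤ.∣ b ∣) eq (ℕ.gcd[m,n]∣n ℤ.∣ a ∣ ℤ.∣ b ∣))
    abs : ∀ {x y} → + g ℤ.* x ≡ y → ℤ.∣ y ∣ ≡ g ℕ.* ℤ.∣ x ∣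
    abs {x} e = trans (cong ℤ.∣_∣ (sym e)) (ℤ.abs-* (+ g) x)
    one : ℕ.gcd ℤ.∣ u .proj₁ ∣ ℤ.∣ v .proj₁ ∣ ≡ 1
    one = ℕ.*-cancelˡ-≡ _ 1 g (begin
      g ℕ.* ℕ.gcd ℤ.∣ u .proj₁ ∣ ℤ.∣ v .proj₁ ∣               ≡⟨ ℕ.c*gcd[m,n]≡gcd[cm,cn] g ℤ.∣ u .proj₁ ∣ ℤ.∣ v .proj₁ ∣ ⟩
      ℕ.gcd (g ℕ.* ℤ.∣ u .proj₁ ∣) (g ℕ.* ℤ.∣ v .proj₁ ∣)     ≡⟨ cong₂ ℕ.gcd (sym (abs (u .proj₂))) (sym (abs (v .proj₂))) ⟩
      ℕ.gcd ℤ.∣ a ∣ ℤ.∣ b ∣                                   ≡⟨ eq ⟩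
      g                                                       ≡⟨ ℕ.*-identityʳ g ⟨
      g ℕ.* 1                                                 ∎)
      where open ≡.≡-Reasoning
    cop : Coprime₂ (u .proj₁) (v .proj₁)
    cop c s d e = ⇒∣ {c} {s} (subst (ℤ.∣ c ∣ ℕ.∣_) (begin
      ℕ.gcd (ℤ.∣ s ∣ ℕ.* ℤ.∣ u .proj₁ ∣) (ℤ.∣ s ∣ ℕ.* ℤ.∣ v .proj₁ ∣)  ≡⟨ ℕ.c*gcd[m,n]≡gcd[cm,cn] ℤ.∣ s ∣ ℤ.∣ u .proj₁ ∣ ℤ.∣ v .proj₁ ∣ ⟨
      ℤ.∣ s ∣ ℕ.* ℕ.gcd ℤ.∣ u .proj₁ ∣ ℤ.∣ v .proj₁ ∣                  ≡⟨ cong (ℤ.∣ s ∣ ℕ.*_) one ⟩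
      ℤ.∣ s ∣ ℕ.* 1                                                    ≡⟨ ℕ.*-identityʳ _ ⟩
      ℤ.∣ s ∣                                                          ∎)
      (ℕ.gcd-greatest (subst (ℤ.∣ c ∣ ℕ.∣_) (ℤ.abs-* s (u .proj₁)) (∣⇒ {c} d)) (subst (ℤ.∣ c ∣ ℕ.∣_) (ℤ.abs-* s (v .proj₁)) (∣⇒ {c} e))))
      where open ≡.≡-Reasoning

-- ℤ[x₁,…,xₙ] as polynomials in x₁ over ℤ[x₂,…,xₙ].
𝔻 : ℕ → GCDDomain
𝔻 zero    = ℤ-GCDDomain
𝔻 (suc n) = PolynomialGCD.polynomialGCD (𝔻 n)

ℤ[X] : ℕ → Set
ℤ[X] n = GCDDomain.Carrier (𝔻 n)

module 𝔻 (n : ℕ) = GCDDomain (𝔻 n)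
module 𝔓 (n : ℕ) = Polynomial (GCDDomain.commutativeRing (𝔻 n))

scalar : ∀ n → ℤ → ℤ[X] n
scalar zero    m = m
scalar (suc n) m = scalar n m ∷ []

scalar≉0 : ∀ n {m} → ¬ m ≡ 0ℤ → ¬ 𝔻._≈_ n (scalar n m) (𝔻.0# n)
scalar≉0 zero    m≢0 e = m≢0 e
scalar≉0 (suc n) m≢0 e = scalar≉0 n m≢0 (𝔓.at {n} e 0)

-- The polynomials in F have no common factor over ℚ.
JointlyCoprime : ∀ n → List (ℤ[X] n) → Set
JointlyCoprime n F = ∀ h → All (𝔻._∣_ n h) F → ∃[ m ] (¬ m ≡ 0ℤ) × 𝔻._∣_ n h (scalar n m)

coprime-coefs : ∀ n F → JointlyCoprime (suc n) F → JointlyCoprime n (concat F)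
coprime-coefs n F cop h divs =
  let m , m≢0 , q , e = cop (h ∷ []) (All.map (λ {f} → Resultant.const-divides (𝔻 n) f) (All.concat⁻ divs))
  in m , m≢0 , 𝔓.coef n q 0 , 𝔻.trans n (𝔻.sym n (𝔓.coef-const-⊛ n h q 0)) (𝔓.at {n} e 0)

-- Evaluation

ev : ∀ n → ℤ[X] n → Vec ℕ n → ℤ
evₗ : ∀ n → List (ℤ[X] n) → ℕ → Vec ℕ n → ℤ
ev zero    a []      = a
ev (suc n) f (x ∷ X) = evₗ n f x X
evₗ n []      x X = 0ℤ
evₗ n (a ∷ f) x X = ev n a X ℤ.+ + x ℤ.* evₗ n f x X

record IsEvaluation (n : ℕ) (φ : ℤ[X] n → ℤ) : Set where
  private module D = 𝔻 n
  field
    φ-cong : ∀ a b → a D.≈ b → φ a ≡ φ b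
    φ-0    : φ D.0# ≡ 0ℤ
    φ-1    : φ D.1# ≡ 1ℤ
    φ-+    : ∀ a b → φ (a D.+ b) ≡ φ a ℤ.+ φ b
    φ-*    : ∀ a b → φ (a D.* b) ≡ φ a ℤ.* φ b

module _ where
  open import Data.Integer.Tactic.RingSolver using (solve-∀)

  private
    rearrange : ∀ a b x f g → (a ℤ.+ b) ℤ.+ x ℤ.* (f ℤ.+ g) ≡ (a ℤ.+ x ℤ.* f) ℤ.+ (b ℤ.+ x ℤ.* g)
    rearrange = solve-∀
    factorˡ : ∀ a b x f → a ℤ.* b ℤ.+ x ℤ.* (a ℤ.* f) ≡ a ℤ.* (b ℤ.+ x ℤ.* f)
    factorˡ = solve-∀
    distrib : ∀ a x f g → a ℤ.* g ℤ.+ (0ℤ ℤ.+ x ℤ.* (f ℤ.* g)) ≡ (a ℤ.+ x ℤ.* f) ℤ.* g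
    distrib = solve-∀

  ev-isEvaluation : ∀ n X → IsEvaluation n (λ f → ev n f X)
  ev-isEvaluation zero [] = record { φ-cong = λ _ _ e → e ; φ-0 = refl ; φ-1 = refl
    ; φ-+ = λ _ _ → refl ; φ-* = λ _ _ → refl }
  ev-isEvaluation (suc n) (x ∷ X) = record
    { φ-cong = ev-cong ; φ-0 = refl
    ; φ-1 = trans (cong (ℤ._+ (+ x ℤ.* 0ℤ)) φ-1) (cong (ℤ._+_ 1ℤ) (ℤ.*-zeroʳ (+ x)))
    ; φ-+ = ev-+ ; φ-* = ev-* }
    where
    open IsEvaluation (ev-isEvaluation n X)
    module D = 𝔻 n
    open 𝔓 n
    E : List (ℤ[X] n) → ℤ
    E f = evₗ n f x X
    ev-≋[] : ∀ f → f ≋ [] → E f ≡ 0ℤ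
    ev-≋[] []      e = refl
    ev-≋[] (a ∷ f) e = trans (cong₂ ℤ._+_ (trans (φ-cong a D.0# (at e 0)) φ-0)
      (cong (+ x ℤ.*_) (ev-≋[] f (mk λ i → at e (suc i))))) (trans (ℤ.+-identityˡ _) (ℤ.*-zeroʳ (+ x)))
    ev-cong : ∀ f g → f ≋ g → E f ≡ E g
    ev-cong []      g       e = sym (ev-≋[] g (≋-sym e))
    ev-cong (a ∷ f) []      e = ev-≋[] (a ∷ f) e
    ev-cong (a ∷ f) (b ∷ g) e = cong₂ (λ a s → a ℤ.+ + x ℤ.* s) (φ-cong a b (at e 0)) (ev-cong f g (∷-injʳ e))
    ev-+ : ∀ f g → E (f ⊕ g) ≡ E f ℤ.+ E g
    ev-+ []      g       = sym (ℤ.+-identityˡ _)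
    ev-+ (a ∷ f) []      = sym (ℤ.+-identityʳ _)
    ev-+ (a ∷ f) (b ∷ g) = trans (cong₂ (λ a s → a ℤ.+ + x ℤ.* s) (φ-+ a b) (ev-+ f g))
      (rearrange (ev n a X) (ev n b X) (+ x) (E f) (E g))
    ev-· : ∀ a f → E (a · f) ≡ ev n a X ℤ.* E f
    ev-· a []      = sym (ℤ.*-zeroʳ (ev n a X))
    ev-· a (b ∷ f) = trans (cong₂ (λ a s → a ℤ.+ + x ℤ.* s) (φ-* a b) (ev-· a f))
      (factorˡ (ev n a X) (ev n b X) (+ x) (E f))
    ev-* : ∀ f g → E (f ⊛ g) ≡ E f ℤ.* E g
    ev-* []      g = refl
    ev-* (a ∷ f) g = trans (ev-+ (a · g) (D.0# ∷ f ⊛ g)) (trans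
      (cong₂ ℤ._+_ (ev-· a g) (cong₂ (λ z s → z ℤ.+ + x ℤ.* s) φ-0 (ev-* f g)))
      (distrib (ev n a X) (+ x) (E f) (E g)))

module Evaluation (n : ℕ) (X : Vec ℕ n) where
  open IsEvaluation (ev-isEvaluation n X) public
    renaming (φ-cong to ev-cong; φ-0 to ev-0; φ-1 to ev-1; φ-+ to ev-+; φ-* to ev-*)

-- Divisibility of an integer by a natural number; for q = 0 it says z = 0.
infix 4 _∣ᶻ_
record _∣ᶻ_ (q : ℕ) (z : ℤ) : Set where
  constructor mk
  field abs : q ℕ.∣ ℤ.∣ z ∣
open _∣ᶻ_ public

∣ᶻ-+ : ∀ {q x y} → q ∣ᶻ x → q ∣ᶻ y → q ∣ᶻ x ℤ.+ y
∣ᶻ-+ {q} {x} {y} (mk d) (mk e) = mk (Signed.∣⇒∣ᵤ {+ q}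
  (Signed.∣m∣n⇒∣m+n (Signed.∣ᵤ⇒∣ {+ q} {x} d) (Signed.∣ᵤ⇒∣ {+ q} {y} e)))

∣ᶻ-*ˡ : ∀ {q y} x → q ∣ᶻ y → q ∣ᶻ x ℤ.* y
∣ᶻ-*ˡ {q} {y} x (mk d) = mk (subst (q ℕ.∣_) (sym (ℤ.abs-* x y)) (ℕ.∣n⇒∣m*n ℤ.∣ x ∣ d))

elimination : ∀ n F → JointlyCoprime (suc n) F → ∃[ R ] (¬ 𝔻._≈_ n R (𝔻.0# n)) ×
  (∀ q x X → All (λ f → q ∣ᶻ ev (suc n) f (x ∷ X)) F → q ∣ᶻ ev n R X)
elimination n F cop with Resultant.resultant (𝔻 n) F
  (λ h divs → let m , m≢0 , d = cop h divs in scalar n m , scalar≉0 n m≢0 , d)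
... | R , R≉0 , gen = R , R≉0 , λ q x X divs →
  subst (q ∣ᶻ_) (trans (cong (ℤ._+_ (ev n R X)) (ℤ.*-zeroʳ (+ x))) (ℤ.+-identityʳ _))
    (gen (λ f → q ∣ᶻ ev (suc n) f (x ∷ X)) (vanishing q x X) divs)
  where
  vanishing : ∀ q x X → Resultant.IsIdeal (𝔻 n) (λ f → q ∣ᶻ ev (suc n) f (x ∷ X))
  vanishing q x X = record
    { resp = λ {f} {g} e → subst (q ∣ᶻ_) (ev-cong f g e)
    ; nil  = mk (q ℕ.∣0)
    ; add  = λ {f} {g} d e → subst (q ∣ᶻ_) (sym (ev-+ f g)) (∣ᶻ-+ d e)
    ; mult = λ h {f} d → subst (q ∣ᶻ_) (sym (ev-* h f)) (∣ᶻ-*ˡ (ev (suc n) h (x ∷ X)) d) }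
    where open Evaluation (suc n) (x ∷ X)

open import Data.List.Base using (deduplicate; map)
open import Data.List.Membership.Propositional using (lose)
open import Data.List.Membership.Propositional.Properties using (∈-deduplicate⁺; ∈-deduplicate⁻)
open import Data.List.Relation.Unary.Any as Any using (Any; here; there)
open import Data.List.Relation.Unary.AllPairs using ([]; _∷_)
open import Data.List.Relation.Unary.Unique.Propositional using (Unique)
open import Data.List.Relation.Unary.Unique.DecPropositional.Properties using (deduplicate-!)
open import Data.Nat.Base using (_+_; _*_; _∸_; _^_; _≤_; _<_; NonZero; _!)
open import Data.Vec.Properties using (≡-dec)
open import Relation.Binary.Definitions using (DecidableEquality)
open import Relation.Binary.PropositionalEquality using (_≢_)
open import Data.Nat.Primality using (Prime; euclidsLemma; prime⇒nonTrivial; prime⇒nonZero; prime⇒irreducible; ¬prime[1])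
open import Relation.Nullary.Decidable using (map′; toSum)
open import Data.Nat.ListAction using (product)
open import Data.Nat.Combinatorics using (nCk+nC[k+1]≡[n+1]C[k+1]; nCk≡nC[n∸k]; nCn≡1; nCk≡n!/k![n-k]!; k>n⇒nCk≡0; k![n∸k]!∣n!) renaming (_C_ to _choose_)
import Data.List.Membership.Propositional as List
open import Data.Nat.Solver using (module +-*-Solver)
import Data.List.Properties as List
import Data.Nat.DivMod as ℕ
import Data.Vec.Relation.Unary.All as VecAll

weight : {A : Set} → (A → ℕ) → List A → ℕ
weight w []       = 0
weight w (a ∷ as) = w a + weight w as

-- ∑_{a ∈ S} w a ≤ M / Q, where S may be infinite and undecidable.
Mass : {A : Set} → (A → ℕ) → (A → Set) → ℕ → ℕ → Set
Mass w S Q M = ∀ as → Unique as → All S as → weight w as * Q ≤ M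

one : {A : Set} → A → ℕ
one _ = 1

weight-one : {A : Set} (as : List A) → weight one as ≡ length as
weight-one []       = refl
weight-one (_ ∷ as) = cong suc (weight-one as)

module _ {A : Set} where

  record Splitting (w : A → ℕ) (P P′ : A → Set) (as : List A) : Set₁ where
    field
      left right : List A
      unique-l   : Unique left
      unique-r   : Unique right
      all-l      : All P left
      all-r      : All P′ right
      total      : weight w as ≡ weight w left + weight w right
      keep-l     : ∀ {R : A → Set} → All R as → All R left
      keep-r     : ∀ {R : A → Set} → All R as → All R right

  splitting : ∀ w {P P′ : A → Set} as → Unique as → All (λ a → P a ⊎ P′ a) as → Splitting w P P′ as
  splitting w []       []       []       = record
    { left = [] ; right = [] ; unique-l = [] ; unique-r = [] ; all-l = [] ; all-r = []
    ; total = refl ; keep-l = λ _ → [] ; keep-r = λ _ → [] }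
  splitting w (a ∷ as) (fresh ∷ u) (inj₁ p ∷ ps) = record
    { left = a ∷ left ; right = right ; unique-l = keep-l fresh ∷ unique-l ; unique-r = unique-r
    ; all-l = p ∷ all-l ; all-r = all-r
    ; total = trans (cong (_+_ (w a)) total) (sym (ℕ.+-assoc (w a) _ _))
    ; keep-l = λ { (r ∷ rs) → r ∷ keep-l rs } ; keep-r = λ { (r ∷ rs) → keep-r rs } }
    where open Splitting (splitting w as u ps)
  splitting w (a ∷ as) (fresh ∷ u) (inj₂ p ∷ ps) = record
    { left = left ; right = a ∷ right ; unique-l = unique-l ; unique-r = keep-r fresh ∷ unique-r
    ; all-l = all-l ; all-r = p ∷ all-r
    ; total = trans (cong (_+_ (w a)) total) (solve 3 (λ x y z → x :+ (y :+ z) := y :+ (x :+ z)) refl (w a) (weight w left) (weight w right))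
    ; keep-l = λ { (r ∷ rs) → keep-l rs } ; keep-r = λ { (r ∷ rs) → r ∷ keep-r rs } }
    where
    open Splitting (splitting w as u ps)
    open +-*-Solver

  module _ {w : A → ℕ} where

    mass-⊆ : ∀ {S S′ : A → Set} {Q M} → (∀ {a} → S a → S′ a) → Mass w S′ Q M → Mass w S Q M
    mass-⊆ i m as u all = m as u (All.map i all)

    mass-≤ : ∀ {S : A → Set} {Q M M′} → M ≤ M′ → Mass w S Q M → Mass w S Q M′
    mass-≤ M≤M′ m as u all = ℕ.≤-trans (m as u all) M≤M′

    mass-≡ : ∀ {S : A → Set} {Q Q′ M} → Q ≡ Q′ → Mass w S Q M → Mass w S Q′ M
    mass-≡ refl m = m

    mass-scale : ∀ {S : A → Set} {Q M} k → Mass w S Q M → Mass w S (k * Q) (k * M)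
    mass-scale {S} {Q} {M} k m as u all = begin
      weight w as * (k * Q)  ≡⟨ solve 3 (λ x y z → x :* (y :* z) := y :* (x :* z)) refl (weight w as) k Q ⟩
      k * (weight w as * Q)  ≤⟨ ℕ.*-monoʳ-≤ k (m as u all) ⟩
      k * M                  ∎
      where
      open ℕ.≤-Reasoning
      open +-*-Solver

    mass-⊎ : ∀ {S S′ S″ : A → Set} {Q M M′} → (∀ {a} → S a → S′ a ⊎ S″ a) →
      Mass w S′ Q M → Mass w S″ Q M′ → Mass w S Q (M + M′)
    mass-⊎ {Q = Q} {M} {M′} i m m′ as u all = begin
      weight w as * Q                          ≡⟨ cong (_* Q) total ⟩
      (weight w left + weight w right) * Q     ≡⟨ ℕ.*-distribʳ-+ Q (weight w left) _ ⟩
      weight w left * Q + weight w right * Q   ≤⟨ ℕ.+-mono-≤ (m left unique-l all-l) (m′ right unique-r all-r) ⟩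
      M + M′                                   ∎
      where
      open ℕ.≤-Reasoning
      open Splitting (splitting w as u (All.map i all))

    mass-empty : ∀ {S : A → Set} {Q M} → (∀ {a} → ¬ S a) → Mass w S Q M
    mass-empty ne []       _ _       = z≤n
    mass-empty ne (a ∷ as) _ (s ∷ _) = ⊥-elim (ne s)

    mass-subsingleton : ∀ {S : A → Set} {M} → (∀ {a b} → S a → S b → a ≡ b) → (∀ {a} → S a → w a ≤ M) → Mass w S 1 M
    mass-subsingleton ss le []           _               _            = z≤n
    mass-subsingleton ss le (a ∷ [])     _               (s ∷ [])     =
      ℕ.≤-trans (ℕ.≤-reflexive (trans (ℕ.*-identityʳ _) (ℕ.+-identityʳ _))) (le s)
    mass-subsingleton ss le (a ∷ b ∷ as) ((ne ∷ _) ∷ _) (s ∷ t ∷ _) = ⊥-elim (ne (ss s t))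

  module _ {B : Set} (_≟_ : DecidableEquality B) where

    private
      covered : ∀ {w : A → ℕ} {v : B → ℕ} {R : B → A → Set} {Q M} bs →
        All (λ b → Mass w (R b) Q (M * v b)) bs →
        ∀ as → Unique as → All (λ a → Any (λ b → R b a) bs) as → weight w as * Q ≤ M * weight v bs
      covered [] [] [] _ _ = z≤n
      covered [] [] (a ∷ as) _ (() ∷ _)
      covered {w} {v} {R} {Q} {M} (b ∷ bs) (m ∷ ms) as u all = begin
        weight w as * Q                          ≡⟨ cong (_* Q) total ⟩
        (weight w left + weight w right) * Q     ≡⟨ ℕ.*-distribʳ-+ Q (weight w left) _ ⟩
        weight w left * Q + weight w right * Q   ≤⟨ ℕ.+-mono-≤ (m left unique-l all-l) (covered {w} {v} {R} {Q} {M} bs ms right unique-r all-r) ⟩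
        M * v b + M * weight v bs                ≡⟨ ℕ.*-distribˡ-+ M (v b) _ ⟨
        M * (v b + weight v bs)                  ∎
        where
        open ℕ.≤-Reasoning
        open Splitting (splitting w as u (All.map Any.toSum all))

      gather : ∀ {T : B → Set} {R : B → A → Set} as → All (λ a → ∃[ b ] T b × R b a) as →
        ∃[ bs ] All T bs × All (λ a → ∃[ b ] b List.∈ bs × R b a) as
      gather []       []                  = [] , [] , []
      gather (a ∷ as) ((b , t , r) ∷ all) with gather as all
      ... | bs , ts , rs = b ∷ bs , t ∷ ts , (b , here refl , r) ∷ All.map (λ { (b , i , r) → b , there i , r }) rs

    mass-fibre : ∀ {w : A → ℕ} {v : B → ℕ} {S : A → Set} (T : B → Set) (R : B → A → Set) {Q Q′ M M′} →
      (∀ {a} → S a → ∃[ b ] T b × R b a) → (∀ {b} → T b → Mass w (R b) Q (M * v b)) →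
      Mass v T Q′ M′ → Mass w S (Q * Q′) (M * M′)
    mass-fibre {w} {v} T R {Q} {Q′} {M} {M′} cover fibre base as u all with gather {T} {R} as (All.map cover all)
    ... | bs , ts , rs = begin
      weight w as * (Q * Q′)   ≡⟨ ℕ.*-assoc (weight w as) Q Q′ ⟨
      weight w as * Q * Q′     ≤⟨ ℕ.*-monoˡ-≤ Q′ (covered {w} {v} {R} {Q} {M} cs (All.map fibre ts′) as u
                                    (All.map (λ { (b , i , r) → lose (∈-deduplicate⁺ _≟_ i) r }) rs)) ⟩
      M * weight v cs * Q′     ≡⟨ ℕ.*-assoc M _ Q′ ⟩
      M * (weight v cs * Q′)   ≤⟨ ℕ.*-monoʳ-≤ M (base cs (deduplicate-! _≟_ bs) ts′) ⟩
      M * M′                   ∎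
      where
      open ℕ.≤-Reasoning
      cs = deduplicate _≟_ bs
      ts′ : All T cs
      ts′ = All.tabulate λ i → All.lookup ts (∈-deduplicate⁻ _≟_ bs i)

    mass-injection : ∀ {w : A → ℕ} {v : B → ℕ} {S : A → Set} {T : B → Set} {Q M} (f : A → B) →
      (∀ {a} → S a → T (f a)) → (∀ {a a′} → S a → S a′ → f a ≡ f a′ → a ≡ a′) →
      (∀ {a} → S a → w a ≤ v (f a)) → Mass v T Q M → Mass w S Q M
    mass-injection {w} {v} {S} {T} {Q} {M} f maps inj le m as u all = begin
      weight w as * Q        ≡⟨ cong (weight w as *_) (ℕ.*-identityˡ Q) ⟨
      weight w as * (1 * Q)  ≤⟨ mass-fibre T (λ b a → S a × f a ≡ b) {1} {Q} {1} {M}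
                                  (λ {a} s → f a , maps s , s , refl)
                                  (λ _ → mass-subsingleton (λ { (s , e) (s′ , e′) → inj s s′ (trans e (sym e′)) })
                                    λ { (s , refl) → ℕ.≤-trans (le s) (ℕ.≤-reflexive (sym (ℕ.*-identityˡ _))) })
                                  m as u all ⟩
      1 * M                  ≡⟨ ℕ.*-identityˡ M ⟩
      M                      ∎
      where open ℕ.≤-Reasoning

∑< : ℕ → (ℕ → ℕ) → ℕ
∑< zero    v = 0
∑< (suc n) v = ∑< n v + v n

mass-below : ∀ {v : ℕ → ℕ} n → Mass v (_< n) 1 (∑< n v)
mass-below zero    = mass-empty λ ()
mass-below {v} (suc n) = mass-⊎ (λ {a} a<n → [ inj₁ , (λ e → inj₂ e) ]′ (ℕ.m<1+n⇒m<n∨m≡n a<n)) (mass-below n)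
  (mass-subsingleton (λ e e′ → trans e (sym e′)) λ { refl → ℕ.≤-refl })

∑<-const : ∀ n c → ∑< n (λ _ → c) ≡ n * c
∑<-const zero    c = refl
∑<-const (suc n) c = trans (cong (_+ c) (∑<-const n c)) (ℕ.+-comm (n * c) c)

count-below : ∀ n → Mass one (_< n) 1 n
count-below n = mass-≤ (ℕ.≤-reflexive (trans (∑<-const n 1) (ℕ.*-identityʳ n))) (mass-below n)

∑<-2^ : ∀ n → ∑< n (2 ^_) < 2 ^ n
∑<-2^ zero    = s≤s z≤n
∑<-2^ (suc n) = ℕ.≤-trans (ℕ.+-monoˡ-≤ (2 ^ n) (∑<-2^ n)) (ℕ.≤-reflexive (cong (_+_ (2 ^ n)) (sym (ℕ.+-identityʳ _))))

-- Dyadic boxes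

Dyadic : ℕ → ℕ → Set
Dyadic k x = 2 ^ k ≤ x × x < 2 ^ suc k

abstract
  dyadic : ∀ x → 1 ≤ x → ∃[ k ] Dyadic k x
  dyadic (suc zero)    _ = 0 , s≤s z≤n , s≤s (s≤s z≤n)
  dyadic (suc (suc x)) _ with dyadic (suc x) (s≤s z≤n)
  ... | k , lo , hi with suc (suc x) ℕ.<? 2 ^ suc k
  ... | yes p = k , ℕ.m≤n⇒m≤1+n lo , p
  ... | no ¬p = suc k , ℕ.≮⇒≥ ¬p , (begin-strict
    suc (suc x)    ≤⟨ hi ⟩
    2 ^ suc k      <⟨ ℕ.^-monoʳ-< 2 (s≤s (s≤s z≤n)) (ℕ.n<1+n (suc k)) ⟩
    2 ^ suc (suc k) ∎)
    where open ℕ.≤-Reasoning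

mass-dyadic : ∀ k → Mass one (Dyadic k) 1 (2 ^ k)
mass-dyadic k = mass-injection ℕ._≟_ (_∸ 2 ^ k)
  (λ { {x} (lo , hi) → ℕ.+-cancelʳ-< (2 ^ k) (x ∸ 2 ^ k) (2 ^ k) (subst (_< 2 ^ k + 2 ^ k) (sym (ℕ.m∸n+n≡m lo)) (subst (x <_) (cong (_+_ (2 ^ k)) (ℕ.+-identityʳ _)) hi)) })
  (λ { (lo , _) (lo′ , _) e → ℕ.∸-cancelʳ-≡ lo lo′ e })
  (λ _ → ℕ.≤-refl) (count-below (2 ^ k))

data Box : ∀ {n} → Vec ℕ n → Vec ℕ n → Set where
  []  : Box [] []
  _∷_ : ∀ {n k x} {ks X : Vec ℕ n} → Dyadic k x → Box ks X → Box (k ∷ ks) (x ∷ X)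

vol : ∀ {n} → Vec ℕ n → ℕ
vol ks = 2 ^ Vec.sum ks

vol-∷ : ∀ {n} k (ks : Vec ℕ n) → vol (k ∷ ks) ≡ 2 ^ k * vol ks
vol-∷ k ks = ℕ.^-distribˡ-+-* 2 k (Vec.sum ks)

mass-∷ : ∀ {n} {S : Vec ℕ (suc n) → Set} (T : Vec ℕ n → Set) {Q Q′ M M′} →
  (∀ {x X} → S (x ∷ X) → T X) → (∀ {X} → T X → Mass one (λ x → S (x ∷ X)) Q M) →
  Mass one T Q′ M′ → Mass one S (Q * Q′) (M * M′)
mass-∷ {n} {S} T {Q} {Q′} {M} tail heads tails = mass-fibre (≡-dec ℕ._≟_) T (λ X Y → S Y × Vec.tail Y ≡ X) {Q} {Q′} {M}
  (λ { {x ∷ X} s → X , tail s , s , refl })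
  (λ {X} t → mass-≤ (ℕ.≤-reflexive (sym (ℕ.*-identityʳ M))) (mass-injection ℕ._≟_ Vec.head
    (λ { {x ∷ _} (s , refl) → s }) (λ { {x ∷ _} {y ∷ _} (_ , refl) (_ , refl) refl → refl })
    (λ _ → ℕ.≤-refl) (heads t))) tails

mass-box : ∀ {n} (ks : Vec ℕ n) → Mass one (Box ks) 1 (vol ks)
mass-box [] = mass-subsingleton (λ { [] [] → refl }) (λ _ → ℕ.≤-refl)
mass-box (k ∷ ks) = subst (Mass one (Box (k ∷ ks)) 1) (sym (vol-∷ k ks))
  (mass-∷ (Box ks) (λ { (_ ∷ b) → b }) (λ _ → mass-⊆ (λ { (d ∷ _) → d }) (mass-dyadic k)) (mass-box ks))

_∣ᶻ?_ : ∀ q z → Dec (q ∣ᶻ z)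
q ∣ᶻ? z = map′ mk abs (q ℕ.∣? ℤ.∣ z ∣)

∣ᶻ-neg : ∀ {q x} → q ∣ᶻ x → q ∣ᶻ ℤ.- x
∣ᶻ-neg {q} {x} (mk d) = mk (subst (q ℕ.∣_) (sym (ℤ.∣-i∣≡∣i∣ x)) d)

∣ᶻ-- : ∀ {q x y} → q ∣ᶻ x → q ∣ᶻ y → q ∣ᶻ x ℤ.- y
∣ᶻ-- d e = ∣ᶻ-+ d (∣ᶻ-neg e)

-- Two kinds of prime ideals (q) are sieved by: q a prime, and q = 0.  In both
-- cases an interval of length 2ᵏ, k ≥ K, meets a class in at most 2ᵏ⁺¹ / Q points.
record Modulus (q Q K : ℕ) : Set₁ where
  field
    prime : ∀ a b → q ∣ᶻ a ℤ.* b → q ∣ᶻ a ⊎ q ∣ᶻ b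
    class : ∀ k → K ≤ k → (C : ℕ → Set) → (∀ {x} → C x → Dyadic k x) →
            (∀ {x y} → C x → C y → q ∣ᶻ + x ℤ.- + y) → Mass one C Q (2 * 2 ^ k)
    small : ∀ c → c ≢ 0ℤ → q ∣ᶻ c → Q ≤ ℤ.∣ c ∣

∣ᶻ⇒≤ : ∀ {q c} → c ≢ 0ℤ → q ∣ᶻ c → q ≤ ℤ.∣ c ∣
∣ᶻ⇒≤ {q} {c} c≢0 (mk d) = ℕ.∣⇒≤ {{ℕ.≢-nonZero λ e → c≢0 (ℤ.∣i∣≡0⇒i≡0 e)}} d

euclid-ℤ : ∀ {p} → Prime p → ∀ a b → p ∣ᶻ a ℤ.* b → p ∣ᶻ a ⊎ p ∣ᶻ b
euclid-ℤ {p} prime-p a b (mk d) with euclidsLemma ℤ.∣ a ∣ ℤ.∣ b ∣ prime-p (subst (p ℕ.∣_) (ℤ.abs-* a b) d)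
... | inj₁ e = inj₁ (mk e)
... | inj₂ e = inj₂ (mk e)

∣-difference⇒≡ : ∀ {p x y} → y ≤ x → x ∸ y < p → p ∣ᶻ + x ℤ.- + y → x ≡ y
∣-difference⇒≡ {p} {x} {y} y≤x x-y<p (mk d) with x ∸ y in eq
... | zero  = ℕ.≤-antisym (ℕ.m∸n≡0⇒m≤n eq) y≤x
... | suc e = ⊥-elim (ℕ.≤⇒≯ (ℕ.∣⇒≤ (subst (p ℕ.∣_) abs≡ d)) x-y<p)
  where
  abs≡ : ℤ.∣ + x ℤ.- + y ∣ ≡ suc e
  abs≡ = trans (cong ℤ.∣_∣ (trans (ℤ.m-n≡m⊖n x y) (ℤ.⊖-≥ y≤x))) eq

-- The index ⌊(x - 2ᵏ) / p⌋ separates the elements of one residue class.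
class-mod : ∀ p .{{_ : NonZero p}} k (C : ℕ → Set) → (∀ {x} → C x → Dyadic k x) →
  (∀ {x y} → C x → C y → p ∣ᶻ + x ℤ.- + y) → Mass one C 1 (suc (2 ^ k ℕ./ p))
class-mod p k C dy cong-p = mass-injection ℕ._≟_ index index< injective (λ _ → ℕ.≤-refl) (count-below _)
  where
  index : ℕ → ℕ
  index x = (x ∸ 2 ^ k) ℕ./ p
  offset≤ : ∀ {x} → Dyadic k x → x ∸ 2 ^ k ≤ 2 ^ k
  offset≤ {x} (_ , hi) = ℕ.m≤n+o⇒m∸n≤o x (2 ^ k) (ℕ.≤-trans (ℕ.<⇒≤ hi) (ℕ.≤-reflexive (cong (_+_ (2 ^ k)) (ℕ.+-identityʳ _))))
  index< : ∀ {x} → C x → index x < suc (2 ^ k ℕ./ p)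
  index< c = s≤s (ℕ./-monoˡ-≤ p (offset≤ (dy c)))
  ordered : ∀ {x y} → y ≤ x → C x → C y → index x ≡ index y → x ≡ y
  ordered {x} {y} y≤x cx cy e = ∣-difference⇒≡ y≤x (begin-strict
    x ∸ y                        ≡⟨ shifted ⟩
    a ∸ b                        ≤⟨ ℕ.∸-monoʳ-≤ a b≥ ⟩
    a ∸ a ℕ./ p * p              ≡⟨ ℕ.m%n≡m∸m/n*n a p ⟨
    a ℕ.% p                      <⟨ ℕ.m%n<n a p ⟩
    p                            ∎) (cong-p cx cy)
    where
    open ℕ.≤-Reasoning
    a = x ∸ 2 ^ k
    b = y ∸ 2 ^ k
    shifted : x ∸ y ≡ a ∸ b
    shifted = trans (cong (x ∸_) (sym (ℕ.m+[n∸m]≡n (dy cy .proj₁)))) (sym (ℕ.∸-+-assoc x (2 ^ k) b))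
    b≥ : a ℕ./ p * p ≤ b
    b≥ = subst (λ j → j * p ≤ b) (sym e) (ℕ.m/n*n≤m b p)
  injective : ∀ {x y} → C x → C y → index x ≡ index y → x ≡ y
  injective {x} {y} cx cy e with ℕ.≤-total y x
  ... | inj₁ y≤x = ordered y≤x cx cy e
  ... | inj₂ x≤y = sym (ordered x≤y cy cx (sym e))

modulus-prime : ∀ {p K} → Prime p → p ≤ 2 ^ K → Modulus p p K
modulus-prime {p} {K} prime-p p≤ = record
  { prime = euclid-ℤ prime-p
  ; class = λ k K≤k C dy c as u all → begin
      weight one as * p           ≤⟨ ℕ.*-monoˡ-≤ p (ℕ.≤-trans (ℕ.≤-reflexive (sym (ℕ.*-identityʳ (weight one as)))) (class-mod p k C dy c as u all)) ⟩
      suc (2 ^ k ℕ./ p) * p       ≡⟨⟩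
      p + 2 ^ k ℕ./ p * p         ≤⟨ ℕ.+-mono-≤ (ℕ.≤-trans p≤ (ℕ.^-monoʳ-≤ 2 K≤k)) (ℕ.m/n*n≤m (2 ^ k) p) ⟩
      2 ^ k + 2 ^ k               ≡⟨ cong (_+_ (2 ^ k)) (ℕ.+-identityʳ _) ⟨
      2 * 2 ^ k                   ∎
  ; small = λ c → ∣ᶻ⇒≤ }
  where
  open ℕ.≤-Reasoning
  instance _ = prime⇒nonZero prime-p

modulus-large : ∀ {p K} → Prime p → 2 ^ K < p → Modulus p (2 ^ K) K
modulus-large {p} {K} prime-p <p = record
  { prime = euclid-ℤ prime-p
  ; class = λ k K≤k C dy c as u all → begin
      weight one as * 2 ^ K          ≤⟨ ℕ.*-monoˡ-≤ (2 ^ K) (ℕ.≤-trans (ℕ.≤-reflexive (sym (ℕ.*-identityʳ (weight one as)))) (class-mod p k C dy c as u all)) ⟩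
      2 ^ K + 2 ^ k ℕ./ p * 2 ^ K    ≤⟨ ℕ.+-mono-≤ (ℕ.^-monoʳ-≤ 2 K≤k) (ℕ.≤-trans (ℕ.*-monoʳ-≤ (2 ^ k ℕ./ p) (ℕ.<⇒≤ <p)) (ℕ.m/n*n≤m (2 ^ k) p)) ⟩
      2 ^ k + 2 ^ k                  ≡⟨ cong (_+_ (2 ^ k)) (ℕ.+-identityʳ _) ⟨
      2 * 2 ^ k                      ∎
  ; small = λ c c≢0 d → ℕ.≤-trans (ℕ.<⇒≤ <p) (∣ᶻ⇒≤ c≢0 d) }
  where
  open ℕ.≤-Reasoning
  instance _ = prime⇒nonZero prime-p

0∣ᶻ⇒≡0 : ∀ {z} → 0 ∣ᶻ z → z ≡ 0ℤ
0∣ᶻ⇒≡0 (mk d) = ℤ.∣i∣≡0⇒i≡0 (ℕ.0∣⇒≡0 d)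

modulus-zero : ∀ {K} → Modulus 0 (2 ^ K) K
modulus-zero {K} = record
  { prime = λ a b d → [ (λ { refl → inj₁ (mk ℕ.∣-refl) }) , (λ { refl → inj₂ (mk ℕ.∣-refl) }) ]′ (ℤ.i*j≡0⇒i≡0∨j≡0 a (0∣ᶻ⇒≡0 d))
  ; class = λ k K≤k C dy c → mass-≤ (ℕ.≤-trans (ℕ.^-monoʳ-≤ 2 K≤k) (ℕ.m≤n*m (2 ^ k) 2))
      (subst₂ (Mass one C) (ℕ.*-identityʳ (2 ^ K)) (ℕ.*-identityʳ (2 ^ K)) (mass-scale (2 ^ K)
        (mass-subsingleton (λ {x} {y} cx cy → ℤ.+-injective (ℤ.i-j≡0⇒i≡j (+ x) (+ y) (0∣ᶻ⇒≡0 (c cx cy)))) λ _ → ℕ.≤-refl)))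
  ; small = λ c c≢0 d → ⊥-elim (c≢0 (0∣ᶻ⇒≡0 d)) }
  where open ≡ using (subst₂)

horner : List ℤ → ℤ → ℤ
horner []      x = 0ℤ
horner (a ∷ f) x = a ℤ.+ x ℤ.* horner f x

evₗ-horner : ∀ n f x X → evₗ n f x X ≡ horner (map (λ a → ev n a X) f) (+ x)
evₗ-horner n []      x X = refl
evₗ-horner n (a ∷ f) x X = cong (λ s → ev n a X ℤ.+ + x ℤ.* s) (evₗ-horner n f x X)

-- Synthetic division by x - c.
quotient : ℤ → List ℤ → List ℤ
quotient c []          = []
quotient c (a ∷ [])    = []
quotient c (a ∷ b ∷ f) = horner (b ∷ f) c ∷ quotient c (b ∷ f)

module _ where
  open import Data.Integer.Tactic.RingSolver using (solve-∀)
  private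
    constant : ∀ a x c → (a ℤ.+ x ℤ.* 0ℤ) ℤ.- (a ℤ.+ c ℤ.* 0ℤ) ≡ (x ℤ.- c) ℤ.* 0ℤ
    constant = solve-∀
    linear : ∀ a x c hx hc → (a ℤ.+ x ℤ.* hx) ℤ.- (a ℤ.+ c ℤ.* hc) ≡ (x ℤ.- c) ℤ.* hc ℤ.+ x ℤ.* (hx ℤ.- hc)
    linear = solve-∀
    regroup : ∀ x c h q → (x ℤ.- c) ℤ.* h ℤ.+ x ℤ.* ((x ℤ.- c) ℤ.* q) ≡ (x ℤ.- c) ℤ.* (h ℤ.+ x ℤ.* q)
    regroup = solve-∀
    head : ∀ a y → (a ℤ.+ y) ℤ.- y ≡ a
    head = solve-∀

  horner-quotient : ∀ c f x → horner f x ℤ.- horner f c ≡ (x ℤ.- c) ℤ.* horner (quotient c f) x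
  horner-quotient c []          x = sym (ℤ.*-zeroʳ (x ℤ.- c))
  horner-quotient c (a ∷ [])    x = constant a x c
  horner-quotient c (a ∷ b ∷ f) x = trans (linear a x c (horner (b ∷ f) x) (horner (b ∷ f) c))
    (trans (cong (λ z → (x ℤ.- c) ℤ.* horner (b ∷ f) c ℤ.+ x ℤ.* z) (horner-quotient c (b ∷ f) x))
      (regroup x c (horner (b ∷ f) c) (horner (quotient c (b ∷ f)) x)))

  quotient-∣ : ∀ {q} c f → q ∣ᶻ horner f c → All (q ∣ᶻ_) (quotient c f) → All (q ∣ᶻ_) f
  quotient-∣ c []          root divs = []
  quotient-∣ {q} c (a ∷ [])    root divs = subst (q ∣ᶻ_) (trans (cong (ℤ._+_ a) (ℤ.*-zeroʳ c)) (ℤ.+-identityʳ a)) root ∷ []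
  quotient-∣ {q} c (a ∷ b ∷ f) root (d ∷ divs) =
    subst (q ∣ᶻ_) (head a (c ℤ.* horner (b ∷ f) c)) (∣ᶻ-- root (∣ᶻ-*ˡ c d)) ∷ quotient-∣ c (b ∷ f) d divs

length-quotient : ∀ c a f → length (quotient c (a ∷ f)) ≡ length f
length-quotient c a []      = refl
length-quotient c a (b ∷ f) = cong suc (length-quotient c b f)

module _ {q Q K : ℕ} (modulus : Modulus q Q K) where
  open Modulus modulus

  mass-roots : ∀ k → K ≤ k → ∀ f → ¬ All (q ∣ᶻ_) f →
    Mass one (λ x → Dyadic k x × q ∣ᶻ horner f (+ x)) Q (length f * (2 * 2 ^ k))
  mass-roots k K≤k f = go (length f) f refl
    where
    go : ∀ n f → length f ≡ n → ¬ All (q ∣ᶻ_) f →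
      Mass one (λ x → Dyadic k x × q ∣ᶻ horner f (+ x)) Q (n * (2 * 2 ^ k))
    go n       []      len ¬all = ⊥-elim (¬all [])
    go (suc n) (a ∷ f) len ¬all []       u all = z≤n
    go (suc n) (a ∷ f) len ¬all (c ∷ xs) u all@((_ , root) ∷ _) = mass-⊎
      {S′ = λ x → Dyadic k x × q ∣ᶻ + x ℤ.- + c} {S″ = λ x → Dyadic k x × q ∣ᶻ horner g (+ x)}
      (λ { {x} (dy , d) → [ (λ e → inj₁ (dy , e)) , (λ e → inj₂ (dy , e)) ]′ (prime (+ x ℤ.- + c) _
        (subst (q ∣ᶻ_) (horner-quotient (+ c) (a ∷ f) (+ x)) (∣ᶻ-- d root))) })
      (class k K≤k _ proj₁ λ { {x} {y} (_ , d) (_ , e) → subst (q ∣ᶻ_) (cancel (+ x) (+ y) (+ c)) (∣ᶻ-- d e) })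
      (go n g (trans (length-quotient (+ c) a f) (ℕ.suc-injective len)) λ all → ¬all (quotient-∣ (+ c) (a ∷ f) root all))
      (c ∷ xs) u all
      where
      open import Data.Integer.Tactic.RingSolver using (solve-∀)
      g = quotient (+ c) (a ∷ f)
      cancel : ∀ x y c → (x ℤ.- c) ℤ.- (y ℤ.- c) ≡ x ℤ.- y
      cancel = solve-∀

  mass-fibre-roots : ∀ n k → K ≤ k → ∀ f X → ¬ All (λ a → q ∣ᶻ ev n a X) f →
    Mass one (λ x → Dyadic k x × q ∣ᶻ evₗ n f x X) Q (length f * (2 * 2 ^ k))
  mass-fibre-roots n k K≤k f X ¬all = mass-⊆ (λ { {x} (dy , d) → dy , subst (q ∣ᶻ_) (evₗ-horner n f x X) d })
    (subst (λ l → Mass one (λ x → Dyadic k x × q ∣ᶻ horner F (+ x)) Q (l * (2 * 2 ^ k))) (List.length-map _ f)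
      (mass-roots k K≤k F λ all → ¬all (All.map⁻ all)))
    where F = map (λ a → ev n a X) f

nonzero-coef : ∀ n f → ¬ 𝔻._≈_ (suc n) f [] → ∃[ a ] a List.∈ f × ¬ 𝔻._≈_ n a (𝔻.0# n)
nonzero-coef n []      ne = ⊥-elim (ne (𝔻.refl (suc n)))
nonzero-coef n (a ∷ f) ne with 𝔻.zero? n a
... | no a≉0  = a , here refl , a≉0
... | yes a≈0 with nonzero-coef n f (λ e → ne (𝔓.0∷≋[] n a≈0 e))
... | b , i , b≉0 = b , there i , b≉0

mass-point : ∀ {S : Vec ℕ 0 → Set} {Q M} → (∀ {X} → S X → Q ≤ M) → Mass one S Q M
mass-point le []            u all     = z≤n
mass-point {Q = Q} le ([] ∷ []) u (s ∷ _) = ℕ.≤-trans (ℕ.≤-reflexive (ℕ.*-identityˡ Q)) (le s)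
mass-point le ([] ∷ [] ∷ _) ((ne ∷ _) ∷ _) _ = ⊥-elim (ne refl)

-- A version of the Schwartz–Zippel lemma for boxes.
mass-zeros : ∀ n h → ¬ 𝔻._≈_ n h (𝔻.0# n) → ∃[ C ] (∀ {q Q K} → Modulus q Q K → ∀ ks → VecAll.All (K ≤_) ks →
  Mass one (λ X → Box ks X × q ∣ᶻ ev n h X) Q (C * vol ks))
mass-zeros zero    c c≢0 = ℤ.∣ c ∣ , λ { modulus [] _ → mass-point λ { {[]} (_ , d) →
  ℕ.≤-trans (Modulus.small modulus c c≢0 d) (ℕ.≤-reflexive (sym (ℕ.*-identityʳ _))) } }
mass-zeros (suc n) f f≉0 with nonzero-coef n f f≉0
... | a , a∈f , a≉0 with mass-zeros n a a≉0
... | C , bound = C + length f * 2 , go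
  where
  total : ∀ C l x v {w} → w ≡ x * v → x * (C * v) + l * (2 * x) * v ≡ (C + l * 2) * w
  total C l x v refl = solve 4 (λ C l x v → x :* (C :* v) :+ l :* (con 2 :* x) :* v := (C :+ l :* con 2) :* (x :* v)) refl C l x v
    where open +-*-Solver
  go : ∀ {q Q K} → Modulus q Q K → ∀ ks → VecAll.All (K ≤_) ks →
    Mass one (λ X → Box ks X × q ∣ᶻ ev (suc n) f X) Q ((C + length f * 2) * vol ks)
  go {q} {Q} modulus (k ∷ ks) (K≤k VecAll.∷ K≤ks) = mass-≤ (ℕ.≤-reflexive (total C (length f) (2 ^ k) (vol ks) (vol-∷ k ks)))
    (mass-⊎ {S′ = S₁} {S₂}
      (λ { {x ∷ X} (b , d) → [ (λ e → inj₁ (b , e)) , (λ e → inj₂ (b , e , d)) ]′ (toSum (q ∣ᶻ? ev n a X)) })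
      (mass-≡ (ℕ.*-identityˡ Q) (mass-∷ {S = S₁} (λ X → Box ks X × q ∣ᶻ ev n a X) (λ { (_ ∷ b , d) → b , d })
        (λ _ → mass-⊆ (λ { (d ∷ _ , _) → d }) (mass-dyadic k)) (bound modulus ks K≤ks)))
      (mass-≡ (ℕ.*-identityʳ Q) (mass-∷ {S = S₂} (λ X → Box ks X × ¬ (q ∣ᶻ ev n a X)) (λ { (_ ∷ b , nd , _) → b , nd })
        (λ { {X} (_ , nd) → mass-⊆ (λ { (d ∷ _ , _ , e) → d , e })
          (mass-fibre-roots modulus n k K≤k f X λ all → nd (All.lookup all a∈f)) })
        (mass-⊆ proj₁ (mass-box ks)))))
    where
    S₁ S₂ : Vec ℕ (suc n) → Set
    S₁ Y = Box (k ∷ ks) Y × q ∣ᶻ ev n a (Vec.tail Y)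
    S₂ Y = Box (k ∷ ks) Y × ¬ (q ∣ᶻ ev n a (Vec.tail Y)) × q ∣ᶻ ev (suc n) f Y

length≤concat : ∀ {A : Set} {f : List A} {F} → f List.∈ F → length f ≤ length (concat F)
length≤concat {f = f} {_ ∷ F} (here refl) = ℕ.≤-trans (ℕ.m≤m+n _ _) (ℕ.≤-reflexive (sym (List.length-++ f {concat F})))
length≤concat {F = g ∷ F}     (there i)   = ℕ.≤-trans (length≤concat i) (ℕ.≤-trans (ℕ.m≤n+m _ (length g)) (ℕ.≤-reflexive (sym (List.length-++ g {concat F}))))

module _ (n : ℕ) where

  Vanishes : ℕ → List (ℤ[X] n) → Vec ℕ n → Set
  Vanishes q F X = All (λ f → q ∣ᶻ ev n f X) F

  vanishes? : ∀ q F X → Dec (Vanishes q F X)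
  vanishes? q F X = All.all? (λ f → q ∣ᶻ? ev n f X) F

  nonvanishing-row : ∀ {q X} F → ¬ Vanishes q (concat F) X → ∃[ f ] f List.∈ F × ¬ Vanishes q f X
  nonvanishing-row []      ne = ⊥-elim (ne [])
  nonvanishing-row {q} {X} (f ∷ F) ne with vanishes? q f X
  ... | no ¬v = f , here refl , ¬v
  ... | yes v with nonvanishing-row F (λ vs → ne (All.++⁺ v vs))
  ... | g , i , ¬v = g , there i , ¬v

  mass-fibre-vanishing : ∀ {q Q K} → Modulus q Q K → ∀ k → K ≤ k → ∀ F X → ¬ Vanishes q (concat F) X →
    Mass one (λ x → Dyadic k x × All (λ f → q ∣ᶻ evₗ n f x X) F) Q (length (concat F) * (2 * 2 ^ k))
  mass-fibre-vanishing modulus k K≤k F X ne with nonvanishing-row F ne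
  ... | f , i , ¬v = mass-≤ (ℕ.*-monoˡ-≤ (2 * 2 ^ k) (length≤concat i))
    (mass-⊆ (λ { (d , all) → d , All.lookup all i }) (mass-fibre-roots modulus n k K≤k f X ¬v))

nonzero-member : ∀ F → JointlyCoprime 0 F → ∃[ c ] c List.∈ F × c ≢ 0ℤ
nonzero-member F cop = find F λ all → let m , m≢0 , q , e = cop 0ℤ (All.map (λ { refl → 0ℤ , refl }) all) in m≢0 (sym e)
  where
  find : ∀ F → ¬ All (_≡ 0ℤ) F → ∃[ c ] c List.∈ F × c ≢ 0ℤ
  find []      ne = ⊥-elim (ne [])
  find (c ∷ F) ne with c ℤ.≟ 0ℤ
  ... | no c≢0  = c , here refl , c≢0
  ... | yes c≡0 with find F (λ all → ne (c≡0 ∷ all))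
  ... | b , i , b≢0 = b , there i , b≢0

-- Common zeros modulo q have codimension two.
mass-common-zeros : ∀ n F → JointlyCoprime n F → ∃[ C ] (∀ {q Q K} → Modulus q Q K → ∀ ks → VecAll.All (K ≤_) ks →
  Mass one (λ X → Box ks X × Vanishes n q F X) (Q * Q) (C * vol ks))
mass-common-zeros zero    F cop with nonzero-member F cop
... | c , i , c≢0 = ℤ.∣ c ∣ * ℤ.∣ c ∣ , λ { {q} {Q} modulus [] _ → mass-point λ { {[]} (_ , all) →
  let le = Modulus.small modulus c c≢0 (All.lookup all i) in
  ℕ.≤-trans (ℕ.*-mono-≤ le le) (ℕ.≤-reflexive (sym (ℕ.*-identityʳ _))) } }
mass-common-zeros (suc n) F cop with mass-common-zeros n (concat F) (coprime-coefs n F cop) | elimination n F cop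
... | C , bound | R , R≉0 , R-divides with mass-zeros n R R≉0
... | C′ , bound′ = C + D * 2 * C′ , go
  where
  D = length (concat F)
  total : ∀ C C′ D x v {w} → w ≡ x * v → x * (C * v) + D * (2 * x) * (C′ * v) ≡ (C + D * 2 * C′) * w
  total C C′ D x v refl = solve 5 (λ C C′ D x v → x :* (C :* v) :+ D :* (con 2 :* x) :* (C′ :* v) := (C :+ D :* con 2 :* C′) :* (x :* v)) refl C C′ D x v
    where open +-*-Solver
  go : ∀ {q Q K} → Modulus q Q K → ∀ ks → VecAll.All (K ≤_) ks →
    Mass one (λ X → Box ks X × Vanishes (suc n) q F X) (Q * Q) ((C + D * 2 * C′) * vol ks)
  go {q} {Q} modulus (k ∷ ks) (K≤k VecAll.∷ K≤ks) = mass-≤ (ℕ.≤-reflexive (total C C′ D (2 ^ k) (vol ks) (vol-∷ k ks)))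
    (mass-⊎ {S′ = S₁} {S₂}
      (λ { {x ∷ X} (b , d) → [ (λ e → inj₁ (b , e)) , (λ e → inj₂ (b , e , d)) ]′ (toSum (vanishes? n q (concat F) X)) })
      (mass-≡ (ℕ.*-identityˡ (Q * Q)) (mass-∷ {S = S₁} (λ X → Box ks X × Vanishes n q (concat F) X) (λ { (_ ∷ b , d) → b , d })
        (λ _ → mass-⊆ (λ { (d ∷ _ , _) → d }) (mass-dyadic k)) (bound modulus ks K≤ks)))
      (mass-∷ {S = S₂} (λ X → (Box ks X × q ∣ᶻ ev n R X) × ¬ Vanishes n q (concat F) X)
        (λ { {x} {X} (_ ∷ b , nv , v) → (b , R-divides q x X v) , nv })
        (λ { {X} (_ , nv) → mass-⊆ (λ { (d ∷ _ , _ , v) → d , v }) (mass-fibre-vanishing n modulus k K≤k F X nv) })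
        (mass-⊆ proj₁ (bound′ modulus ks K≤ks))))
    where
    S₁ S₂ : Vec ℕ (suc n) → Set
    S₁ Y = Box (k ∷ ks) Y × Vanishes n q (concat F) (Vec.tail Y)
    S₂ Y = Box (k ∷ ks) Y × ¬ Vanishes n q (concat F) (Vec.tail Y) × Vanishes (suc n) q F Y

-- Large primes

product-primes-∣ : ∀ {c} ps → c ≢ 0 → Unique ps → All (λ p → Prime p × p ℕ.∣ c) ps → product ps ℕ.∣ c
product-primes-∣ []       c≢0 _ _ = ℕ.1∣ _
product-primes-∣ {c} (p ∷ ps) c≢0 (fresh ∷ u) ((prime-p , ℕ.divides d eq) ∷ all) =
  subst (p * product ps ℕ.∣_) (trans (ℕ.*-comm p d) (sym eq)) (ℕ.*-monoʳ-∣ p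
    (product-primes-∣ ps (λ { refl → c≢0 eq }) u (All.zipWith descend (fresh , all))))
  where
  descend : ∀ {q} → p ≢ q × Prime q × q ℕ.∣ c → Prime q × q ℕ.∣ d
  descend {q} (p≢q , prime-q , q∣c) with euclidsLemma d p prime-q (subst (q ℕ.∣_) eq q∣c)
  ... | inj₁ q∣d = prime-q , q∣d
  ... | inj₂ q∣p with prime⇒irreducible prime-p q∣p
  ... | inj₁ refl = ⊥-elim (¬prime[1] prime-q)
  ... | inj₂ q≡p  = ⊥-elim (p≢q (sym q≡p))

^-length≤product : ∀ b ps → All (b ≤_) ps → b ^ length ps ≤ product ps
^-length≤product b []       []       = ℕ.≤-refl
^-length≤product b (p ∷ ps) (l ∷ ls) = ℕ.*-mono-≤ l (^-length≤product b ps ls)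

mass-prime-divisors : ∀ j c e → c ≢ 0 → c ≤ 2 ^ e → Mass one (λ p → Prime p × p ℕ.∣ c × 2 ^ j ≤ p) j e
mass-prime-divisors j c e c≢0 c≤ ps u all = ℕ.≮⇒≥ λ e< → ℕ.<⇒≱ (ℕ.^-monoʳ-< 2 (s≤s (s≤s z≤n)) e<) (begin
  2 ^ (weight one ps * j)   ≡⟨ cong (λ l → 2 ^ (l * j)) (weight-one ps) ⟩
  2 ^ (length ps * j)       ≡⟨ cong (2 ^_) (ℕ.*-comm (length ps) j) ⟩
  2 ^ (j * length ps)       ≡⟨ ℕ.^-*-assoc 2 j (length ps) ⟨
  (2 ^ j) ^ length ps       ≤⟨ ^-length≤product (2 ^ j) ps (All.map (λ { (_ , _ , l) → l }) all) ⟩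
  product ps                ≤⟨ ℕ.∣⇒≤ {{ℕ.≢-nonZero c≢0}} (product-primes-∣ ps c≢0 u (All.map (λ { (p , d , _) → p , d }) all)) ⟩
  c                         ≤⟨ c≤ ⟩
  2 ^ e                     ∎)
  where open ℕ.≤-Reasoning

1≤2^ : ∀ e → 1 ≤ 2 ^ e
1≤2^ e = ℕ.m^n>0 2 e

n<2^n : ∀ n → n < 2 ^ n
n<2^n zero    = s≤s z≤n
n<2^n (suc n) = ℕ.+-mono-≤ (1≤2^ n) (ℕ.≤-trans (n<2^n n) (ℕ.≤-reflexive (sym (ℕ.+-identityʳ _))))

2^a+2^b≤ : ∀ a b → 2 ^ a + 2 ^ b ≤ 2 ^ suc (a + b)
2^a+2^b≤ a b = ℕ.≤-trans (ℕ.+-mono-≤ (ℕ.^-monoʳ-≤ 2 (ℕ.m≤m+n a b)) (ℕ.^-monoʳ-≤ 2 (ℕ.m≤n+m b a)))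
  (ℕ.≤-reflexive (cong (_+_ (2 ^ (a + b))) (sym (ℕ.+-identityʳ _))))

ev-bound : ∀ n h → ∃[ C ] (∀ L → 1 ≤ L → ∀ ks → VecAll.All (_≤ L) ks → ∀ {X} → Box ks X → ℤ.∣ ev n h X ∣ ≤ 2 ^ (C * L))
ev-bound zero c = ℤ.∣ c ∣ , λ { L 1≤L [] _ [] → ℕ.≤-trans (ℕ.<⇒≤ (n<2^n ℤ.∣ c ∣))
  (ℕ.^-monoʳ-≤ 2 (ℕ.m≤m*n ℤ.∣ c ∣ L {{ℕ.>-nonZero 1≤L}})) }
ev-bound (suc n) f = let C , b = go f in C , λ { L 1≤L (k ∷ ks) (k≤L VecAll.∷ ks≤L) ((_ , hi) ∷ box) →
  b L 1≤L ks ks≤L (ℕ.<⇒≤ (ℕ.<-≤-trans hi (ℕ.^-monoʳ-≤ 2 (s≤s k≤L)))) box }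
  where
  go : ∀ f → ∃[ C ] (∀ L → 1 ≤ L → ∀ ks → VecAll.All (_≤ L) ks → ∀ {x X} → x ≤ 2 ^ suc L → Box ks X → ℤ.∣ evₗ n f x X ∣ ≤ 2 ^ (C * L))
  go []      = 0 , λ _ _ _ _ _ _ → z≤n
  go (a ∷ f) with ev-bound n a | go f
  ... | C , b | C′ , b′ = C + C′ + 3 , λ L 1≤L ks ks≤L {x} {X} x≤ box → begin
    ℤ.∣ ev n a X ℤ.+ + x ℤ.* evₗ n f x X ∣          ≤⟨ ℤ.∣i+j∣≤∣i∣+∣j∣ (ev n a X) _ ⟩
    ℤ.∣ ev n a X ∣ + ℤ.∣ + x ℤ.* evₗ n f x X ∣      ≡⟨ cong (_+_ ℤ.∣ ev n a X ∣) (ℤ.abs-* (+ x) (evₗ n f x X)) ⟩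
    ℤ.∣ ev n a X ∣ + x * ℤ.∣ evₗ n f x X ∣          ≤⟨ ℕ.+-mono-≤ (b L 1≤L ks ks≤L box) (ℕ.*-mono-≤ x≤ (b′ L 1≤L ks ks≤L x≤ box)) ⟩
    2 ^ (C * L) + 2 ^ suc L * 2 ^ (C′ * L)          ≡⟨ cong (_+_ (2 ^ (C * L))) (ℕ.^-distribˡ-+-* 2 (suc L) (C′ * L)) ⟨
    2 ^ (C * L) + 2 ^ (suc L + C′ * L)              ≤⟨ 2^a+2^b≤ (C * L) (suc L + C′ * L) ⟩
    2 ^ suc (C * L + (suc L + C′ * L))              ≤⟨ ℕ.^-monoʳ-≤ 2 (exponent C C′ 1≤L) ⟩
    2 ^ ((C + C′ + 3) * L)                          ∎
    where
    open ℕ.≤-Reasoning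
    exponent : ∀ C C′ {L} → 1 ≤ L → suc (C * L + (suc L + C′ * L)) ≤ (C + C′ + 3) * L
    exponent C C′ {L} 1≤L = begin
      suc (C * L + (suc L + C′ * L))       ≡⟨ solve 3 (λ C C′ L → con 1 :+ (C :* L :+ (con 1 :+ L :+ C′ :* L)) := (C :+ C′ :+ con 1) :* L :+ con 2) refl C C′ L ⟩
      (C + C′ + 1) * L + 2                 ≤⟨ ℕ.+-monoʳ-≤ ((C + C′ + 1) * L) (ℕ.*-monoʳ-≤ 2 1≤L) ⟩
      (C + C′ + 1) * L + 2 * L             ≡⟨ solve 3 (λ C C′ L → (C :+ C′ :+ con 1) :* L :+ con 2 :* L := (C :+ C′ :+ con 3) :* L) refl C C′ L ⟩
      (C + C′ + 3) * L                     ∎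
      where open +-*-Solver

LargePrime : ∀ n → ℕ → List (ℤ[X] n) → Vec ℕ n → Set
LargePrime n K F X = ∃[ p ] Prime p × 2 ^ K < p × Vanishes n p F X

mass-large-primes : ∀ n F → JointlyCoprime n F → ∃[ C ] (∀ K L → 1 ≤ L → ∀ ks → VecAll.All (K ≤_) ks → VecAll.All (_≤ L) ks →
  Mass one (λ X → Box ks X × LargePrime n K F X) (2 ^ K) (C * L * vol ks))
mass-large-primes zero    F cop with nonzero-member F cop
... | c , i , c≢0 = ℤ.∣ c ∣ , λ { K L 1≤L [] _ _ → mass-point λ { {[]} (_ , p , prime-p , K<p , v) →
  ℕ.≤-trans (Modulus.small (modulus-large {K = K} prime-p K<p) c c≢0 (All.lookup v i))
    (ℕ.≤-trans (ℕ.m≤m*n ℤ.∣ c ∣ L {{ℕ.>-nonZero 1≤L}}) (ℕ.≤-reflexive (sym (ℕ.*-identityʳ _)))) } }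
mass-large-primes (suc n) F cop with mass-large-primes n (concat F) (coprime-coefs n F cop) | elimination n F cop
... | C , bound | R , R≉0 , R-divides with mass-zeros n R R≉0 | ev-bound n R
... | C′ , bound′ | E , R-bound = C + C′ + D * 2 * E , go
  where
  D = length (concat F)
  total : ∀ C C′ D E x v L {w} → 1 ≤ L → w ≡ x * v →
    x * (C * L * v) + (x * (C′ * v) + D * (2 * x) * (E * L) * v) ≤ (C + C′ + D * 2 * E) * L * w
  total C C′ D E x v L 1≤L refl = begin
    x * (C * L * v) + (x * (C′ * v) + D * (2 * x) * (E * L) * v)
      ≤⟨ ℕ.+-monoʳ-≤ (x * (C * L * v)) (ℕ.+-monoˡ-≤ _ (ℕ.m≤m*n (x * (C′ * v)) L {{ℕ.>-nonZero 1≤L}})) ⟩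
    x * (C * L * v) + (x * (C′ * v) * L + D * (2 * x) * (E * L) * v)
      ≡⟨ solve 7 (λ C C′ D E x v L → x :* (C :* L :* v) :+ (x :* (C′ :* v) :* L :+ D :* (con 2 :* x) :* (E :* L) :* v)
           := (C :+ C′ :+ D :* con 2 :* E) :* L :* (x :* v)) refl C C′ D E x v L ⟩
    (C + C′ + D * 2 * E) * L * (x * v) ∎
    where
    open ℕ.≤-Reasoning
    open +-*-Solver
  go : ∀ K L → 1 ≤ L → ∀ ks → VecAll.All (K ≤_) ks → VecAll.All (_≤ L) ks →
    Mass one (λ X → Box ks X × LargePrime (suc n) K F X) (2 ^ K) ((C + C′ + D * 2 * E) * L * vol ks)
  go K L 1≤L (k ∷ ks) (K≤k VecAll.∷ K≤ks) (k≤L VecAll.∷ ks≤L) =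
    mass-≤ (total C C′ D E (2 ^ k) (vol ks) L 1≤L (vol-∷ k ks))
    (mass-⊎ {S′ = S₁} {λ Y → S₂ Y ⊎ S₃ Y} split
      (mass-≡ (ℕ.*-identityˡ (2 ^ K)) (mass-∷ {S = S₁} (λ X → Box ks X × LargePrime n K (concat F) X) (λ { (_ ∷ b , d) → b , d })
        (λ _ → mass-⊆ (λ { (d ∷ _ , _) → d }) (mass-dyadic k)) (bound K L 1≤L ks K≤ks ks≤L)))
      (mass-⊎ {S′ = S₂} {S₃} (λ s → s)
        (mass-≡ (ℕ.*-identityˡ (2 ^ K)) (mass-∷ {S = S₂} (λ X → Box ks X × 0 ∣ᶻ ev n R X) (λ { (_ ∷ b , d) → b , d })
          (λ _ → mass-⊆ (λ { (d ∷ _ , _) → d }) (mass-dyadic k)) (bound′ modulus-zero ks K≤ks)))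
        (mass-≡ (ℕ.*-identityʳ (2 ^ K)) (mass-∷ {S = S₃} (λ X → Box ks X × ¬ 0 ∣ᶻ ev n R X)
          (λ { (_ ∷ b , nz , _) → b , nz })
          (λ { {X} (b , nz) → mass-≡ (ℕ.*-identityʳ (2 ^ K)) (mass-fibre ℕ._≟_
            (λ p → Prime p × p ℕ.∣ ℤ.∣ ev n R X ∣ × 2 ^ 1 ≤ p)
            (λ p x → (Dyadic k x × Vanishes (suc n) p F (x ∷ X)) × Prime p × 2 ^ K < p × ¬ Vanishes n p (concat F) X)
            {2 ^ K} {1} {D * (2 * 2 ^ k)} {E * L}
            (λ { {x} (d ∷ _ , _ , p , prime-p , K<p , nv , v) → p
              , (prime-p , abs (R-divides p x X v) , ℕ.nonTrivial⇒n>1 p {{prime⇒nonTrivial prime-p}})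
              , (d , v) , prime-p , K<p , nv })
            (λ { {p} _ → λ
              { []       u all → z≤n
              ; (x ∷ xs) u all@((_ , prime-p , K<p , nv) ∷ _) →
                  ℕ.≤-trans (mass-fibre-vanishing n (modulus-large prime-p K<p) k K≤k F X nv (x ∷ xs) u (All.map proj₁ all))
                    (ℕ.≤-reflexive (sym (ℕ.*-identityʳ _))) } })
            (mass-prime-divisors 1 ℤ.∣ ev n R X ∣ (E * L) (λ e → nz (mk (subst (0 ℕ.∣_) (sym e) ℕ.∣-refl))) (R-bound L 1≤L ks ks≤L b))) })
          (mass-⊆ proj₁ (mass-box ks))))))
    where
    S₁ S₂ S₃ : Vec ℕ (suc n) → Set
    S₁ Y = Box (k ∷ ks) Y × LargePrime n K (concat F) (Vec.tail Y)
    S₂ Y = Box (k ∷ ks) Y × 0 ∣ᶻ ev n R (Vec.tail Y)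
    S₃ Y = Box (k ∷ ks) Y × ¬ 0 ∣ᶻ ev n R (Vec.tail Y) ×
      ∃[ p ] Prime p × 2 ^ K < p × ¬ Vanishes n p (concat F) (Vec.tail Y) × Vanishes (suc n) p F Y
    split : ∀ {Y} → Box (k ∷ ks) Y × LargePrime (suc n) K F Y → S₁ Y ⊎ (S₂ Y ⊎ S₃ Y)
    split {x ∷ X} (b , p , prime-p , K<p , v) with vanishes? n p (concat F) X | 0 ∣ᶻ? ev n R X
    ... | yes v′ | _      = inj₁ (b , p , prime-p , K<p , v′)
    ... | no _   | yes z  = inj₂ (inj₁ (b , z))
    ... | no nv  | no nz  = inj₂ (inj₂ (b , nz , p , prime-p , K<p , nv , v))

nCk≤2^n : ∀ n k → n choose k ≤ 2 ^ n
nCk≤2^n n       zero    = ℕ.≤-trans (ℕ.≤-reflexive (trans (nCk≡nC[n∸k] {0} {n} z≤n) (nCn≡1 n))) (1≤2^ n)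
nCk≤2^n zero    (suc k) = ℕ.≤-trans (ℕ.≤-reflexive (k>n⇒nCk≡0 {0} {suc k} (s≤s z≤n))) z≤n
nCk≤2^n (suc n) (suc k) = begin
  suc n choose suc k        ≡⟨ nCk+nC[k+1]≡[n+1]C[k+1] n k ⟨
  n choose k + n choose suc k    ≤⟨ ℕ.+-mono-≤ (nCk≤2^n n k) (nCk≤2^n n (suc k)) ⟩
  2 ^ n + 2 ^ n        ≡⟨ cong (_+_ (2 ^ n)) (ℕ.+-identityʳ _) ⟨
  2 ^ suc n            ∎
  where open ℕ.≤-Reasoning

prime∣!⇒≤ : ∀ {p} → Prime p → ∀ m → p ℕ.∣ m ! → p ≤ m
prime∣!⇒≤ prime-p zero    d = ⊥-elim (¬prime[1] (subst Prime (ℕ.∣1⇒≡1 d) prime-p))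
prime∣!⇒≤ prime-p (suc m) d with euclidsLemma (suc m) (m !) prime-p d
... | inj₁ e = ℕ.∣⇒≤ e
... | inj₂ e = ℕ.m≤n⇒m≤1+n (prime∣!⇒≤ prime-p m e)

private
  central : ∀ m → ((m + m) choose m) * (m ! * m !) ≡ (m + m) !
  central m = begin
    ((m + m) choose m) * (m ! * m !)   ≡⟨ cong (_* (m ! * m !)) (trans (nCk≡n!/k![n-k]! m≤) (ℕ./-congʳ {{m ℕ.!* m + m ∸ m !≢0}} {{m ℕ.!* m !≢0}} same)) ⟩
    ℕ._/_ ((m + m) !) (m ! * m !) {{m ℕ.!* m !≢0}} * (m ! * m !)  ≡⟨ ℕ.m/n*n≡m {{m ℕ.!* m !≢0}} (subst (ℕ._∣ (m + m) !) same (k![n∸k]!∣n! m≤)) ⟩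
    (m + m) !                     ∎
    where
    open ≡.≡-Reasoning
    m≤ : m ≤ m + m
    m≤ = ℕ.m≤m+n m m
    same : m ! * (m + m ∸ m) ! ≡ m ! * m !
    same = cong (λ k → m ! * k !) (ℕ.m+n∸m≡n m m)

n∣n! : ∀ n .{{_ : NonZero n}} → n ℕ.∣ n !
n∣n! (suc n) = ℕ.m∣m*n (n !)

prime∣central : ∀ {p} m → Prime p → m < p → p ≤ m + m → p ℕ.∣ (m + m) choose m
prime∣central {p} m prime-p m<p p≤2m with euclidsLemma ((m + m) choose m) (m ! * m !) prime-p
    (subst (p ℕ.∣_) (sym (central m)) (ℕ.∣-trans (n∣n! p {{prime⇒nonZero prime-p}}) (ℕ.m≤n⇒m!∣n! p≤2m)))
... | inj₁ d = d
... | inj₂ d with euclidsLemma (m !) (m !) prime-p d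
... | inj₁ e = ⊥-elim (ℕ.<⇒≱ m<p (prime∣!⇒≤ prime-p m e))
... | inj₂ e = ⊥-elim (ℕ.<⇒≱ m<p (prime∣!⇒≤ prime-p m e))

-- Chebyshev: the primes in (m , 2m] divide the central binomial coefficient.
mass-dyadic-primes : ∀ j → Mass one (λ p → Prime p × Dyadic j p) j (3 * 2 ^ j)
mass-dyadic-primes j = mass-≤ (ℕ.≤-trans (ℕ.+-monoˡ-≤ (m + m) (ℕ.≤-trans (ℕ.≤-reflexive (ℕ.*-identityʳ j)) (ℕ.<⇒≤ (n<2^n j))))
    (ℕ.≤-reflexive (cong (λ z → m + (m + z)) (sym (ℕ.+-identityʳ m)))))
  (mass-⊎ {S′ = _≡ m} {λ p → Prime p × p ℕ.∣ (m + m) choose m × m ≤ p} split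
    (mass-≡ (ℕ.*-identityʳ j) (mass-scale {M = 1} j (mass-subsingleton (λ e e′ → trans e (sym e′)) λ _ → ℕ.≤-refl)))
    (mass-prime-divisors j ((m + m) choose m) (m + m) central≢0 (nCk≤2^n (m + m) m)))
  where
  m = 2 ^ j
  central≢0 : (m + m) choose m ≢ 0
  central≢0 e = ℕ.≢-nonZero⁻¹ ((m + m) !) {{(m + m) ℕ.!≢0}} (trans (sym (central m)) (cong (_* (m ! * m !)) e))
  split : ∀ {p} → Prime p × Dyadic j p → p ≡ m ⊎ (Prime p × p ℕ.∣ (m + m) choose m × m ≤ p)
  split {p} (prime-p , lo , hi) with ℕ.m≤n⇒m<n∨m≡n lo
  ... | inj₂ m≡p = inj₁ (sym m≡p)
  ... | inj₁ m<p = inj₂ (prime-p , prime∣central m prime-p m<p (ℕ.≤-trans (ℕ.<⇒≤ hi) (ℕ.≤-reflexive (cong (_+_ m) (ℕ.+-identityʳ m)))) , lo)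

-- ∑_{l ≤ j ≤ K} 2⁻ʲ ≤ 2¹⁻ˡ, scaled by 2ᴷ.
mass-geometric : ∀ l K → Mass (λ j → 2 ^ (K ∸ j)) (λ j → l ≤ j × j ≤ K) 1 (2 * 2 ^ (K ∸ l))
mass-geometric l K = mass-injection ℕ._≟_ {v = 2 ^_} (K ∸_) (λ { (l≤j , _) → s≤s (ℕ.∸-monoʳ-≤ K l≤j) })
  (λ { (_ , j≤) (_ , j′≤) e → ℕ.∸-cancelˡ-≡ j≤ j′≤ e }) (λ _ → ℕ.≤-refl)
  (mass-≤ (ℕ.<⇒≤ (∑<-2^ (suc (K ∸ l)))) (mass-below (suc (K ∸ l))))

mass-cancel : ∀ {A : Set} {w : A → ℕ} {S : A → Set} {Q M} k .{{_ : NonZero k}} → Mass w S (k * Q) (k * M) → Mass w S Q M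
mass-cancel {w = w} {Q = Q} k m as u all = ℕ.*-cancelˡ-≤ k (ℕ.≤-trans (ℕ.≤-reflexive
  (solve 3 (λ k x Q → k :* (x :* Q) := x :* (k :* Q)) refl k (weight w as) Q)) (m as u all))
  where open +-*-Solver

dyadic-≤ : ∀ {j k x y} → Dyadic j x → Dyadic k y → x ≤ y → j ≤ k
dyadic-≤ {j} {k} (lo , _) (_ , hi) x≤y = ℕ.≮⇒≥ λ k<j → ℕ.<⇒≱ hi (ℕ.≤-trans (ℕ.^-monoʳ-≤ 2 k<j) (ℕ.≤-trans lo x≤y))

SmallPrime : ∀ n → ℕ → ℕ → List (ℤ[X] n) → Vec ℕ n → Set
SmallPrime n N K F X = ∃[ p ] (Prime p × N ≤ p × p ≤ 2 ^ K) × Vanishes n p F X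

mass-small-primes : ∀ n F → JointlyCoprime n F → ∃[ C ] (∀ N l K → 1 ≤ l → Dyadic l N → ∀ ks → VecAll.All (K ≤_) ks →
  Mass one (λ X → Box ks X × SmallPrime n N K F X) (2 ^ l * l) (C * vol ks))
mass-small-primes n F cop with mass-common-zeros n F cop
... | C , bound = C * 3 * 2 , go
  where
  module _ (N l K : ℕ) (1≤l : 1 ≤ l) (dyN : Dyadic l N) (ks : Vec ℕ n) (K≤ks : VecAll.All (K ≤_) ks) where
    v = vol ks
    Block : ℕ → Vec ℕ n → Set
    Block j X = Box ks X × ∃[ p ] (Prime p × Dyadic j p) × p ≤ 2 ^ K × Vanishes n p F X
    block : ∀ j → Mass one (Block j) (2 ^ j * 2 ^ j * j) (C * v * (3 * 2 ^ j))
    block j = mass-fibre ℕ._≟_ (λ p → Prime p × Dyadic j p) (λ p X → (Box ks X × Vanishes n p F X) × Prime p × Dyadic j p × p ≤ 2 ^ K)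
      {2 ^ j * 2 ^ j} {j} {C * v} {3 * 2 ^ j}
      (λ { (b , p , (prime-p , dy) , p≤ , v) → p , (prime-p , dy) , (b , v) , prime-p , dy , p≤ })
      (λ { {p} _ → λ
        { []       u all → z≤n
        ; (X ∷ Xs) u all@((_ , prime-p , (lo , _) , p≤) ∷ _) → ℕ.≤-trans
            (ℕ.*-monoʳ-≤ (weight one (X ∷ Xs)) (ℕ.*-mono-≤ lo lo))
            (ℕ.≤-trans (bound (modulus-prime prime-p p≤) ks K≤ks (X ∷ Xs) u (All.map proj₁ all)) (ℕ.≤-reflexive (sym (ℕ.*-identityʳ _)))) } })
      (mass-dyadic-primes j)
    scaled : ∀ {j} → l ≤ j → j ≤ K → Mass one (Block j) (2 ^ K * l) (C * v * 3 * 2 ^ (K ∸ j))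
    scaled {j} l≤j j≤K = mass-cancel (2 ^ j * 2 ^ j) {{ℕ.m*n≢0 (2 ^ j) (2 ^ j) {{ℕ.m^n≢0 2 j}} {{ℕ.m^n≢0 2 j}}}}
      λ as u all → begin
      weight one as * (2 ^ j * 2 ^ j * (2 ^ K * l))     ≤⟨ ℕ.*-monoʳ-≤ (weight one as) (ℕ.*-monoʳ-≤ (2 ^ j * 2 ^ j) (ℕ.*-monoʳ-≤ (2 ^ K) l≤j)) ⟩
      weight one as * (2 ^ j * 2 ^ j * (2 ^ K * j))     ≡⟨ solve 4 (λ w x k j → w :* (x :* x :* (k :* j)) := k :* (w :* (x :* x :* j))) refl (weight one as) (2 ^ j) (2 ^ K) j ⟩
      2 ^ K * (weight one as * (2 ^ j * 2 ^ j * j))     ≤⟨ ℕ.*-monoʳ-≤ (2 ^ K) (block j as u all) ⟩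
      2 ^ K * (C * v * (3 * 2 ^ j))                     ≡⟨ cong (λ k → k * (C * v * (3 * 2 ^ j))) (trans (cong (2 ^_) (sym (ℕ.m∸n+n≡m j≤K))) (ℕ.^-distribˡ-+-* 2 (K ∸ j) j)) ⟩
      2 ^ (K ∸ j) * 2 ^ j * (C * v * (3 * 2 ^ j))       ≡⟨ solve 4 (λ k x C v → k :* x :* (C :* v :* (con 3 :* x)) := x :* x :* (C :* v :* con 3 :* k)) refl (2 ^ (K ∸ j)) (2 ^ j) C v ⟩
      2 ^ j * 2 ^ j * (C * v * 3 * 2 ^ (K ∸ j))         ∎
      where
      open ℕ.≤-Reasoning
      open +-*-Solver
    locate : ∀ {X} → Box ks X × SmallPrime n N K F X → ∃[ j ] (l ≤ j × j ≤ K) × Block j X × l ≤ j × j ≤ K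
    locate (b , p , (prime-p , N≤p , p≤) , v) with dyadic p (ℕ.<⇒≤ (ℕ.nonTrivial⇒n>1 p {{prime⇒nonTrivial prime-p}}))
    ... | j , dy = j , (l≤j , j≤K) , (b , p , (prime-p , dy) , p≤ , v) , l≤j , j≤K
      where
      l≤j = dyadic-≤ {l} {j} dyN dy N≤p
      j≤K = dyadic-≤ {j} {K} dy (ℕ.≤-refl , ℕ.^-monoʳ-< 2 (s≤s (s≤s z≤n)) (ℕ.n<1+n K)) p≤
    all-blocks : Mass one (λ X → Box ks X × SmallPrime n N K F X) (2 ^ K * l * 1) (C * v * 3 * (2 * 2 ^ (K ∸ l)))
    all-blocks = mass-fibre ℕ._≟_ (λ j → l ≤ j × j ≤ K) (λ j X → Block j X × l ≤ j × j ≤ K)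
      {2 ^ K * l} {1} {C * v * 3} {2 * 2 ^ (K ∸ l)}
      locate (λ { (l≤j , j≤K) → mass-⊆ proj₁ (scaled l≤j j≤K) }) (mass-geometric l K)
    go : Mass one (λ X → Box ks X × SmallPrime n N K F X) (2 ^ l * l) (C * 3 * 2 * v)
    go []       u all = z≤n
    go (X ∷ Xs) u all@(s ∷ _) = mass-cancel (2 ^ (K ∸ l)) {{ℕ.m^n≢0 2 (K ∸ l)}}
      (λ as u all → ℕ.≤-trans (ℕ.≤-reflexive (cong (weight one as *_) exponents)) (ℕ.≤-trans (all-blocks as u all) (ℕ.≤-reflexive
        (solve 3 (λ C v k → C :* v :* con 3 :* (con 2 :* k) := k :* (C :* con 3 :* con 2 :* v)) refl C v (2 ^ (K ∸ l))))))
      (X ∷ Xs) u all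
      where
      open +-*-Solver
      l≤K : l ≤ K
      l≤K = let _ , (l≤j , j≤K) , _ = locate s in ℕ.≤-trans l≤j j≤K
      exponents : 2 ^ (K ∸ l) * (2 ^ l * l) ≡ 2 ^ K * l * 1
      exponents = trans (sym (ℕ.*-assoc (2 ^ (K ∸ l)) (2 ^ l) l)) (trans (cong (_* l) (trans (sym (ℕ.^-distribˡ-+-* 2 (K ∸ l) l)) (cong (2 ^_) (ℕ.m∸n+n≡m l≤K)))) (sym (ℕ.*-identityʳ _)))

PrimeAbove : ∀ n → ℕ → List (ℤ[X] n) → Vec ℕ n → Set
PrimeAbove n N F X = ∃[ p ] (Prime p × N ≤ p) × Vanishes n p F X

mass-primes : ∀ n F → JointlyCoprime n F → ∃[ C ] (∀ N l K L → 1 ≤ l → Dyadic l N → 1 ≤ L →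
  ∀ ks → VecAll.All (K ≤_) ks → VecAll.All (_≤ L) ks →
  Mass one (λ X → Box ks X × PrimeAbove n N F X) (2 ^ K * (2 ^ l * l)) (C * (2 ^ K + L * (2 ^ l * l)) * vol ks))
mass-primes n F cop with mass-small-primes n F cop | mass-large-primes n F cop
... | C , small | C′ , large = C + C′ , λ N l K L 1≤l dyN 1≤L ks K≤ks ks≤L →
  mass-≤ (total (2 ^ K) (2 ^ l * l) L (vol ks)) (mass-⊎ {S′ = λ X → Box ks X × SmallPrime n N K F X} {λ X → Box ks X × LargePrime n K F X}
    (λ { (b , p , (prime-p , N≤p) , v) → [ (λ p≤ → inj₁ (b , p , (prime-p , N≤p , p≤) , v)) , (λ <p → inj₂ (b , p , prime-p , <p , v)) ]′ (ℕ.≤-<-connex p (2 ^ K)) })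
    (mass-scale (2 ^ K) (small N l K 1≤l dyN ks K≤ks))
    (mass-≡ (ℕ.*-comm (2 ^ l * l) (2 ^ K)) (mass-scale (2 ^ l * l) (large K L 1≤L ks K≤ks ks≤L))))
  where
  total : ∀ k q L v → k * (C * v) + q * (C′ * L * v) ≤ (C + C′) * (k + L * q) * v
  total k q L v = ℕ.≤-trans (ℕ.m≤m+n _ _) (ℕ.≤-reflexive (solve 6 (λ C C′ k q L v →
    (k :* (C :* v) :+ q :* (C′ :* L :* v)) :+ (C′ :* k :* v :+ C :* L :* q :* v) := (C :+ C′) :* (k :+ L :* q) :* v) refl C C′ k q L v))
    where open +-*-Solver

open import Data.Bool.Base using (if_then_else_)
open import Data.List.Base using (foldr; cartesianProductWith; filter; allFin)
open import Data.Product.Base using (map₁; Σ-syntax)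
open import Data.Rational.Base as ℚ using (ℚ; 0ℚ; 1ℚ)
open import Data.Vec.Base using (lookup)
open import Relation.Nullary using (does; ¬?)
open import Relation.Binary.PropositionalEquality using (subst₂)
open import Data.Fin.Base as Fin using (Fin; zero; suc)
open import Data.Fin.Subset using (_∈_; _∉_)
open import Data.Fin.Subset.Properties using (_∈?_)
open import Data.Vec.Functional using (Vector)
open import Function.Base using (_∘_)
open import Data.Vec.Relation.Unary.All.Properties using (lookup⁺; lookup⁻)
open import Relation.Nullary.Decidable using (_×-dec_; toWitness)
open import Data.Nat.Divisibility using (∣-trans)
open import Defs
import Data.Rational.Properties as ℚ
import Data.Rational.Unnormalised.Base as ℚᵘ
import Data.Rational.Unnormalised.Properties as ℚᵘ
import Data.Fin.Properties as Fin
import Data.List.Membership.Propositional.Properties as List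
import Data.List.Relation.Unary.Unique.Propositional.Properties as Unique
import Algebra.Properties.Semiring.Sum as SemiringSum
open import Algebra.Bundles using (module CommutativeRing)
import Data.Vec.Properties as Vec
import Data.Vec.Functional as VecF
import Algebra.Properties.CommutativeMonoid.Sum as CommutativeMonoidSum
import Data.Rational.Solver as ℚ
open import Algebra.Properties.Semiring.Exp (CommutativeRing.semiring ℚ.+-*-commutativeRing) using () renaming (_^_ to _^ℚ_; ^-homo-* to ^ℚ-homo-*)
import Data.Integer.Divisibility as ℤᵈ
import Data.Integer.GCD as ℤᵍ
module ∑ = SemiringSum (CommutativeRing.semiring ℤ.+-*-commutativeRing)
module ∑ᵘ = SemiringSum (CommutativeRing.semiring ℚ.+-*-commutativeRing)
module ∑ⁿ = SemiringSum ℕ.+-*-semiring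
open ∑ using () renaming (sum to ∑ℤ)
open ∑ⁿ using () renaming (sum to ∑ℕ)
open CommutativeMonoidSum ℕ.*-1-commutativeMonoid using () renaming (sum to ∏ℕ)
open ∑ᵘ using () renaming (sum to ∑ℚ)

infixl 8 _/1
_/1 : ℤ → ℚ
z /1 = z ℚ./ 1

/1ᵘ : ∀ z → ℚ.toℚᵘ (z /1) ℚᵘ.≃ ℚᵘ.mkℚᵘ z 0
/1ᵘ z = ℚ.toℚᵘ-fromℚᵘ (ℚᵘ.mkℚᵘ z 0)

/1-* : ∀ x y → (x ℤ.* y) /1 ≡ x /1 ℚ.* y /1
/1-* x y = ℚ.toℚᵘ-injective (ℚᵘ.≃-trans (/1ᵘ (x ℤ.* y)) (ℚᵘ.≃-sym
  (ℚᵘ.≃-trans (ℚ.toℚᵘ-homo-* (x /1) (y /1)) (ℚᵘ.*-cong (/1ᵘ x) (/1ᵘ y)))))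

/1-+ : ∀ x y → (x ℤ.+ y) /1 ≡ x /1 ℚ.+ y /1
/1-+ x y = ℚ.toℚᵘ-injective (ℚᵘ.≃-trans (/1ᵘ (x ℤ.+ y)) (ℚᵘ.≃-sym
  (ℚᵘ.≃-trans (ℚ.toℚᵘ-homo-+ (x /1) (y /1)) (ℚᵘ.≃-trans (ℚᵘ.+-cong (/1ᵘ x) (/1ᵘ y))
    (ℚᵘ.*≡* (cong (ℤ._* 1ℤ) (cong₂ ℤ._+_ (ℤ.*-identityʳ x) (ℤ.*-identityʳ y))))))))

/1-injective : ∀ {x y} → x /1 ≡ y /1 → x ≡ y
/1-injective {x} {y} e with ℚᵘ.≃-trans (ℚᵘ.≃-sym (/1ᵘ x)) (ℚᵘ.≃-trans (ℚᵘ.≃-reflexive (cong ℚ.toℚᵘ e)) (/1ᵘ y))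
... | ℚᵘ.*≡* h = trans (sym (ℤ.*-identityʳ x)) (trans h (ℤ.*-identityʳ y))

↧/1-* : ∀ q → (ℚ.↧ q) /1 ℚ.* q ≡ (ℚ.↥ q) /1
↧/1-* q@record{} = ℚ.toℚᵘ-injective (ℚᵘ.≃-trans (ℚ.toℚᵘ-homo-* ((ℚ.↧ q) /1) q)
  (ℚᵘ.≃-trans (ℚᵘ.*-congʳ {ℚ.toℚᵘ q} (/1ᵘ (ℚ.↧ q))) (ℚᵘ.≃-trans eq (ℚᵘ.≃-sym (/1ᵘ (ℚ.↥ q))))))
  where
  eq : ℚᵘ.mkℚᵘ (ℚ.↧ q) 0 ℚᵘ.* ℚ.toℚᵘ q ℚᵘ.≃ ℚᵘ.mkℚᵘ (ℚ.↥ q) 0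
  eq = ℚᵘ.*≡* (trans (ℤ.*-identityʳ _) (trans (ℤ.*-comm (ℚ.↧ q) (ℚ.↥ q))
    (cong (λ d → ℚ.↥ q ℤ.* + suc d) (sym (ℕ.+-identityʳ _)))))

coeffℤ : ∀ {n} → Poly ℤ n → Vec ℕ n → ℤ
coeffℤ f e = foldr (λ (c , e′) s → if does (≡-dec ℕ._≟_ e′ e) then c ℤ.+ s else s) 0ℤ f

infixl 7 _*ₛ_
_*ₛ_ : ∀ {n} → Poly ℤ n → Poly ℤ n → Poly ℤ n
_*ₛ_ = cartesianProductWith λ (c , e) (c′ , e′) → c ℤ.* c′ , Vec.zipWith ℕ._+_ e e′

coeff-overℚ : ∀ {n} (f : Poly ℤ n) e → coeff (overℚ f) e ≡ coeffℤ f e /1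
coeff-overℚ []            e = refl
coeff-overℚ ((c , e′) ∷ f) e with ≡-dec ℕ._≟_ e′ e
... | yes _ = trans (cong (c /1 ℚ.+_) (coeff-overℚ f e)) (sym (/1-+ c (coeffℤ f e)))
... | no  _ = coeff-overℚ f e

overℚ-* : ∀ {n} (f g : Poly ℤ n) → overℚ (f *ₛ g) ≡ overℚ f *ₚ overℚ g
overℚ-* []            g = refl
overℚ-* ((c , e) ∷ f) g = go g
  where
  go : ∀ h → overℚ (map (λ (c′ , e′) → c ℤ.* c′ , Vec.zipWith ℕ._+_ e e′) h ++ f *ₛ g) ≡
       map (λ (c′ , e′) → c /1 ℚ.* c′ , Vec.zipWith ℕ._+_ e e′) (overℚ h) ++ overℚ f *ₚ overℚ g
  go []             = overℚ-* f g
  go ((c′ , e′) ∷ h) = cong₂ (λ z l → (z , Vec.zipWith ℕ._+_ e e′) ∷ l) (/1-* c c′) (go h)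

scaleₚ : ∀ {n} → ℚ → Poly ℚ n → Poly ℚ n
scaleₚ d = map (map₁ (d ℚ.*_))

coeff-scaleₚ : ∀ {n} d (f : Poly ℚ n) e → coeff (scaleₚ d f) e ≡ d ℚ.* coeff f e
coeff-scaleₚ d []             e = sym (ℚ.*-zeroʳ d)
coeff-scaleₚ d ((c , e′) ∷ f) e with ≡-dec ℕ._≟_ e′ e
... | yes _ = trans (cong (d ℚ.* c ℚ.+_) (coeff-scaleₚ d f e)) (sym (ℚ.*-distribˡ-+ d c _))
... | no  _ = coeff-scaleₚ d f e

*ₚ-scaleₚ : ∀ {n} d (f g : Poly ℚ n) → f *ₚ scaleₚ d g ≡ scaleₚ d (f *ₚ g)
*ₚ-scaleₚ d []            g = refl
*ₚ-scaleₚ d ((c , e) ∷ f) g = go g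
  where
  swap : ∀ x y z → x ℚ.* (y ℚ.* z) ≡ y ℚ.* (x ℚ.* z)
  swap x y z = trans (sym (ℚ.*-assoc x y z)) (trans (cong (ℚ._* z) (ℚ.*-comm x y)) (ℚ.*-assoc y x z))
  go : ∀ h → map (λ (c′ , e′) → c ℚ.* c′ , Vec.zipWith ℕ._+_ e e′) (scaleₚ d h) ++ f *ₚ scaleₚ d g ≡
       scaleₚ d (map (λ (c′ , e′) → c ℚ.* c′ , Vec.zipWith ℕ._+_ e e′) h ++ f *ₚ g)
  go []              = *ₚ-scaleₚ d f g
  go ((c′ , e′) ∷ h) = cong₂ (λ z l → (z , Vec.zipWith ℕ._+_ e e′) ∷ l) (swap c d c′) (go h)

commonDenominator : ∀ {n} (q : Poly ℚ n) → ∃[ d ] (¬ d ≡ 0ℤ) × ∃[ Q ] overℚ Q ≡ scaleₚ (d /1) q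
commonDenominator [] = 1ℤ , (λ ()) , [] , refl
commonDenominator ((c , e) ∷ q) with commonDenominator q
... | d , d≢0 , Q , eq = ℚ.↧ c ℤ.* d
  , (λ e → d≢0 (cancel (ℤ.i*j≡0⇒i≡0∨j≡0 (ℚ.↧ c) e)))
  , (ℚ.↥ c ℤ.* d , e) ∷ map (map₁ (ℚ.↧ c ℤ.*_)) Q
  , cong₂ (λ z l → (z , e) ∷ l) head (trans (over Q) (trans (cong (scaleₚ (ℚ.↧ c /1)) eq) (scale-scale q)))
  where
  cancel : ℚ.↧ c ≡ 0ℤ ⊎ d ≡ 0ℤ → d ≡ 0ℤ
  cancel (inj₂ e) = e
  head : (ℚ.↥ c ℤ.* d) /1 ≡ (ℚ.↧ c ℤ.* d) /1 ℚ.* c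
  head = begin
    (ℚ.↥ c ℤ.* d) /1                ≡⟨ /1-* (ℚ.↥ c) d ⟩
    ℚ.↥ c /1 ℚ.* d /1               ≡⟨ ℚ.*-comm (ℚ.↥ c /1) (d /1) ⟩
    d /1 ℚ.* ℚ.↥ c /1               ≡⟨ cong (d /1 ℚ.*_) (↧/1-* c) ⟨
    d /1 ℚ.* (ℚ.↧ c /1 ℚ.* c)       ≡⟨ ℚ.*-assoc (d /1) _ c ⟨
    d /1 ℚ.* ℚ.↧ c /1 ℚ.* c         ≡⟨ cong (ℚ._* c) (trans (sym (/1-* d (ℚ.↧ c))) (cong _/1 (ℤ.*-comm d (ℚ.↧ c)))) ⟩
    (ℚ.↧ c ℤ.* d) /1 ℚ.* c          ∎
    where open ≡.≡-Reasoning
  over : ∀ Q → overℚ (map (map₁ (ℚ.↧ c ℤ.*_)) Q) ≡ scaleₚ (ℚ.↧ c /1) (overℚ Q)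
  over []            = refl
  over ((x , e) ∷ Q) = cong₂ (λ z l → (z , e) ∷ l) (/1-* (ℚ.↧ c) x) (over Q)
  scale-scale : ∀ q → scaleₚ (ℚ.↧ c /1) (scaleₚ (d /1) q) ≡ scaleₚ ((ℚ.↧ c ℤ.* d) /1) q
  scale-scale []            = refl
  scale-scale ((x , e) ∷ q) = cong₂ (λ z l → (z , e) ∷ l)
    (trans (sym (ℚ.*-assoc (ℚ.↧ c /1) (d /1) x)) (cong (ℚ._* x) (sym (/1-* (ℚ.↧ c) d)))) (scale-scale q)

-- From sums of terms to iterated polynomials

module _ {A : Set} (z : A) where
  shift : ℕ → A → List A
  shift zero    a = a ∷ []
  shift (suc k) a = z ∷ shift k a

term : ∀ n → ℤ → Vec ℕ n → ℤ[X] n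
term zero    c []       = c
term (suc n) c (k ∷ e) = shift (𝔻.0# n) k (term n c e)

dense : ∀ {n} → Poly ℤ n → ℤ[X] n
dense {n} []            = 𝔻.0# n
dense {n} ((c , e) ∷ f) = 𝔻._+_ n (term n c e) (dense f)

ev-term : ∀ n c e X → ev n (term n c e) X ≡ c ℤ.* + monomial X e
ev-term zero    c []      []      = sym (ℤ.*-identityʳ c)
ev-term (suc n) c (k ∷ e) (x ∷ X) = go k
  where
  open import Data.Integer.Tactic.RingSolver using (solve-∀)
  swap : ∀ x c m → 0ℤ ℤ.+ x ℤ.* (c ℤ.* m) ≡ c ℤ.* (x ℤ.* m)
  swap = solve-∀
  go : ∀ k → evₗ n (shift (𝔻.0# n) k (term n c e)) x X ≡ c ℤ.* + (x ℕ.^ k ℕ.* monomial X e)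
  go zero    = trans (trans (cong (ℤ._+_ (ev n (term n c e) X)) (ℤ.*-zeroʳ (+ x))) (ℤ.+-identityʳ _))
    (trans (ev-term n c e X) (cong (λ m → c ℤ.* + m) (sym (ℕ.*-identityˡ (monomial X e)))))
  go (suc k) = trans (cong₂ (λ a s → a ℤ.+ + x ℤ.* s) (Evaluation.ev-0 n X) (go k))
    (trans (swap (+ x) c (+ (x ℕ.^ k ℕ.* monomial X e))) (cong (c ℤ.*_)
      (trans (sym (ℤ.pos-* x _)) (cong +_ (sym (ℕ.*-assoc x (x ℕ.^ k) (monomial X e)))))))

ev-dense : ∀ {n} (f : Poly ℤ n) X → ev n (dense f) X ≡ eval f X
ev-dense {n} []            X = Evaluation.ev-0 n X
ev-dense {n} ((c , e) ∷ f) X = trans (Evaluation.ev-+ n X (term n c e) (dense f))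
  (cong₂ ℤ._+_ (ev-term n c e X) (ev-dense f X))

coefAt : ∀ n → ℤ[X] n → Vec ℕ n → ℤ
coefAt zero    a []      = a
coefAt (suc n) f (k ∷ e) = coefAt n (𝔓.coef n f k) e

coefAt-cong : ∀ n {f g} → 𝔻._≈_ n f g → ∀ e → coefAt n f e ≡ coefAt n g e
coefAt-cong zero    eq []      = eq
coefAt-cong (suc n) eq (k ∷ e) = coefAt-cong n (𝔓.at {n} eq k) e

coefAt-injective : ∀ n {f g} → (∀ e → coefAt n f e ≡ coefAt n g e) → 𝔻._≈_ n f g
coefAt-injective zero    eq = eq []
coefAt-injective (suc n) eq = 𝔓.mk {n} λ k → coefAt-injective n λ e → eq (k ∷ e)

coefAt-0 : ∀ n e → coefAt n (𝔻.0# n) e ≡ 0ℤ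
coefAt-0 zero    []      = refl
coefAt-0 (suc n) (k ∷ e) = coefAt-0 n e

coefAt-+ : ∀ n f g e → coefAt n (𝔻._+_ n f g) e ≡ coefAt n f e ℤ.+ coefAt n g e
coefAt-+ zero    f g []      = refl
coefAt-+ (suc n) f g (k ∷ e) = trans (coefAt-cong n (𝔓.coef-⊕ n f g k) e) (coefAt-+ n _ _ e)

coefAt-term-diagonal : ∀ n c e → coefAt n (term n c e) e ≡ c
coefAt-term-diagonal zero    c []      = refl
coefAt-term-diagonal (suc n) c (k ∷ e) = trans (go k) (coefAt-term-diagonal n c e)
  where
  go : ∀ k → coefAt (suc n) (shift (𝔻.0# n) k (term n c e)) (k ∷ e) ≡ coefAt n (term n c e) e
  go zero    = refl
  go (suc k) = go k

coefAt-term-off : ∀ n c e e′ → ¬ e ≡ e′ → coefAt n (term n c e) e′ ≡ 0ℤ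
coefAt-term-off zero    c []      []        ne = ⊥-elim (ne refl)
coefAt-term-off (suc n) c (k ∷ e) (k′ ∷ e′) ne = go k k′ λ { refl refl → ne refl }
  where
  go : ∀ k k′ → (k ≡ k′ → ¬ e ≡ e′) → coefAt (suc n) (shift (𝔻.0# n) k (term n c e)) (k′ ∷ e′) ≡ 0ℤ
  go zero    zero     ne = coefAt-term-off n c e e′ (ne refl)
  go zero    (suc k′) ne = coefAt-0 n e′
  go (suc k) zero     ne = coefAt-0 n e′
  go (suc k) (suc k′) ne = go k k′ λ { refl → ne refl }

coefAt-dense : ∀ {n} (f : Poly ℤ n) e → coefAt n (dense f) e ≡ coeffℤ f e
coefAt-dense {n} []             e = coefAt-0 n e
coefAt-dense {n} ((c , e′) ∷ f) e with ≡-dec ℕ._≟_ e′ e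
... | yes refl = trans (coefAt-+ n (term n c e) (dense f) e) (cong₂ ℤ._+_ (coefAt-term-diagonal n c e) (coefAt-dense f e))
... | no ne    = trans (coefAt-+ n (term n c e′) (dense f) e)
  (trans (cong₂ ℤ._+_ (coefAt-term-off n c e′ e ne) (coefAt-dense f e)) (ℤ.+-identityˡ _))

term-* : ∀ n c c′ e e′ → 𝔻._≈_ n (𝔻._*_ n (term n c e) (term n c′ e′)) (term n (c ℤ.* c′) (Vec.zipWith ℕ._+_ e e′))
term-* zero    c c′ []      []        = refl
term-* (suc n) c c′ (k ∷ e) (k′ ∷ e′) = go k
  where
  open 𝔓 n
  module D = 𝔻 n
  s = term n c e
  t = term n c′ e′
  u = term n (c ℤ.* c′) (Vec.zipWith ℕ._+_ e e′)
  scaled : ∀ k′ → s · shift D.0# k′ t ≋ shift D.0# k′ u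
  scaled zero     = ∷-cong (term-* n c c′ e e′) ≋-refl
  scaled (suc k′) = ∷-cong (D.zeroʳ s) (scaled k′)
  go : ∀ k → shift D.0# k s ⊛ shift D.0# k′ t ≋ shift D.0# (k ℕ.+ k′) u
  go zero    = ≋-trans (const-⊛ s (shift D.0# k′ t)) (scaled k′)
  go (suc k) = ≋-trans (0∷-⊛ (shift D.0# k s) (shift D.0# k′ t)) (∷-cong D.refl (go k))

dense-++ : ∀ {n} (f g : Poly ℤ n) → 𝔻._≈_ n (dense (f ++ g)) (𝔻._+_ n (dense f) (dense g))
dense-++ {n} []            g = 𝔻.sym n (𝔻.+-identityˡ n (dense g))
dense-++ {n} ((c , e) ∷ f) g = 𝔻.trans n (𝔻.+-congˡ n (dense-++ f g)) (𝔻.sym n (𝔻.+-assoc n _ _ _))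

dense-* : ∀ {n} (f g : Poly ℤ n) → 𝔻._≈_ n (dense (f *ₛ g)) (𝔻._*_ n (dense f) (dense g))
dense-* {n} []            g = 𝔻.sym n (𝔻.zeroˡ n (dense g))
dense-* {n} ((c , e) ∷ f) g = D.trans (dense-++ (row g) (f *ₛ g)) (D.trans
  (D.+-cong (row-* g) (dense-* f g)) (D.sym (D.distribʳ (dense g) (term n c e) (dense f))))
  where
  module D = 𝔻 n
  row : Poly ℤ n → Poly ℤ n
  row = map (λ (c′ , e′) → c ℤ.* c′ , Vec.zipWith ℕ._+_ e e′)
  row-* : ∀ g → dense (row g) D.≈ (term n c e D.* dense g)
  row-* []              = D.sym (D.zeroʳ _)
  row-* ((c′ , e′) ∷ g) = D.trans (D.+-cong (D.sym (term-* n c c′ e e′)) (row-* g))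
    (D.sym (D.distribˡ (term n c e) (term n c′ e′) (dense g)))

dense-surjective : ∀ n (h : ℤ[X] n) → ∃[ f ] 𝔻._≈_ n (dense f) h
dense-surjective zero    h = (h , []) ∷ [] , ℤ.+-identityʳ h
dense-surjective (suc n) h = go h
  where
  open 𝔓 n
  module D = 𝔻 n
  lift : Poly ℤ n → Poly ℤ (suc n)
  lift = map (λ (c , e) → c , 0 ∷ e)
  dense-lift : ∀ f → dense (lift f) ≋ const (dense f)
  dense-lift []            = ≋-sym 0∷[]≋[]
  dense-lift ((c , e) ∷ f) = ⊕-cong (≋-refl {const (term n c e)}) (dense-lift f)
  raise : Poly ℤ (suc n) → Poly ℤ (suc n)
  raise = map (λ { (c , k ∷ e) → c , suc k ∷ e })
  dense-raise : ∀ f → dense (raise f) ≋ D.0# ∷ dense f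
  dense-raise []                = ≋-sym 0∷[]≋[]
  dense-raise ((c , k ∷ e) ∷ f) = ≋-trans (⊕-cong (≋-refl {D.0# ∷ term (suc n) c (k ∷ e)}) (dense-raise f))
    (∷-cong (D.+-identityʳ D.0#) ≋-refl)
  go : ∀ h → ∃[ f ] dense f ≋ h
  go []      = [] , ≋-refl
  go (a ∷ h) = let f , e = dense-surjective n a ; g , e′ = go h in lift f ++ raise g ,
    ≋-trans (dense-++ (lift f) (raise g)) (≋-trans (⊕-cong (dense-lift f) (dense-raise g))
      (∷-cong (D.trans (D.+-identityʳ _) e) e′))

scalar-term : ∀ n m → scalar n m ≡ term n m (Vec.replicate n 0)
scalar-term zero    m = refl
scalar-term (suc n) m = cong (_∷ []) (scalar-term n m)

coprime⇒jointlyCoprime : ∀ {n} (f g : Poly ℤ n) → Coprime f g → JointlyCoprime n (dense f ∷ dense g ∷ [])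
coprime⇒jointlyCoprime {n} f g cop h (h∣f ∷ h∣g ∷ []) =
  d , d≢0 , dense Q , coefAt-injective n λ e → /1-injective (begin
    coefAt n (h D.* dense Q) e /1                 ≡⟨ transfer Q e ⟨
    coeff (overℚ H *ₚ overℚ Q) e                  ≡⟨ cong (λ q → coeff (overℚ H *ₚ q) e) Q-eq ⟩
    coeff (overℚ H *ₚ scaleₚ (d /1) q) e          ≡⟨ cong (λ p → coeff p e) (*ₚ-scaleₚ (d /1) (overℚ H) q) ⟩
    coeff (scaleₚ (d /1) (overℚ H *ₚ q)) e        ≡⟨ coeff-scaleₚ (d /1) (overℚ H *ₚ q) e ⟩
    d /1 ℚ.* coeff (overℚ H *ₚ q) e               ≡⟨ cong (d /1 ℚ.*_) (Hq≈1 e) ⟩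
    d /1 ℚ.* coeff 1ₚ e                           ≡⟨ coeff-scaleₚ (d /1) 1ₚ e ⟨
    coeff (scaleₚ (d /1) 1ₚ) e                    ≡⟨ cong (λ z → coeff ((z , Vec.replicate n 0) ∷ []) e) (ℚ.*-identityʳ (d /1)) ⟩
    coeff (overℚ ((d , Vec.replicate n 0) ∷ [])) e ≡⟨ coeff-overℚ ((d , Vec.replicate n 0) ∷ []) e ⟩
    coeffℤ ((d , Vec.replicate n 0) ∷ []) e /1     ≡⟨ cong _/1 (coefAt-dense ((d , Vec.replicate n 0) ∷ []) e) ⟨
    coefAt n (term n d (Vec.replicate n 0) D.+ D.0#) e /1 ≡⟨ cong _/1 (coefAt-cong n (D.+-identityʳ _) e) ⟩
    coefAt n (term n d (Vec.replicate n 0)) e /1  ≡⟨ cong (λ k → coefAt n k e /1) (scalar-term n d) ⟨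
    coefAt n (scalar n d) e /1                         ∎)
  where
  open ≡.≡-Reasoning
  module D = 𝔻 n
  H = dense-surjective n h .proj₁
  H≈h = dense-surjective n h .proj₂
  transfer : ∀ Q e → coeff (overℚ H *ₚ overℚ Q) e ≡ coefAt n (h D.* dense Q) e /1
  transfer Q e = begin
    coeff (overℚ H *ₚ overℚ Q) e       ≡⟨ cong (λ p → coeff p e) (overℚ-* H Q) ⟨
    coeff (overℚ (H *ₛ Q)) e           ≡⟨ coeff-overℚ (H *ₛ Q) e ⟩
    coeffℤ (H *ₛ Q) e /1               ≡⟨ cong _/1 (coefAt-dense (H *ₛ Q) e) ⟨
    coefAt n (dense (H *ₛ Q)) e /1     ≡⟨ cong _/1 (coefAt-cong n (D.trans (dense-* H Q) (D.*-congʳ H≈h)) e) ⟩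
    coefAt n (h D.* dense Q) e /1      ∎
  divides : ∀ f → h D.∣ dense f → overℚ H ∣ₚ overℚ f
  divides f (q , hq≈f) = overℚ Q , λ e → begin
    coeff (overℚ H *ₚ overℚ Q) e   ≡⟨ transfer Q e ⟩
    coefAt n (h D.* dense Q) e /1  ≡⟨ cong _/1 (coefAt-cong n (D.trans (D.*-congˡ (dense-surjective n q .proj₂)) hq≈f) e) ⟩
    coefAt n (dense f) e /1        ≡⟨ cong _/1 (coefAt-dense f e) ⟩
    coeffℤ f e /1                  ≡⟨ coeff-overℚ f e ⟨
    coeff (overℚ f) e              ∎
    where Q = dense-surjective n q .proj₁
  unit = cop (overℚ H) (divides f h∣f) (divides g h∣g)
  q = unit .proj₁
  Hq≈1 = unit .proj₂
  cleared = commonDenominator q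
  d = cleared .proj₁
  d≢0 = cleared .proj₂ .proj₁
  Q = cleared .proj₂ .proj₂ .proj₁
  Q-eq = cleared .proj₂ .proj₂ .proj₂

/1-∑ : ∀ {n} (f : Vector ℤ n) → ∑ℤ f /1 ≡ ∑ℚ (λ i → f i /1)
/1-∑ {zero}  f = refl
/1-∑ {suc n} f = trans (/1-+ (f zero) _) (cong (f zero /1 ℚ.+_) (/1-∑ (f ∘ suc)))

pos-∑ : ∀ {n} (f : Vector ℕ n) → + ∑ℕ f ≡ ∑ℤ (λ i → + f i)
pos-∑ {zero}  f = refl
pos-∑ {suc n} f = trans (ℤ.pos-+ (f zero) _) (cong (ℤ._+_ (+ f zero)) (pos-∑ (f ∘ suc)))

∑-single : ∀ {n} (f : Vector ℤ n) j → (∀ i → i ≢ j → f i ≡ 0ℤ) → ∑ℤ f ≡ f j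
∑-single {suc n} f zero    off = trans (cong (ℤ._+_ (f zero)) (trans (∑.sum-cong-≗ (λ i → off (suc i) λ ())) (∑.sum-replicate-zero n))) (ℤ.+-identityʳ _)
∑-single {suc n} f (suc j) off = trans (cong (ℤ._+ ∑ℤ (f ∘ suc)) (off zero λ ()))
  (trans (ℤ.+-identityˡ _) (∑-single (f ∘ suc) j λ i i≢j → off (suc i) λ { refl → i≢j refl }))

∑ℕ-cancel : ∀ {n} (f g : Vector ℕ n) j → (∀ i → i ≢ j → f i ≡ g i) → ∑ℕ f ≡ ∑ℕ g → f j ≡ g j
∑ℕ-cancel {suc n} f g zero    eq e = ℕ.+-cancelʳ-≡ (∑ℕ (f ∘ suc)) _ _
  (trans e (cong (_+_ (g zero)) (sym (∑ⁿ.sum-cong-≗ λ i → eq (suc i) λ ()))))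
∑ℕ-cancel {suc n} f g (suc j) eq e = ∑ℕ-cancel (f ∘ suc) (g ∘ suc) j (λ i i≢j → eq (suc i) λ { refl → i≢j refl })
  (ℕ.+-cancelˡ-≡ (f zero) _ _ (trans e (cong (_+ ∑ℕ (g ∘ suc)) (sym (eq zero λ ())))))

∑ℕ-≥ : ∀ {n} (f : Vector ℕ n) j → f j ≤ ∑ℕ f
∑ℕ-≥ {suc n} f zero    = ℕ.m≤m+n _ _
∑ℕ-≥ {suc n} f (suc j) = ℕ.≤-trans (∑ℕ-≥ (f ∘ suc) j) (ℕ.m≤n+m _ _)

∑ℕ-single : ∀ {n} (f : Vector ℕ n) j → (∀ i → i ≢ j → f i ≡ 0) → ∑ℕ f ≡ f j
∑ℕ-single {n} f j off = ℤ.+-injective (trans (pos-∑ f) (∑-single (λ i → + f i) j λ i i≢j → cong +_ (off i i≢j)))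

*-∑-distribʳ : ∀ {n} c (f g : Vector ℤ n) → (∀ i → f i ≡ c ℤ.* g i) → ∑ℤ f ≡ c ℤ.* ∑ℤ g
*-∑-distribʳ c f g e = trans (∑.sum-cong-≗ e) (sym (∑.*-distribˡ-sum c g))

/1-mono-≤ : ∀ {x y} → x ℤ.≤ y → x /1 ℚ.≤ y /1
/1-mono-≤ {x} {y} x≤y = ℚ.toℚᵘ-cancel-≤ (ℚᵘ.≤-respˡ-≃ (ℚᵘ.≃-sym (/1ᵘ x)) (ℚᵘ.≤-respʳ-≃ (ℚᵘ.≃-sym (/1ᵘ y))
  (ℚᵘ.*≤* (ℤ.*-monoʳ-≤-nonNeg 1ℤ x≤y))))

/1-cancel-≤ : ∀ {x y} → x /1 ℚ.≤ y /1 → x ℤ.≤ y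
/1-cancel-≤ {x} {y} le with ℚᵘ.≤-respˡ-≃ (/1ᵘ x) (ℚᵘ.≤-respʳ-≃ (/1ᵘ y) (ℚ.toℚᵘ-mono-≤ le))
... | ℚᵘ.*≤* h = ℤ.*-cancelʳ-≤-pos x y 1ℤ h

commonDenominators : ∀ {n} (q : Vector ℚ n) → ∃[ D ] Σ[ z ∈ Vector ℤ n ] (∀ i → z i /1 ≡ (+ suc D) /1 ℚ.* q i)
commonDenominators {zero}  q = 0 , (λ ()) , λ ()
commonDenominators {suc n} q with commonDenominators (q ∘ suc)
... | D′ , z , eq = D′ + d′ * suc D′ ,
  (λ { zero → D ℤ.* ℚ.↥ (q zero) ; (suc i) → d ℤ.* z i }) , λ
  { zero → begin
      (D ℤ.* ℚ.↥ (q zero)) /1           ≡⟨ /1-* D (ℚ.↥ (q zero)) ⟩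
      D /1 ℚ.* ℚ.↥ (q zero) /1          ≡⟨ cong (D /1 ℚ.*_) (↧/1-* (q zero)) ⟨
      D /1 ℚ.* (d /1 ℚ.* q zero)        ≡⟨ ℚ.*-assoc (D /1) (d /1) (q zero) ⟨
      D /1 ℚ.* d /1 ℚ.* q zero          ≡⟨ cong (ℚ._* q zero) (trans (sym (/1-* D d)) (cong _/1 (ℤ.*-comm D d))) ⟩
      (d ℤ.* D) /1 ℚ.* q zero           ∎
  ; (suc i) → begin
      (d ℤ.* z i) /1                    ≡⟨ /1-* d (z i) ⟩
      d /1 ℚ.* z i /1                   ≡⟨ cong (d /1 ℚ.*_) (eq i) ⟩
      d /1 ℚ.* (D /1 ℚ.* q (suc i))     ≡⟨ ℚ.*-assoc (d /1) (D /1) (q (suc i)) ⟨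
      d /1 ℚ.* D /1 ℚ.* q (suc i)       ≡⟨ cong (ℚ._* q (suc i)) (/1-* d D) ⟨
      (d ℤ.* D) /1 ℚ.* q (suc i)        ∎ }
  where
  open ≡.≡-Reasoning
  d′ = ℚ.denominator-1 (q zero)
  d = + suc d′
  D = + suc D′

lookup-unique : ∀ {A : Set} {xs : List A} → Unique xs → ∀ {i j} → List.lookup xs i ≡ List.lookup xs j → i ≡ j
lookup-unique (_ ∷ _)     {zero}  {zero}  e = refl
lookup-unique (fresh ∷ _) {zero}  {suc j} e = ⊥-elim (All.lookup fresh (List.∈-lookup j) e)
lookup-unique (fresh ∷ _) {suc i} {zero}  e = ⊥-elim (All.lookup fresh (List.∈-lookup i) (sym e))
lookup-unique (_ ∷ u)     {suc i} {suc j} e = cong suc (lookup-unique u e)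

δ : ∀ {n} → Fin n → Fin n → ℕ
δ ρ ρ′ with ρ′ Fin.≟ ρ
... | yes _ = 1
... | no _  = 0

δ-on : ∀ {n} (ρ : Fin n) → δ ρ ρ ≡ 1
δ-on ρ with ρ Fin.≟ ρ
... | yes _ = refl
... | no ne = ⊥-elim (ne refl)

δ-off : ∀ {n} {ρ ρ′ : Fin n} → ρ′ ≢ ρ → δ ρ ρ′ ≡ 0
δ-off {ρ = ρ} {ρ′} ne with ρ′ Fin.≟ ρ
... | yes e = ⊥-elim (ne e)
... | no _  = refl

module Geometry {d n : ℕ} (Δ : CompleteRegularFan d n) where
  open CompleteRegularFan Δ

  lin : Vector ℤ n → Lattice d
  lin c i = ∑ℤ λ ρ → c ρ ℤ.* gen ρ i

  lin-cong : ∀ {c c′ : Vector ℤ n} → (∀ ρ → c ρ ≡ c′ ρ) → ∀ i → lin c i ≡ lin c′ i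
  lin-cong e i = ∑.sum-cong-≗ λ ρ → cong (ℤ._* gen ρ i) (e ρ)

  lin-+ : ∀ (c c′ : Vector ℤ n) i → lin (λ ρ → c ρ ℤ.+ c′ ρ) i ≡ lin c i ℤ.+ lin c′ i
  lin-+ c c′ i = trans (∑.sum-cong-≗ λ ρ → ℤ.*-distribʳ-+ (gen ρ i) (c ρ) (c′ ρ)) (∑.∑-distrib-+ (λ ρ → c ρ ℤ.* gen ρ i) (λ ρ → c′ ρ ℤ.* gen ρ i))

  lin-* : ∀ z (c : Vector ℤ n) i → lin (λ ρ → z ℤ.* c ρ) i ≡ z ℤ.* lin c i
  lin-* z c i = *-∑-distribʳ z _ _ λ ρ → ℤ.*-assoc z (c ρ) (gen ρ i)

  pairing-lin : ∀ (μ : Lattice d) (c : Vector ℤ n) → ⟨ μ , lin c ⟩ ≡ ∑ℤ λ ρ → c ρ ℤ.* ⟨ μ , gen ρ ⟩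
  pairing-lin μ c = begin
    ∑ℤ (λ i → μ i ℤ.* ∑ℤ λ ρ → c ρ ℤ.* gen ρ i)        ≡⟨ ∑.sum-cong-≗ (λ i → ∑.*-distribˡ-sum (μ i) (λ ρ → c ρ ℤ.* gen ρ i)) ⟩
    ∑ℤ (λ i → ∑ℤ λ ρ → μ i ℤ.* (c ρ ℤ.* gen ρ i))      ≡⟨ ∑.∑-comm (λ i ρ → μ i ℤ.* (c ρ ℤ.* gen ρ i)) ⟩
    ∑ℤ (λ ρ → ∑ℤ λ i → μ i ℤ.* (c ρ ℤ.* gen ρ i))      ≡⟨ ∑.sum-cong-≗ (λ ρ → *-∑-distribʳ (c ρ) _ _ λ i → swap (μ i) (c ρ) (gen ρ i)) ⟩
    ∑ℤ (λ ρ → c ρ ℤ.* ⟨ μ , gen ρ ⟩)                   ∎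
    where
    open ≡.≡-Reasoning
    swap : ∀ x y z → x ℤ.* (y ℤ.* z) ≡ y ℤ.* (x ℤ.* z)
    swap x y z = trans (sym (ℤ.*-assoc x y z)) (trans (cong (ℤ._* z) (ℤ.*-comm x y)) (ℤ.*-assoc y x z))

  pairing-cong : ∀ (μ : Lattice d) {v v′ : Lattice d} → (∀ i → v i ≡ v′ i) → ⟨ μ , v ⟩ ≡ ⟨ μ , v′ ⟩
  pairing-cong μ e = ∑.sum-cong-≗ λ i → cong (μ i ℤ.*_) (e i)

  pairing-0 : ∀ (μ : Lattice d) {v : Lattice d} → (∀ i → v i ≡ 0ℤ) → ⟨ μ , v ⟩ ≡ 0ℤ
  pairing-0 μ e = trans (∑.sum-cong-≗ λ i → trans (cong (μ i ℤ.*_) (e i)) (ℤ.*-zeroʳ (μ i))) (∑.sum-replicate-zero d)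

  agree : ∀ σ (μ ν : Lattice d) → (∀ ρ → ρ ∈ rays σ → ⟨ μ , gen ρ ⟩ ≡ ⟨ ν , gen ρ ⟩) → ∀ v → ⟨ μ , v ⟩ ≡ ⟨ ν , v ⟩
  agree σ μ ν eq v with spanning σ v
  ... | c , off , v≡ = begin
    ⟨ μ , v ⟩                                ≡⟨ pairing-cong μ v≡ ⟩
    ⟨ μ , lin c ⟩                            ≡⟨ pairing-lin μ c ⟩
    ∑ℤ (λ ρ → c ρ ℤ.* ⟨ μ , gen ρ ⟩)         ≡⟨ ∑.sum-cong-≗ same ⟩
    ∑ℤ (λ ρ → c ρ ℤ.* ⟨ ν , gen ρ ⟩)         ≡⟨ pairing-lin ν c ⟨
    ⟨ ν , lin c ⟩                            ≡⟨ pairing-cong ν v≡ ⟨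
    ⟨ ν , v ⟩                                ∎
    where
    open ≡.≡-Reasoning
    same : ∀ ρ → c ρ ℤ.* ⟨ μ , gen ρ ⟩ ≡ c ρ ℤ.* ⟨ ν , gen ρ ⟩
    same ρ with ρ ∈? rays σ
    ... | yes i = cong (c ρ ℤ.*_) (eq ρ i)
    ... | no ni rewrite off ρ ni = refl

  pairing-neg : ∀ (μ v : Lattice d) → ⟨ (λ i → ℤ.- μ i) , v ⟩ ≡ ℤ.- ⟨ μ , v ⟩
  pairing-neg μ v = trans (*-∑-distribʳ (ℤ.- 1ℤ) (λ i → ℤ.- μ i ℤ.* v i) (λ i → μ i ℤ.* v i) λ i → trans (sym (ℤ.neg-distribˡ-* (μ i) (v i))) (sym (ℤ.-1*i≡-i (μ i ℤ.* v i)))) (ℤ.-1*i≡-i ⟨ μ , v ⟩)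

  -- Coordinates in a cone are integral because its generators form a basis.
  integral-coordinates : ∀ τ (v : Lattice d) → InCone gen (rays τ) (λ i → v i /1) →
    Σ[ c ∈ Vector ℕ n ] (∀ ρ → ρ ∉ rays τ → c ρ ≡ 0) × (∀ i → v i ≡ lin (λ ρ → + c ρ) i)
  integral-coordinates τ v (γ , γ≥0 , γ-off , v≡γ) with spanning τ v | commonDenominators γ
  ... | c , c-off , v≡c | D′ , z , z≡ = (λ ρ → ℤ.∣ c ρ ∣) , (λ ρ ni → cong ℤ.∣_∣ (c-off ρ ni)) ,
    λ i → trans (v≡c i) (sym (lin-cong (λ ρ → ℤ.0≤i⇒+∣i∣≡i (c≥0 ρ)) i))
    where
    open ≡.≡-Reasoning
    D = + suc D′
    w : Vector ℤ n
    w ρ = z ρ ℤ.+ ℤ.- D ℤ.* c ρ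
    z-lin : ∀ i → lin z i ≡ D ℤ.* v i
    z-lin i = /1-injective (begin
      lin z i /1                                      ≡⟨ /1-∑ (λ ρ → z ρ ℤ.* gen ρ i) ⟩
      ∑ℚ (λ ρ → (z ρ ℤ.* gen ρ i) /1)                 ≡⟨ ∑ᵘ.sum-cong-≗ (λ ρ → trans (/1-* (z ρ) (gen ρ i)) (trans (cong (ℚ._* gen ρ i /1) (z≡ ρ)) (ℚ.*-assoc (D /1) (γ ρ) (gen ρ i /1)))) ⟩
      ∑ℚ (λ ρ → D /1 ℚ.* (γ ρ ℚ.* gen ρ i /1))        ≡⟨ ∑ᵘ.*-distribˡ-sum (D /1) (λ ρ → γ ρ ℚ.* gen ρ i /1) ⟨
      D /1 ℚ.* ∑ℚ (λ ρ → γ ρ ℚ.* gen ρ i /1)          ≡⟨ cong (D /1 ℚ.*_) (v≡γ i) ⟨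
      D /1 ℚ.* v i /1                                 ≡⟨ /1-* D (v i) ⟨
      (D ℤ.* v i) /1                                  ∎)
    w-lin : ∀ i → lin w i ≡ 0ℤ
    w-lin i = begin
      lin w i                                  ≡⟨ lin-+ z (λ ρ → ℤ.- D ℤ.* c ρ) i ⟩
      lin z i ℤ.+ lin (λ ρ → ℤ.- D ℤ.* c ρ) i  ≡⟨ cong₂ ℤ._+_ (z-lin i) (trans (lin-* (ℤ.- D) c i) (cong (ℤ.- D ℤ.*_) (sym (v≡c i)))) ⟩
      D ℤ.* v i ℤ.+ ℤ.- D ℤ.* v i              ≡⟨ ℤ.*-distribʳ-+ (v i) D (ℤ.- D) ⟨
      (D ℤ.+ ℤ.- D) ℤ.* v i                    ≡⟨ cong (ℤ._* v i) (ℤ.+-inverseʳ D) ⟩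
      0ℤ                                       ∎
    z-off : ∀ ρ → ρ ∉ rays τ → z ρ ≡ 0ℤ
    z-off ρ ni = /1-injective (trans (z≡ ρ) (trans (cong (D /1 ℚ.*_) (γ-off ρ ni)) (ℚ.*-zeroʳ (D /1))))
    w≡0 : ∀ ρ → w ρ ≡ 0ℤ
    w≡0 = independent τ w (λ ρ ni → cong₂ ℤ._+_ (z-off ρ ni) (trans (cong (ℤ.- D ℤ.*_) (c-off ρ ni)) (ℤ.*-zeroʳ (ℤ.- D)))) w-lin
    z≡Dc : ∀ ρ → z ρ ≡ D ℤ.* c ρ
    z≡Dc ρ = ℤ.i-j≡0⇒i≡j (z ρ) _ (trans (cong (ℤ._+_ (z ρ)) (ℤ.neg-distribˡ-* D (c ρ))) (w≡0 ρ))
    z≥0 : ∀ ρ → 0ℤ ℤ.≤ z ρ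
    z≥0 ρ = /1-cancel-≤ (ℚ.≤-trans (ℚ.≤-reflexive (sym (ℚ.*-zeroʳ (D /1)))) (ℚ.≤-trans
      (ℚ.*-monoˡ-≤-nonNeg (D /1) {{ℚ.nonNegative (/1-mono-≤ {0ℤ} {D} (ℤ.+≤+ z≤n))}} (γ≥0 ρ)) (ℚ.≤-reflexive (sym (z≡ ρ)))))
    c≥0 : ∀ ρ → 0ℤ ℤ.≤ c ρ
    c≥0 ρ = ℤ.*-cancelˡ-≤-pos 0ℤ (c ρ) D (subst₂ ℤ._≤_ (sym (ℤ.*-zeroʳ D)) (z≡Dc ρ) (z≥0 ρ))
      where open ≡ using (subst₂)

  Relation : Vector ℕ n → Set
  Relation e = ∀ i → lin (λ ρ → + e ρ) i ≡ 0ℤ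

  relation-difference : ∀ σ e e′ → Relation e → Relation e′ → (∀ ρ → ρ ∉ rays σ → e ρ ≡ e′ ρ) → ∀ ρ → e ρ ≡ e′ ρ
  relation-difference σ e e′ rel rel′ off ρ = ℤ.+-injective (ℤ.i-j≡0⇒i≡j (+ e ρ) (+ e′ ρ)
    (trans (cong (ℤ._+_ (+ e ρ)) (sym (ℤ.-1*i≡-i (+ e′ ρ)))) (independent σ w w-off w-lin ρ)))
    where
    w : Vector ℤ n
    w ρ = + e ρ ℤ.+ ℤ.- 1ℤ ℤ.* + e′ ρ
    w-off : ∀ ρ → ρ ∉ rays σ → w ρ ≡ 0ℤ
    w-off ρ ni = trans (cong (ℤ._+_ (+ e ρ)) (ℤ.-1*i≡-i (+ e′ ρ))) (ℤ.i≡j⇒i-j≡0 (cong +_ (off ρ ni)))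
    w-lin : ∀ i → lin w i ≡ 0ℤ
    w-lin i = trans (lin-+ (λ ρ → + e ρ) (λ ρ → ℤ.- 1ℤ ℤ.* + e′ ρ) i)
      (cong₂ ℤ._+_ (rel i) (trans (lin-* (ℤ.- 1ℤ) (λ ρ → + e′ ρ) i) (cong (ℤ._*_ (ℤ.- 1ℤ)) (rel′ i))))

  outside : Fin numMax → List (Fin n)
  outside σ = filter (λ ρ → ¬? (ρ ∈? rays σ)) (allFin n)

  ∈-outside : ∀ {σ ρ} → ρ ∉ rays σ → ρ List.∈ outside σ
  ∈-outside {σ} {ρ} ni = List.∈-filter⁺ (λ ρ → ¬? (ρ ∈? rays σ)) (List.∈-allFin ρ) ni

  outside-∉ : ∀ {σ ρ} → ρ List.∈ outside σ → ρ ∉ rays σ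
  outside-∉ {σ} i = List.∈-filter⁻ (λ ρ → ¬? (ρ ∈? rays σ)) {xs = allFin n} i .proj₂

  -- The divisors outside a maximal cone are independent in the Picard group.
  length-outside : ∀ {r} → RankPic Δ r → ∀ σ → length (outside σ) ≤ r
  length-outside {r} (_ , max) σ = ℕ.≮⇒≥ λ r< → max (D r<) (D-independent r<)
    where
    module _ (r< : r < length (outside σ)) where
      outer : Fin (suc r) → Fin n
      outer i = List.lookup (outside σ) (Fin.inject≤ i r<)
      outer-injective : ∀ {i j} → outer i ≡ outer j → i ≡ j
      outer-injective e = Fin.inject≤-injective r< r< _ _ (lookup-unique (Unique.filter⁺ _ (Unique.allFin⁺ n)) e)
      D : Vector (Divisor Δ) (suc r)
      D i ρ = + δ (outer i) ρ
      D-on : ∀ i → D i (outer i) ≡ 1ℤ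
      D-on i = cong +_ (δ-on (outer i))
      D-off : ∀ i {ρ} → outer i ≢ ρ → D i ρ ≡ 0ℤ
      D-off i ne = cong +_ (δ-off λ e → ne (sym e))
      D-independent : PicIndependent Δ D
      D-independent c (μ , eq) j = begin
        c j                              ≡⟨ ℤ.*-identityʳ (c j) ⟨
        c j ℤ.* 1ℤ                       ≡⟨ cong (c j ℤ.*_) (D-on j) ⟨
        c j ℤ.* D j (outer j)                ≡⟨ ∑-single (λ i → c i ℤ.* D i (outer j)) j (λ i i≢j → trans (cong (c i ℤ.*_) (D-off i λ e → i≢j (outer-injective e))) (ℤ.*-zeroʳ (c i))) ⟨
        ∑ℤ (λ i → c i ℤ.* D i (outer j))     ≡⟨ eq (outer j) ⟩
        ⟨ μ , gen (outer j) ⟩                ≡⟨ agree σ μ (λ _ → 0ℤ) (λ ρ i → trans (sym (eq ρ)) (trans (vanish i) (sym (zeroˡ (gen ρ))))) (gen (outer j)) ⟩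
        ⟨ (λ _ → 0ℤ) , gen (outer j) ⟩       ≡⟨ zeroˡ (gen (outer j)) ⟩
        0ℤ                               ∎
        where
        open ≡.≡-Reasoning
        zeroˡ : ∀ (v : Lattice d) → ⟨ (λ _ → 0ℤ) , v ⟩ ≡ 0ℤ
        zeroˡ v = ∑.sum-replicate-zero d
        vanish : ∀ {ρ} → ρ ∈ rays σ → ∑ℤ (λ i → c i ℤ.* D i ρ) ≡ 0ℤ
        vanish {ρ} i = trans (∑.sum-cong-≗ λ k → trans (cong (c k ℤ.*_) (D-off k λ e → outside-∉ {σ} (List.∈-lookup (Fin.inject≤ k r<)) (subst (_∈ rays σ) (sym e) i))) (ℤ.*-zeroʳ (c k)))
          (∑.sum-replicate-zero (suc r))

  module Dual (gg : GloballyGenerated Δ (-K Δ)) (m : Vector (Lattice d) numMax) (dual : IsDualFamily Δ m) where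

    m≤1 : ∀ σ ρ → ⟨ m σ , gen ρ ⟩ ℤ.≤ 1ℤ
    m≤1 σ ρ with gg σ (λ i → ℤ.- m σ i) (λ ρ i → ℤ.≤-reflexive (sym (negated ρ i)))
      where
      negated : ∀ ρ → ρ ∈ rays σ → ⟨ (λ i → ℤ.- m σ i) , gen ρ ⟩ ≡ ℤ.- 1ℤ
      negated ρ i = trans (pairing-neg (m σ) (gen ρ)) (cong ℤ.-_ (dual σ ρ i))
    ... | m′ , section , le = ℤ.neg-cancel-≤ (begin
      ℤ.- 1ℤ                            ≤⟨ section ρ ⟩
      ⟨ m′ , gen ρ ⟩                    ≡⟨ agree σ m′ (λ i → ℤ.- m σ i) (λ ρ i → ℤ.≤-antisym (le ρ i)
                                             (ℤ.≤-trans (ℤ.≤-reflexive (trans (pairing-neg (m σ) (gen ρ)) (cong ℤ.-_ (dual σ ρ i)))) (section ρ))) (gen ρ) ⟩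
      ⟨ (λ i → ℤ.- m σ i) , gen ρ ⟩     ≡⟨ pairing-neg (m σ) (gen ρ) ⟩
      ℤ.- ⟨ m σ , gen ρ ⟩               ∎)
      where open ℤ.≤-Reasoning

    α : Fin numMax → Fin n → ℕ
    α σ ρ = ℤ.∣ a Δ m σ ρ ∣

    α-def : ∀ σ ρ → + α σ ρ ≡ 1ℤ ℤ.- ⟨ m σ , gen ρ ⟩
    α-def σ ρ = ℤ.0≤i⇒+∣i∣≡i (ℤ.i≤j⇒0≤j-i (m≤1 σ ρ))

    α-on : ∀ {σ ρ} → ρ ∈ rays σ → α σ ρ ≡ 0
    α-on {σ} {ρ} i = ℤ.+-injective (trans (α-def σ ρ) (cong (ℤ._-_ 1ℤ) (dual σ ρ i)))

    degree : ∀ σ (e : Vector ℕ n) → Relation e → ∑ℕ e ≡ ∑ℕ λ ρ → α σ ρ * e ρ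
    degree σ e rel = ℤ.+-injective (begin
      + ∑ℕ e                                             ≡⟨ pos-∑ e ⟩
      ∑ℤ (λ ρ → + e ρ)                                   ≡⟨ ℤ.+-identityʳ _ ⟨
      ∑ℤ (λ ρ → + e ρ) ℤ.+ 0ℤ                            ≡⟨ cong (ℤ._+_ (∑ℤ (λ ρ → + e ρ))) (cong (ℤ._*_ (ℤ.- 1ℤ)) (trans (sym (pairing-0 (m σ) rel)) (pairing-lin (m σ) (λ ρ → + e ρ)))) ⟩
      ∑ℤ (λ ρ → + e ρ) ℤ.+ ℤ.- 1ℤ ℤ.* ∑ℤ (λ ρ → + e ρ ℤ.* ⟨ m σ , gen ρ ⟩)
        ≡⟨ cong (ℤ._+_ (∑ℤ (λ ρ → + e ρ))) (∑.*-distribˡ-sum (ℤ.- 1ℤ) (λ ρ → + e ρ ℤ.* ⟨ m σ , gen ρ ⟩)) ⟩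
      ∑ℤ (λ ρ → + e ρ) ℤ.+ ∑ℤ (λ ρ → ℤ.- 1ℤ ℤ.* (+ e ρ ℤ.* ⟨ m σ , gen ρ ⟩))
        ≡⟨ ∑.∑-distrib-+ (λ ρ → + e ρ) _ ⟨
      ∑ℤ (λ ρ → + e ρ ℤ.+ ℤ.- 1ℤ ℤ.* (+ e ρ ℤ.* ⟨ m σ , gen ρ ⟩))
        ≡⟨ ∑.sum-cong-≗ (λ ρ → trans (factor (+ e ρ) ⟨ m σ , gen ρ ⟩) (trans (cong (ℤ._* + e ρ) (sym (α-def σ ρ))) (sym (ℤ.pos-* (α σ ρ) (e ρ))))) ⟩
      ∑ℤ (λ ρ → + (α σ ρ * e ρ))                         ≡⟨ pos-∑ (λ ρ → α σ ρ * e ρ) ⟨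
      + ∑ℕ (λ ρ → α σ ρ * e ρ)                           ∎)
      where
      open ≡.≡-Reasoning
      open import Data.Integer.Tactic.RingSolver using (solve-∀)
      factor : ∀ x y → x ℤ.+ ℤ.- 1ℤ ℤ.* (x ℤ.* y) ≡ (1ℤ ℤ.- y) ℤ.* x
      factor = solve-∀

    -- Completing k to a relation by the coordinates c of -∑ k_ρ n_ρ in a cone.
    completion : ∀ (k : Vector ℕ n) → ∃[ τ ] Σ[ c ∈ Vector ℕ n ] Relation (λ ρ → k ρ + c ρ) × ∑ℕ (λ ρ → k ρ + c ρ) ≡ ∑ℕ (λ ρ → α τ ρ * k ρ)
    completion k =
      let τ , inCone     = complete (λ i → (ℤ.- 1ℤ ℤ.* lin (λ ρ → + k ρ) i) /1)
          c , off , v≡   = integral-coordinates τ (λ i → ℤ.- 1ℤ ℤ.* lin (λ ρ → + k ρ) i) inCone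
          rel            = relation c v≡
      in τ , c , rel , trans (degree τ (λ ρ → k ρ + c ρ) rel) (∑ⁿ.sum-cong-≗ (drop τ c off))
      where
      relation : ∀ c → (∀ i → ℤ.- 1ℤ ℤ.* lin (λ ρ → + k ρ) i ≡ lin (λ ρ → + c ρ) i) → Relation (λ ρ → k ρ + c ρ)
      relation c v≡ i = begin
        lin (λ ρ → + (k ρ + c ρ)) i                            ≡⟨ lin-cong (λ ρ → ℤ.pos-+ (k ρ) (c ρ)) i ⟩
        lin (λ ρ → + k ρ ℤ.+ + c ρ) i                          ≡⟨ lin-+ (λ ρ → + k ρ) (λ ρ → + c ρ) i ⟩
        lin (λ ρ → + k ρ) i ℤ.+ lin (λ ρ → + c ρ) i            ≡⟨ cong (ℤ._+_ (lin (λ ρ → + k ρ) i)) (v≡ i) ⟨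
        lin (λ ρ → + k ρ) i ℤ.+ ℤ.- 1ℤ ℤ.* lin (λ ρ → + k ρ) i ≡⟨ cong (ℤ._+_ (lin (λ ρ → + k ρ) i)) (ℤ.-1*i≡-i _) ⟩
        lin (λ ρ → + k ρ) i ℤ.- lin (λ ρ → + k ρ) i            ≡⟨ ℤ.+-inverseʳ (lin (λ ρ → + k ρ) i) ⟩
        0ℤ                                                     ∎
        where open ≡.≡-Reasoning
      drop : ∀ τ (c : Vector ℕ n) → (∀ ρ → ρ ∉ rays τ → c ρ ≡ 0) → ∀ ρ → α τ ρ * (k ρ + c ρ) ≡ α τ ρ * k ρ
      drop τ c off ρ with ρ ∈? rays τ
      ... | yes i = trans (cong (_* (k ρ + c ρ)) (α-on {τ} i)) (cong (_* k ρ) (sym (α-on {τ} i)))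
      ... | no ni = cong (α τ ρ *_) (trans (cong (_+_ (k ρ)) (off ρ ni)) (ℕ.+-identityʳ (k ρ)))

    -- As α σ vanishes on the rays of σ, this cone does not contain ρ.
    opposite : ∀ ρ → ∃[ σ ] 1 ≤ α σ ρ
    opposite ρ = let τ , c , rel , eq = completion (δ ρ) in τ , positive τ c eq
      where
      open ℕ.≤-Reasoning
      positive : ∀ τ c → ∑ℕ (λ ρ′ → δ ρ ρ′ + c ρ′) ≡ ∑ℕ (λ ρ′ → α τ ρ′ * δ ρ ρ′) → 1 ≤ α τ ρ
      positive τ c eq = begin
        1                             ≡⟨ δ-on ρ ⟨
        δ ρ ρ                         ≤⟨ ℕ.m≤m+n (δ ρ ρ) (c ρ) ⟩
        δ ρ ρ + c ρ                   ≤⟨ ∑ℕ-≥ (λ ρ′ → δ ρ ρ′ + c ρ′) ρ ⟩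
        ∑ℕ (λ ρ′ → δ ρ ρ′ + c ρ′)     ≡⟨ eq ⟩
        ∑ℕ (λ ρ′ → α τ ρ′ * δ ρ ρ′)   ≡⟨ ∑ℕ-single (λ ρ′ → α τ ρ′ * δ ρ ρ′) ρ (λ ρ′ ne → trans (cong (α τ ρ′ *_) (δ-off ne)) (ℕ.*-zeroʳ (α τ ρ′))) ⟩
        α τ ρ * δ ρ ρ                 ≡⟨ cong (α τ ρ *_) (δ-on ρ) ⟩
        α τ ρ * 1                     ≡⟨ ℕ.*-identityʳ _ ⟩
        α τ ρ                         ∎

mass-weight-≤ : ∀ {A : Set} {w : A → ℕ} {S : A → Set} {Q M} W → (∀ {a} → S a → w a * Q ≤ W) → Mass one S 1 M → Mass w S Q (W * M)
mass-weight-≤ {w = w} {S} {Q} {M} W le m as u all = ℕ.≤-trans (go as all)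
  (ℕ.*-monoʳ-≤ W (ℕ.≤-trans (ℕ.≤-reflexive (sym (ℕ.*-identityʳ _))) (m as u all)))
  where
  go : ∀ as → All S as → weight w as * Q ≤ W * weight one as
  go []       []        = z≤n
  go (a ∷ as) (s ∷ all) = begin
    (w a + weight w as) * Q        ≡⟨ ℕ.*-distribʳ-+ Q (w a) _ ⟩
    w a * Q + weight w as * Q      ≤⟨ ℕ.+-mono-≤ (le s) (go as all) ⟩
    W + W * weight one as          ≡⟨ ℕ.*-suc W _ ⟨
    W * suc (weight one as)        ∎
    where open ℕ.≤-Reasoning

mass-sum-≤ : ∀ n L → Mass (λ c → 2 ^ (L ∸ Vec.sum c)) (λ (c : Vec ℕ n) → Vec.sum c ≤ L) 1 (2 ^ n * 2 ^ L)
mass-sum-≤ zero    L = mass-subsingleton (λ { {[]} {[]} _ _ → refl }) (λ { {[]} _ → ℕ.≤-reflexive (sym (ℕ.*-identityˡ _)) })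
mass-sum-≤ (suc n) L = mass-≤ (ℕ.≤-reflexive (sym (ℕ.*-assoc 2 (2 ^ n) (2 ^ L))))
  (mass-fibre (Vec.≡-dec ℕ._≟_) (λ c → Vec.sum c ≤ L) (λ c Y → Vec.sum Y ≤ L × Vec.tail Y ≡ c) {1} {1} {2} {2 ^ n * 2 ^ L}
    (λ { {x ∷ c} le → c , ℕ.≤-trans (ℕ.m≤n+m _ x) le , le , refl })
    (λ {c} c≤ → mass-injection ℕ._≟_ Vec.head
      (λ { {x ∷ _} (le , refl) → z≤n , ℕ.≤-trans (ℕ.≤-reflexive (sym (ℕ.m+n∸n≡m x (Vec.sum c)))) (ℕ.∸-monoˡ-≤ (Vec.sum c) le) })
      (λ { {_ ∷ _} {_ ∷ _} (_ , refl) (_ , refl) refl → refl })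
      (λ { {x ∷ _} (_ , refl) → ℕ.≤-reflexive (cong (2 ^_) (trans (cong (L ∸_) (ℕ.+-comm x (Vec.sum c))) (sym (ℕ.∸-+-assoc L (Vec.sum c) x)))) })
      (mass-geometric 0 (L ∸ Vec.sum c)))
    (mass-sum-≤ n L))

-- The sum of vol k over k completed by some c to total degree at most L, from
-- the number B of such k of given degree for each c: the degrees contribute
-- ∑_{t ≤ L} 2ᵗ⁻ᶜ, and the sum of 2⁻ᶜ over all c converges.
mass-completed : ∀ {n} (P : Vec ℕ n → Vec ℕ n → Set) L B →
  (∀ c t → t ≤ L → Mass one (λ k → P c k × Vec.sum k + Vec.sum c ≡ t) 1 B) →
  Mass vol (λ k → ∃[ c ] P c k × Vec.sum k + Vec.sum c ≤ L) 1 (2 ^ suc n * 2 ^ L * B)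
mass-completed {n} P L B count = mass-cancel (2 ^ L) {{ℕ.m^n≢0 2 L}} (mass-≤ (ℕ.≤-reflexive
    (solve 3 (λ B l n → B :* (con 2 :* l) :* (n :* l) := l :* (con 2 :* n :* l :* B)) refl B (2 ^ L) (2 ^ n)))
  (mass-fibre (Vec.≡-dec ℕ._≟_) (λ c → Vec.sum c ≤ L) (λ c k → P c k × Vec.sum k + Vec.sum c ≤ L) {2 ^ L} {1} {B * 2 ^ suc L} {2 ^ n * 2 ^ L}
    (λ { {k} (c , p , le) → c , ℕ.≤-trans (ℕ.m≤n+m _ (Vec.sum k)) le , p , le })
    (λ {c} c≤ → mass-≡ (exponent c≤) (mass-≤ (ℕ.≤-reflexive (ℕ.*-comm (2 ^ (L ∸ Vec.sum c)) _)) (mass-scale (2 ^ (L ∸ Vec.sum c)) (for c))))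
    (mass-sum-≤ n L)))
  where
  open +-*-Solver
  exponent : ∀ {s} → s ≤ L → 2 ^ (L ∸ s) * (2 ^ s * 1) ≡ 2 ^ L
  exponent {s} s≤ = trans (cong (2 ^ (L ∸ s) *_) (ℕ.*-identityʳ _)) (trans (sym (ℕ.^-distribˡ-+-* 2 (L ∸ s) s)) (cong (2 ^_) (ℕ.m∸n+n≡m s≤)))
  for : ∀ c → Mass vol (λ k → P c k × Vec.sum k + Vec.sum c ≤ L) (2 ^ Vec.sum c * 1) (B * 2 ^ suc L)
  for c = mass-fibre ℕ._≟_ (_< suc L) (λ t k → P c k × Vec.sum k + Vec.sum c ≡ t) {2 ^ Vec.sum c} {1} {B} {2 ^ suc L}
    (λ { (p , le) → _ , s≤s le , p , refl })
    (λ { {t} (s≤s t≤) → mass-≤ (ℕ.≤-reflexive (ℕ.*-comm (2 ^ t) B)) (mass-weight-≤ (2 ^ t)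
      (λ { {k} (_ , refl) → ℕ.≤-reflexive (sym (ℕ.^-distribˡ-+-* 2 (Vec.sum k) (Vec.sum c))) }) (count c t t≤)) })
    (mass-≤ (ℕ.<⇒≤ (∑<-2^ (suc L))) (mass-below {2 ^_} (suc L)))

mass-cube : ∀ s L → Mass one (λ (k : Vec ℕ s) → VecAll.All (_≤ L) k) 1 (suc L ^ s)
mass-cube zero    L = mass-subsingleton (λ { {[]} {[]} _ _ → refl }) (λ _ → ℕ.≤-refl)
mass-cube (suc s) L = mass-∷ (VecAll.All (_≤ L)) (λ { (_ VecAll.∷ all) → all })
  (λ _ → mass-⊆ (λ { (x≤ VecAll.∷ _) → s≤s x≤ }) (count-below (suc L))) (mass-cube s L)

entries≤sum : ∀ {n} (k : Vec ℕ n) → VecAll.All (_≤ Vec.sum k) k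
entries≤sum []      = VecAll.[]
entries≤sum (x ∷ k) = ℕ.m≤m+n x _ VecAll.∷ VecAll.map (λ le → ℕ.≤-trans le (ℕ.m≤n+m _ x)) (entries≤sum k)

sum-lookup : ∀ {n} (k : Vec ℕ n) → Vec.sum k ≡ ∑ℕ (lookup k)
sum-lookup []      = refl
sum-lookup (x ∷ k) = cong (_+_ x) (sum-lookup k)

lookup-ext : ∀ {n} (k k′ : Vec ℕ n) → (∀ ρ → lookup k ρ ≡ lookup k′ ρ) → k ≡ k′
lookup-ext []      []        e = refl
lookup-ext (x ∷ k) (x′ ∷ k′) e = cong₂ _∷_ (e zero) (lookup-ext k k′ (e ∘ suc))

module _ {n : ℕ} where
  entries : (J : List (Fin n)) → Vec ℕ n → Vec ℕ (length J)
  entries []      k = []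
  entries (ρ ∷ J) k = lookup k ρ ∷ entries J k

  entries-≡ : ∀ J {k k′} → entries J k ≡ entries J k′ → ∀ {ρ} → ρ List.∈ J → lookup k ρ ≡ lookup k′ ρ
  entries-≡ (ρ ∷ J) e (here refl) = Vec.∷-injectiveˡ e
  entries-≡ (ρ ∷ J) e (there i)   = entries-≡ J (Vec.∷-injectiveʳ e) i

  entries-≤ : ∀ J {k L} → VecAll.All (_≤ L) k → VecAll.All (_≤ L) (entries J k)
  entries-≤ []      le = VecAll.[]
  entries-≤ (ρ ∷ J) le = lookup⁺ le ρ VecAll.∷ entries-≤ J le

  without : Fin n → List (Fin n) → List (Fin n)
  without ρ = filter λ ρ′ → ¬? (ρ′ Fin.≟ ρ)

  ∈-without : ∀ {ρ ρ′ J} → ρ′ List.∈ J → ρ′ ≢ ρ → ρ′ List.∈ without ρ J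
  ∈-without {ρ} = List.∈-filter⁺ λ ρ′ → ¬? (ρ′ Fin.≟ ρ)

  length-without : ∀ {ρ J} → ρ List.∈ J → length (without ρ J) < length J
  length-without {ρ} {J} i = List.filter-notAll (λ ρ′ → ¬? (ρ′ Fin.≟ ρ)) J (List.lose i λ ne → ne refl)

^-distribʳ-* : ∀ j a b → (a * b) ^ j ≡ a ^ j * b ^ j
^-distribʳ-* zero    a b = refl
^-distribʳ-* (suc j) a b = trans (cong (a * b *_) (^-distribʳ-* j a b))
  (solve 4 (λ a b x y → a :* b :* (x :* y) := a :* x :* (b :* y)) refl a b (a ^ j) (b ^ j))
  where open +-*-Solver

2L-bound : ∀ {L} → 1 ≤ L → suc L ≤ 2 * L
2L-bound {L} 1≤L = ℕ.≤-trans (ℕ.+-monoˡ-≤ L 1≤L) (ℕ.≤-reflexive (cong (_+_ L) (sym (ℕ.+-identityʳ L))))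

-- Write a j q ≤ L < a j (q + 1); then L + 1 ≤ a j 2^q.
polynomial≤exponential : ∀ a .{{_ : NonZero a}} j → ∃[ C ] (∀ L → suc L ^ j ≤ C * 2 ^ (L ℕ./ a))
polynomial≤exponential a zero      = 1 , λ L → ℕ.≤-trans (1≤2^ (L ℕ./ a)) (ℕ.≤-reflexive (sym (ℕ.*-identityˡ _)))
polynomial≤exponential a j@(suc _) = A ^ j , λ L → let q = L ℕ./ A in begin
  suc L ^ j                  ≤⟨ ℕ.^-monoˡ-≤ j (ceiling L) ⟩
  (A * 2 ^ q) ^ j            ≡⟨ ^-distribʳ-* j A (2 ^ q) ⟩
  A ^ j * (2 ^ q) ^ j        ≡⟨ cong (A ^ j *_) (ℕ.^-*-assoc 2 q j) ⟩
  A ^ j * 2 ^ (q * j)        ≤⟨ ℕ.*-monoʳ-≤ (A ^ j) (ℕ.^-monoʳ-≤ 2 (exponent L)) ⟩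
  A ^ j * 2 ^ (L ℕ./ a)      ∎
  where
  open ℕ.≤-Reasoning
  A = a * j
  instance
    A≢0 : NonZero A
    A≢0 = ℕ.m*n≢0 a j
  ceiling : ∀ L → suc L ≤ A * 2 ^ (L ℕ./ A)
  ceiling L = begin-strict
    L                               ≡⟨ ℕ.m≡m%n+[m/n]*n L A ⟩
    L ℕ.% A + L ℕ./ A * A           <⟨ ℕ.+-monoˡ-< (L ℕ./ A * A) (ℕ.m%n<n L A) ⟩
    A + L ℕ./ A * A                 ≡⟨ ℕ.*-comm A (suc (L ℕ./ A)) ⟨
    A * suc (L ℕ./ A)               ≤⟨ ℕ.*-monoʳ-≤ A (n<2^n (L ℕ./ A)) ⟩
    A * 2 ^ (L ℕ./ A)               ∎
  exponent : ∀ L → L ℕ./ A * j ≤ L ℕ./ a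
  exponent L = begin
    L ℕ./ A * j                ≡⟨ ℕ.m*n/n≡m _ a ⟨
    L ℕ./ A * j * a ℕ./ a      ≤⟨ ℕ./-monoˡ-≤ a (ℕ.≤-trans (ℕ.≤-reflexive (trans (ℕ.*-assoc (L ℕ./ A) j a) (cong (L ℕ./ A *_) (ℕ.*-comm j a)))) (ℕ.m/n*n≤m L A)) ⟩
    L ℕ./ a                    ∎

module Count {d n : ℕ} (Δ : CompleteRegularFan d n) (gg : GloballyGenerated Δ (-K Δ))
  (m : Vector (Lattice d) (CompleteRegularFan.numMax Δ)) (dual : IsDualFamily Δ m) where
  open CompleteRegularFan Δ
  open Geometry Δ
  open Dual gg m dual

  -- A relation of given degree is determined by its coordinates outside σ and
  -- different from ρ₁, as ∑ e = ∑ α σ ρ e ρ.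
  separate : ∀ {σ ρ₁} → 1 ≤ α σ ρ₁ → ∀ e e′ → Relation e → Relation e′ → ∑ℕ e ≡ ∑ℕ e′ →
    (∀ ρ → ρ ∉ rays σ → ρ ≢ ρ₁ → e ρ ≡ e′ ρ) → ∀ ρ → e ρ ≡ e′ ρ
  separate {σ} {ρ₁} 1≤α e e′ rel rel′ eq off = relation-difference σ e e′ rel rel′ outer
    where
    terms : ∀ ρ → ρ ≢ ρ₁ → α σ ρ * e ρ ≡ α σ ρ * e′ ρ
    terms ρ ne with ρ ∈? rays σ
    ... | yes i = trans (cong (_* e ρ) (α-on {σ} i)) (cong (_* e′ ρ) (sym (α-on {σ} i)))
    ... | no ni = cong (α σ ρ *_) (off ρ ni ne)
    outer : ∀ ρ → ρ ∉ rays σ → e ρ ≡ e′ ρ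
    outer ρ ni with ρ Fin.≟ ρ₁
    ... | no ne    = off ρ ni ne
    ... | yes refl = ℕ.*-cancelˡ-≡ (e ρ) (e′ ρ) (α σ ρ) {{ℕ.>-nonZero 1≤α}}
      (∑ℕ-cancel (λ ρ → α σ ρ * e ρ) (λ ρ → α σ ρ * e′ ρ) ρ terms
        (trans (sym (degree σ e rel)) (trans eq (degree σ e′ rel′))))

  Completes : Vec ℕ n → Vec ℕ n → Set
  Completes c k = Relation (λ ρ → lookup k ρ + lookup c ρ)

  sum-completed : ∀ (k c : Vec ℕ n) → ∑ℕ (λ ρ → lookup k ρ + lookup c ρ) ≡ Vec.sum k + Vec.sum c
  sum-completed k c = trans (∑ⁿ.∑-distrib-+ (lookup k) (lookup c)) (cong₂ _+_ (sym (sum-lookup k)) (sym (sum-lookup c)))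

  completes-injective : ∀ {σ ρ₁} → 1 ≤ α σ ρ₁ → ∀ c {k k′ t} →
    Completes c k → Vec.sum k + Vec.sum c ≡ t → Completes c k′ → Vec.sum k′ + Vec.sum c ≡ t →
    (∀ ρ → ρ ∉ rays σ → ρ ≢ ρ₁ → lookup k ρ ≡ lookup k′ ρ) → k ≡ k′
  completes-injective 1≤α c {k} {k′} r e r′ e′ off = lookup-ext k k′ λ ρ → ℕ.+-cancelʳ-≡ (lookup c ρ) _ _
    (separate 1≤α (λ ρ → lookup k ρ + lookup c ρ) (λ ρ → lookup k′ ρ + lookup c ρ) r r′
      (trans (sum-completed k c) (trans e (trans (sym e′) (sym (sum-completed k′ c)))))
      (λ ρ ni ne → cong (_+ lookup c ρ) (off ρ ni ne)) ρ)

  Admissible : ℕ → Vec ℕ n → Set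
  Admissible L k = ∃[ c ] Completes c k × Vec.sum k + Vec.sum c ≤ L

  admissible-entries : ∀ {L k} → Admissible L k → VecAll.All (_≤ L) k
  admissible-entries {L} {k} (c , _ , le) = VecAll.map (λ x≤ → ℕ.≤-trans x≤ (ℕ.≤-trans (ℕ.m≤m+n _ _) le)) (entries≤sum k)

  count-entries : ∀ {σ ρ₁} → 1 ≤ α σ ρ₁ → ∀ L c t → t ≤ L →
    Mass one (λ k → Completes c k × Vec.sum k + Vec.sum c ≡ t) 1 (suc L ^ length (without ρ₁ (outside σ)))
  count-entries {σ} {ρ₁} 1≤α L c t t≤L = mass-injection (Vec.≡-dec ℕ._≟_) (entries J)
    (λ { {k} (r , e) → entries-≤ J (admissible-entries {L} (c , r , ℕ.≤-trans (ℕ.≤-reflexive e) t≤L)) })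
    (λ { (r , e) (r′ , e′) eq → completes-injective 1≤α c r e r′ e′ λ ρ ni ne → entries-≡ J eq (∈-without (∈-outside ni) ne) })
    (λ _ → ℕ.≤-refl) (mass-cube (length J) L)
    where J = without ρ₁ (outside σ)

  count-bad-entries : ∀ {σ ρ₀ ρ₁} → 1 ≤ α σ ρ₁ → ∀ L K c t → t ≤ L →
    Mass one (λ k → (Completes c k × lookup k ρ₀ < K) × Vec.sum k + Vec.sum c ≡ t) 1
      (K * suc L ^ length (without ρ₀ (without ρ₁ (outside σ))))
  count-bad-entries {σ} {ρ₀} {ρ₁} 1≤α L K c t t≤L = mass-injection (Vec.≡-dec ℕ._≟_) (λ k → lookup k ρ₀ ∷ entries J k)
    (λ { {k} ((r , <K) , e) → <K , entries-≤ J (admissible-entries {L} (c , r , ℕ.≤-trans (ℕ.≤-reflexive e) t≤L)) })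
    (λ { {k} {k′} ((r , _) , e) ((r′ , _) , e′) eq → completes-injective 1≤α c r e r′ e′ λ ρ ni ne → same k k′ eq ρ ni ne })
    (λ _ → ℕ.≤-refl)
    (mass-∷ {S = λ Y → Vec.head Y < K × VecAll.All (_≤ L) (Vec.tail Y)} (VecAll.All (_≤ L)) proj₂ (λ _ → mass-⊆ proj₁ (count-below K)) (mass-cube (length J) L))
    where
    J = without ρ₀ (without ρ₁ (outside σ))
    same : ∀ k k′ → lookup k ρ₀ ∷ entries J k ≡ lookup k′ ρ₀ ∷ entries J k′ → ∀ ρ → ρ ∉ rays σ → ρ ≢ ρ₁ → lookup k ρ ≡ lookup k′ ρ
    same k k′ eq ρ ni ne with ρ Fin.≟ ρ₀
    ... | yes refl = Vec.∷-injectiveˡ eq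
    ... | no ne′   = entries-≡ J (Vec.∷-injectiveʳ eq) (∈-without (∈-without (∈-outside ni) ne) ne′)

  outside-of : ∀ {σ ρ} → 1 ≤ α σ ρ → ρ List.∈ outside σ
  outside-of {σ} {ρ} 1≤α = ∈-outside λ i → ℕ.<⇒≢ 1≤α (sym (α-on {σ} i))

  module _ {r : ℕ} (rank : RankPic Δ r) where

    1≤rank : Fin n → 1 ≤ r
    1≤rank ρ = let σ , 1≤α = opposite ρ in
      ℕ.≤-trans (ℕ.≤-trans (s≤s z≤n) (length-without (outside-of 1≤α))) (length-outside rank σ)

    mass-admissible : Fin n → ∀ L → Mass vol (Admissible L) 1 (2 ^ suc n * 2 ^ L * suc L ^ (r ∸ 1))
    mass-admissible ρ L = let σ , 1≤α = opposite ρ in mass-completed Completes L _ λ c t t≤L →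
      mass-≤ (ℕ.^-monoʳ-≤ (suc L) (ℕ.∸-monoˡ-≤ 1 (ℕ.≤-trans (length-without (outside-of 1≤α)) (length-outside rank σ))))
        (count-entries 1≤α L c t t≤L)

    Bad : ℕ → ℕ → Fin n → Vec ℕ n → Set
    Bad L K ρ₀ k = Admissible L k × lookup k ρ₀ < K

    mass-bad-independent : ∀ {σ ρ₀ ρ₁} → 1 ≤ α σ ρ₀ → 1 ≤ α σ ρ₁ → ρ₀ ≢ ρ₁ → ∀ L K → 1 ≤ L →
      Mass vol (Bad L K ρ₀) (L * L) (2 ^ suc n * 2 ^ r * (2 ^ L * L ^ r * K))
    mass-bad-independent {σ} {ρ₀} {ρ₁} 1≤α₀ 1≤α₁ ne L K 1≤L = mass-≡ (ℕ.*-identityʳ (L * L)) (mass-≤ (begin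
      L * L * (2 ^ suc n * 2 ^ L * (K * suc L ^ j))          ≤⟨ ℕ.*-monoʳ-≤ (L * L) (ℕ.*-monoʳ-≤ (2 ^ suc n * 2 ^ L) (ℕ.*-monoʳ-≤ K (ℕ.≤-trans (ℕ.^-monoˡ-≤ j (2L-bound 1≤L)) (ℕ.≤-reflexive (^-distribʳ-* j 2 L))))) ⟩
      L * L * (2 ^ suc n * 2 ^ L * (K * (2 ^ j * L ^ j)))    ≡⟨ solve 6 (λ L a b K c l → L :* L :* (a :* b :* (K :* (c :* l))) := a :* c :* (b :* (L :* (L :* l)) :* K)) refl L (2 ^ suc n) (2 ^ L) K (2 ^ j) (L ^ j) ⟩
      2 ^ suc n * 2 ^ j * (2 ^ L * L ^ suc (suc j) * K)      ≤⟨ ℕ.*-mono-≤ (ℕ.*-monoʳ-≤ (2 ^ suc n) (ℕ.^-monoʳ-≤ 2 (ℕ.≤-trans (ℕ.m≤n+m j 2) j+2≤r)))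
                                                                  (ℕ.*-monoˡ-≤ K (ℕ.*-monoʳ-≤ (2 ^ L) (ℕ.^-monoʳ-≤ L {{ℕ.>-nonZero 1≤L}} j+2≤r))) ⟩
      2 ^ suc n * 2 ^ r * (2 ^ L * L ^ r * K)                ∎)
      (mass-scale (L * L) (mass-⊆ (λ { ((c , r , le) , <K) → c , (r , <K) , le })
        (mass-completed (λ c k → Completes c k × lookup k ρ₀ < K) L _ (count-bad-entries 1≤α₁ L K)))))
      where
      open ℕ.≤-Reasoning
      open +-*-Solver
      j = length (without ρ₀ (without ρ₁ (outside σ)))
      j+2≤r : suc (suc j) ≤ r
      j+2≤r = ℕ.≤-trans (s≤s (length-without (∈-without (outside-of 1≤α₀) ne)))
        (ℕ.≤-trans (length-without (outside-of 1≤α₁)) (length-outside rank σ))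

    -- If ∑ e is proportional to e ρ₀ for relations e, a small k ρ₀ saves a power
    -- of 2ᴸ.
    mass-bad-proportional : ∀ {σ ρ₀} → 1 ≤ α σ ρ₀ → (∀ ρ → ρ ≢ ρ₀ → α σ ρ ≡ 0) →
      ∃[ C ] (∀ L K → 1 ≤ L → 1 ≤ K → 2 ^ K ≤ 4 * (L * L) → Mass vol (Bad L K ρ₀) (L * L) (C * (2 ^ L * L ^ r * K)))
    mass-bad-proportional {σ} {ρ₀} 1≤α off = 4 * C , λ L K 1≤L 1≤K 2^K≤ → let q = L ℕ./ a₀ in
      mass-cancel (2 ^ q) {{ℕ.m^n≢0 2 q}} (mass-≡ (ℕ.*-comm (L * L) (2 ^ q)) (mass-≤ (begin
        L * L * (2 ^ (L + K) * suc L ^ n)          ≡⟨ cong (λ z → L * L * (z * suc L ^ n)) (ℕ.^-distribˡ-+-* 2 L K) ⟩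
        L * L * (2 ^ L * 2 ^ K * suc L ^ n)        ≤⟨ ℕ.*-monoʳ-≤ (L * L) (ℕ.*-monoˡ-≤ (suc L ^ n) (ℕ.*-monoʳ-≤ (2 ^ L) 2^K≤)) ⟩
        L * L * (2 ^ L * (4 * (L * L)) * suc L ^ n) ≡⟨ solve 3 (λ L b l → L :* L :* (b :* (con 4 :* (L :* L)) :* l) := con 4 :* b :* (L :* (L :* (L :* (L :* l))))) refl L (2 ^ L) (suc L ^ n) ⟩
        4 * 2 ^ L * (L * (L * (L * (L * suc L ^ n)))) ≤⟨ ℕ.*-monoʳ-≤ (4 * 2 ^ L) (ℕ.*-mono-≤ (L≤ L) (ℕ.*-mono-≤ (L≤ L) (ℕ.*-mono-≤ (L≤ L) (ℕ.*-monoˡ-≤ (suc L ^ n) (L≤ L))))) ⟩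
        4 * 2 ^ L * suc L ^ (4 + n)                ≤⟨ ℕ.*-monoʳ-≤ (4 * 2 ^ L) (exp L) ⟩
        4 * 2 ^ L * (C * 2 ^ q)                    ≡⟨ solve 3 (λ b C q → con 4 :* b :* (C :* q) := q :* (con 4 :* C :* b)) refl (2 ^ L) C (2 ^ q) ⟩
        2 ^ q * (4 * C * 2 ^ L)                    ≤⟨ ℕ.*-monoʳ-≤ (2 ^ q) (ℕ.*-monoʳ-≤ (4 * C) (one≤ L K 1≤L 1≤K)) ⟩
        2 ^ q * (4 * C * (2 ^ L * L ^ r * K))      ∎)
        (mass-scale (L * L) (mass-weight-≤ (2 ^ (L + K)) (λ {k} bad → ℕ.≤-trans (ℕ.≤-reflexive (sym (ℕ.^-distribˡ-+-* 2 (Vec.sum k) q))) (ℕ.^-monoʳ-≤ 2 (saving L K k bad)))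
          (mass-⊆ (λ bad → admissible-entries (bad .proj₁)) (mass-cube n L))))))
      where
      open ℕ.≤-Reasoning
      open +-*-Solver
      a₀ = α σ ρ₀
      instance
        a₀≢0 : NonZero a₀
        a₀≢0 = ℕ.>-nonZero 1≤α
      C = polynomial≤exponential a₀ (4 + n) .proj₁
      exp = polynomial≤exponential a₀ (4 + n) .proj₂
      L≤ : ∀ L → L ≤ suc L
      L≤ = ℕ.n≤1+n
      one≤ : ∀ L K → 1 ≤ L → 1 ≤ K → 2 ^ L ≤ 2 ^ L * L ^ r * K
      one≤ L K 1≤L 1≤K = ℕ.≤-trans (ℕ.m≤m*n (2 ^ L) (L ^ r) {{ℕ.m^n≢0 L r {{ℕ.>-nonZero 1≤L}}}}) (ℕ.m≤m*n _ K {{ℕ.>-nonZero 1≤K}})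
      saving : ∀ L K k → Bad L K ρ₀ k → Vec.sum k + L ℕ./ a₀ ≤ L + K
      saving L K k ((c , rel , t≤L) , <K) = ℕ.*-cancelˡ-≤ a₀ (begin
        a₀ * (s + L ℕ./ a₀)                 ≡⟨ ℕ.*-distribˡ-+ a₀ s _ ⟩
        a₀ * s + a₀ * (L ℕ./ a₀)            ≤⟨ ℕ.+-monoʳ-≤ (a₀ * s) (ℕ.≤-trans (ℕ.≤-reflexive (ℕ.*-comm a₀ _)) (ℕ.m/n*n≤m L a₀)) ⟩
        a₀ * s + L                          ≡⟨ cong (_+_ (a₀ * s)) (sym (ℕ.m+[n∸m]≡n t≤L)) ⟩
        a₀ * s + (t + (L ∸ t))              ≤⟨ ℕ.+-monoʳ-≤ (a₀ * s) (ℕ.+-mono-≤ t-bound (ℕ.m≤n*m (L ∸ t) a₀)) ⟩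
        a₀ * s + (a₀ * (K + Vec.sum c) + a₀ * (L ∸ t)) ≡⟨ solve 5 (λ a s K c z → a :* s :+ (a :* (K :+ c) :+ a :* z) := a :* (s :+ c :+ z :+ K)) refl a₀ s K (Vec.sum c) (L ∸ t) ⟩
        a₀ * (t + (L ∸ t) + K)              ≡⟨ cong (λ z → a₀ * (z + K)) (ℕ.m+[n∸m]≡n t≤L) ⟩
        a₀ * (L + K)                        ∎)
        where
        s = Vec.sum k
        t = s + Vec.sum c
        t-bound : t ≤ a₀ * (K + Vec.sum c)
        t-bound = begin
          t                                         ≡⟨ sum-completed k c ⟨
          ∑ℕ (λ ρ → lookup k ρ + lookup c ρ)        ≡⟨ degree σ _ rel ⟩
          ∑ℕ (λ ρ → α σ ρ * (lookup k ρ + lookup c ρ)) ≡⟨ ∑ℕ-single _ ρ₀ (λ ρ ne → cong (_* (lookup k ρ + lookup c ρ)) (off ρ ne)) ⟩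
          a₀ * (lookup k ρ₀ + lookup c ρ₀)          ≤⟨ ℕ.*-monoʳ-≤ a₀ (ℕ.+-mono-≤ (ℕ.<⇒≤ <K) (lookup⁺ (entries≤sum c) ρ₀)) ⟩
          a₀ * (K + Vec.sum c)                      ∎

    mass-bad : ∀ ρ₀ → ∃[ C ] (∀ L K → 1 ≤ L → 1 ≤ K → 2 ^ K ≤ 4 * (L * L) → Mass vol (Bad L K ρ₀) (L * L) (C * (2 ^ L * L ^ r * K)))
    mass-bad ρ₀ = let σ , 1≤α = opposite ρ₀ in decide σ 1≤α (Fin.any? λ ρ → ¬? (ρ₀ Fin.≟ ρ) ×-dec (1 ℕ.≤? α σ ρ))
      where
      decide : ∀ σ → 1 ≤ α σ ρ₀ → Dec (∃[ ρ ] ρ₀ ≢ ρ × 1 ≤ α σ ρ) →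
        ∃[ C ] (∀ L K → 1 ≤ L → 1 ≤ K → 2 ^ K ≤ 4 * (L * L) → Mass vol (Bad L K ρ₀) (L * L) (C * (2 ^ L * L ^ r * K)))
      decide σ 1≤α (yes (ρ₁ , ne , 1≤α₁)) = 2 ^ suc n * 2 ^ r , λ L K 1≤L _ _ → mass-bad-independent 1≤α 1≤α₁ ne L K 1≤L
      decide σ 1≤α (no none) = mass-bad-proportional 1≤α λ ρ ne → ℕ.n<1⇒n≡0 (ℕ.≰⇒> λ 1≤ → none (ρ , (λ e → ne (sym e)) , 1≤))

    mass-any-bad : ∃[ C ] (∀ L K → 1 ≤ L → 1 ≤ K → 2 ^ K ≤ 4 * (L * L) →
      Mass vol (λ k → ∃[ ρ₀ ] Bad L K ρ₀ k) (L * L) (C * (2 ^ L * L ^ r * K)))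
    mass-any-bad = ∑ℕ C * n , λ L K 1≤L 1≤K 2^K≤ → mass-≤ (ℕ.≤-reflexive (solve 3 (λ c x n → c :* x :* n := c :* n :* x) refl (∑ℕ C) (2 ^ L * L ^ r * K) n))
      (mass-≡ (ℕ.*-identityʳ (L * L)) (mass-fibre Fin._≟_ (λ _ → Fin n) (Bad L K) {L * L} {1} {∑ℕ C * (2 ^ L * L ^ r * K)} {n}
        (λ { (ρ₀ , bad) → ρ₀ , ρ₀ , bad })
        (λ {ρ₀} _ → mass-≤ (ℕ.≤-trans (ℕ.*-monoˡ-≤ _ (∑ℕ-≥ C ρ₀)) (ℕ.≤-reflexive (sym (ℕ.*-identityʳ _)))) (mass-bad ρ₀ .proj₂ L K 1≤L 1≤K 2^K≤))
        (mass-injection ℕ._≟_ Fin.toℕ (λ {i} _ → Fin.toℕ<n i) (λ _ _ → Fin.toℕ-injective) (λ _ → ℕ.≤-refl) (count-below n))))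
      where
      open +-*-Solver
      C : Vector ℕ n
      C ρ = mass-bad ρ .proj₁

box : ∀ {n} (X : Vec ℕ n) → (∀ ρ → 1 ≤ lookup X ρ) → ∃[ ks ] Box ks X
box []      pos = [] , []
box (x ∷ X) pos = let k , dy = dyadic x (pos zero) ; ks , b = box X (pos ∘ suc) in k ∷ ks , dy ∷ b

2^∑≤∏ : ∀ {n ks} {X : Vec ℕ n} → Box ks X → (α : Fin n → ℕ) →
  2 ^ ∑ℕ (λ ρ → α ρ * lookup ks ρ) ≤ ∏ℕ (λ ρ → lookup X ρ ^ α ρ)
2^∑≤∏ []                      α = ℕ.≤-refl
2^∑≤∏ (_∷_ {k = k} (lo , _) b) α = ℕ.≤-trans (ℕ.≤-reflexive (ℕ.^-distribˡ-+-* 2 (α zero * k) _))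
  (ℕ.*-mono-≤ (ℕ.≤-trans (ℕ.≤-reflexive (trans (cong (2 ^_) (ℕ.*-comm (α zero) k)) (sym (ℕ.^-*-assoc 2 k (α zero))))) (ℕ.^-monoˡ-≤ (α zero) lo))
    (2^∑≤∏ b (α ∘ suc)))

≤-maximum : ∀ {n} (f : Vector ℕ n) i → f i ≤ VecF.foldr ℕ._⊔_ 0 f
≤-maximum f zero    = ℕ.m≤m⊔n (f zero) _
≤-maximum f (suc i) = ℕ.≤-trans (≤-maximum (f ∘ suc) i) (ℕ.m≤n⊔m (f zero) _)

≡-or-empty : ∀ n → n ≡ 0 ⊎ Fin n
≡-or-empty zero    = inj₁ refl
≡-or-empty (suc n) = inj₂ zero

module Total {d n : ℕ} (Δ : CompleteRegularFan d n) (gg : GloballyGenerated Δ (-K Δ))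
  (m : Vector (Lattice d) (CompleteRegularFan.numMax Δ)) (dual : IsDualFamily Δ m)
  {r : ℕ} (rank : RankPic Δ r) (F : List (ℤ[X] n)) (cop : JointlyCoprime n F) where
  open CompleteRegularFan Δ
  open Geometry Δ
  open Dual gg m dual
  open Count Δ gg m dual

  Target : ℕ → ℕ → Vec ℕ n → Set
  Target N L X = (∀ ρ → 1 ≤ lookup X ρ) × height Δ m X < 2 ^ suc L × PrimeAbove n N F X

  admissible : ∀ {L ks X} → Box ks X → height Δ m X < 2 ^ suc L → Admissible L ks
  admissible {L} {ks} {X} b h< = let τ , c , rel , eq = completion (lookup ks) in
    Vec.tabulate c
    , (λ i → trans (lin-cong (λ ρ → cong (λ z → + (lookup ks ρ + z)) (Vec.lookup∘tabulate c ρ)) i) (rel i))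
    , (begin
      Vec.sum ks + Vec.sum (Vec.tabulate c)                 ≡⟨ sum-completed ks (Vec.tabulate c) ⟨
      ∑ℕ (λ ρ → lookup ks ρ + lookup (Vec.tabulate c) ρ)    ≡⟨ ∑ⁿ.sum-cong-≗ (λ ρ → cong (_+_ (lookup ks ρ)) (Vec.lookup∘tabulate c ρ)) ⟩
      ∑ℕ (λ ρ → lookup ks ρ + c ρ)                          ≡⟨ eq ⟩
      ∑ℕ (λ ρ → α τ ρ * lookup ks ρ)                        ≤⟨ small τ ⟩
      L                                                     ∎)
    where
    open ℕ.≤-Reasoning
    small : ∀ τ → ∑ℕ (λ ρ → α τ ρ * lookup ks ρ) ≤ L
    small τ = ℕ.≮⇒≥ λ L< → ℕ.<⇒≱ h< (begin
      2 ^ suc L                                  ≤⟨ ℕ.^-monoʳ-≤ 2 L< ⟩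
      2 ^ ∑ℕ (λ ρ → α τ ρ * lookup ks ρ)         ≤⟨ 2^∑≤∏ b (α τ) ⟩
      D₀-power Δ m X τ                           ≤⟨ ≤-maximum (D₀-power Δ m X) τ ⟩
      height Δ m X                               ∎)

  Good : ℕ → ℕ → ℕ → Vec ℕ n → Set
  Good N L K X = ∃[ ks ] Admissible L ks × Box ks X × PrimeAbove n N F X × VecAll.All (K ≤_) ks

  Small : ℕ → ℕ → Vec ℕ n → Set
  Small L K X = ∃[ ks ] (∃[ ρ₀ ] Bad rank L K ρ₀ ks) × Box ks X

  good-or-small : ∀ {N L} K {X} → Target N L X → Good N L K X ⊎ Small L K X
  good-or-small {N} {L} K {X} (pos , h< , p) = let ks , b = box X pos in decide ks b (Fin.any? λ ρ → lookup ks ρ ℕ.<? K)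
    where
    decide : ∀ ks → Box ks X → Dec (∃[ ρ ] lookup ks ρ < K) → Good N L K X ⊎ Small L K X
    decide ks b (yes (ρ , <K)) = inj₂ (ks , (ρ , admissible b h< , <K) , b)
    decide ks b (no none)      = inj₁ (ks , admissible b h< , b , p , lookup⁻ λ ρ → ℕ.≮⇒≥ λ <K → none (ρ , <K))

  mass-target : ∃[ C ] (∀ N l L l′ → 1 ≤ l → Dyadic l N → 1 ≤ L → Dyadic l′ L →
    Mass one (Target N L) (2 ^ l * l * (L * L)) (C * (2 ^ L * (L ^ suc r + L ^ r * suc l′ * (2 ^ l * l)))))
  mass-target with ≡-or-empty n
  ... | inj₁ refl = C , λ N l L l′ 1≤l _ 1≤L _ → let q = 2 ^ l * l in mass-point λ _ → begin
      q * (L * L)                                          ≤⟨ ℕ.*-monoʳ-≤ q (ℕ.≤-trans (ℕ.≤-trans (ℕ.*-mono-≤ (ℕ.n≤1+n L) (ℕ.≤-trans (ℕ.n≤1+n L) (ℕ.≤-reflexive (sym (ℕ.*-identityʳ _)))))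
                                                                (exp L)) (ℕ.≤-reflexive (cong (λ z → C * 2 ^ z) (ℕ.n/1≡n L)))) ⟩
      q * (C * 2 ^ L)                                      ≡⟨ solve 3 (λ q C x → q :* (C :* x) := C :* (x :* (con 1 :* con 1 :* q))) refl q C (2 ^ L) ⟩
      C * (2 ^ L * (1 * 1 * q))                            ≤⟨ ℕ.*-monoʳ-≤ C (ℕ.*-monoʳ-≤ (2 ^ L) (ℕ.≤-trans (ℕ.*-monoˡ-≤ q (ℕ.*-mono-≤ (ℕ.m^n>0 L {{ℕ.>-nonZero 1≤L}} r) (s≤s z≤n))) (ℕ.m≤n+m _ (L ^ suc r)))) ⟩
      C * (2 ^ L * (L ^ suc r + L ^ r * suc l′ * q))       ∎
    where
    open ℕ.≤-Reasoning
    open +-*-Solver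
    C = polynomial≤exponential 1 2 .proj₁
    exp = polynomial≤exponential 1 2 .proj₂
  ... | inj₂ ρ = C₁ * 2 ^ suc n * 2 ^ r + C₂ * 2 , go
    where
    open ℕ.≤-Reasoning
    open +-*-Solver
    C₁ = mass-primes n F cop .proj₁
    primes = mass-primes n F cop .proj₂
    C₂ = mass-any-bad rank .proj₁
    bad = mass-any-bad rank .proj₂
    module _ (N l L l′ : ℕ) (1≤l : 1 ≤ l) (dyN : Dyadic l N) (1≤L : 1 ≤ L) (dyL : Dyadic l′ L) where
      q = 2 ^ l * l
      K = 2 * suc l′
      2^K : 2 ^ K ≡ 2 ^ suc l′ * 2 ^ suc l′
      2^K = trans (cong (2 ^_) (cong (_+_ (suc l′)) (ℕ.+-identityʳ (suc l′)))) (ℕ.^-distribˡ-+-* 2 (suc l′) (suc l′))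
      2^K≤ : 2 ^ K ≤ 4 * (L * L)
      2^K≤ = begin
        2 ^ K                              ≡⟨ 2^K ⟩
        2 ^ suc l′ * 2 ^ suc l′            ≤⟨ ℕ.*-mono-≤ (ℕ.*-monoʳ-≤ 2 (dyL .proj₁)) (ℕ.*-monoʳ-≤ 2 (dyL .proj₁)) ⟩
        2 * L * (2 * L)                    ≡⟨ solve 1 (λ L → con 2 :* L :* (con 2 :* L) := con 4 :* (L :* L)) refl L ⟩
        4 * (L * L)                        ∎
      L*L≤ : L * L ≤ 2 ^ K
      L*L≤ = ℕ.≤-trans (ℕ.*-mono-≤ (ℕ.<⇒≤ (dyL .proj₂)) (ℕ.<⇒≤ (dyL .proj₂))) (ℕ.≤-reflexive (sym 2^K))
      r′ = r ∸ 1
      r≡ : suc r′ ≡ r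
      r≡ = ℕ.m+[n∸m]≡n (1≤rank rank ρ)
      good : Mass one (Good N L K) (q * (L * L)) (C₁ * 2 ^ suc n * 2 ^ r * (2 ^ L * (L ^ suc r + L ^ r * suc l′ * q)))
      good = mass-cancel (2 ^ K) {{ℕ.m^n≢0 2 K}} (mass-≡ (solve 3 (λ k q l → l :* (k :* q :* con 1) := k :* (q :* l)) refl (2 ^ K) q (L * L)) (mass-≤ (begin
        L * L * (C₁ * (2 ^ K + L * q) * (2 ^ suc n * 2 ^ L * suc L ^ r′))
          ≡⟨ solve 7 (λ L C k q a b x → L :* L :* (C :* (k :+ L :* q) :* (a :* b :* x)) := C :* a :* b :* x :* (k :* (L :* L) :+ L :* L :* (L :* q))) refl L C₁ (2 ^ K) q (2 ^ suc n) (2 ^ L) (suc L ^ r′) ⟩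
        C₁ * 2 ^ suc n * 2 ^ L * suc L ^ r′ * (2 ^ K * (L * L) + L * L * (L * q))
          ≤⟨ ℕ.*-mono-≤ (ℕ.*-monoʳ-≤ (C₁ * 2 ^ suc n * 2 ^ L) (ℕ.≤-trans (ℕ.^-monoˡ-≤ r′ (2L-bound 1≤L)) (ℕ.≤-reflexive (^-distribʳ-* r′ 2 L))))
               (ℕ.+-monoʳ-≤ (2 ^ K * (L * L)) (ℕ.*-monoˡ-≤ (L * q) L*L≤)) ⟩
        C₁ * 2 ^ suc n * 2 ^ L * (2 ^ r′ * L ^ r′) * (2 ^ K * (L * L) + 2 ^ K * (L * q))
          ≡⟨ solve 8 (λ L C k q a b x y → C :* a :* b :* (x :* y) :* (k :* (L :* L) :+ k :* (L :* q)) := k :* (C :* a :* x :* (b :* (L :* (L :* y) :+ L :* y :* q)))) refl L C₁ (2 ^ K) q (2 ^ suc n) (2 ^ L) (2 ^ r′) (L ^ r′) ⟩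
        2 ^ K * (C₁ * 2 ^ suc n * 2 ^ r′ * (2 ^ L * (L ^ suc (suc r′) + L ^ suc r′ * q)))
          ≤⟨ ℕ.*-monoʳ-≤ (2 ^ K) (ℕ.*-mono-≤ (ℕ.*-monoʳ-≤ (C₁ * 2 ^ suc n) (ℕ.^-monoʳ-≤ 2 (ℕ.m∸n≤m r 1))) (ℕ.*-monoʳ-≤ (2 ^ L)
               (ℕ.+-mono-≤ (ℕ.≤-reflexive (cong (λ z → L ^ suc z) r≡)) (ℕ.*-monoˡ-≤ q (ℕ.≤-trans (ℕ.≤-reflexive (cong (L ^_) r≡)) (ℕ.m≤m*n (L ^ r) (suc l′))))))) ⟩
        2 ^ K * (C₁ * 2 ^ suc n * 2 ^ r * (2 ^ L * (L ^ suc r + L ^ r * suc l′ * q)))  ∎)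
        (mass-scale (L * L) (mass-fibre (Vec.≡-dec ℕ._≟_) (Admissible L)
          (λ ks X → (Box ks X × PrimeAbove n N F X) × Admissible L ks × VecAll.All (K ≤_) ks) {2 ^ K * q} {1} {C₁ * (2 ^ K + L * q)} {2 ^ suc n * 2 ^ L * suc L ^ r′}
          (λ { (ks , adm , b , p , K≤) → ks , adm , (b , p) , adm , K≤ })
          (λ { {ks} adm → λ
            { [] u all → z≤n
            ; (X ∷ Xs) u all@((_ , _ , K≤) ∷ _) → primes N l K L 1≤l dyN 1≤L ks K≤ (admissible-entries adm) (X ∷ Xs) u (All.map proj₁ all) } })
          (mass-admissible rank ρ L)))))
      small : Mass one (Small L K) (q * (L * L)) (C₂ * 2 * (2 ^ L * (L ^ suc r + L ^ r * suc l′ * q)))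
      small = mass-≡ (cong (q *_) (ℕ.*-identityˡ (L * L))) (mass-≤ (begin
        q * (1 * (C₂ * (2 ^ L * L ^ r * K)))              ≡⟨ solve 5 (λ q C b x l → q :* (con 1 :* (C :* (b :* x :* (con 2 :* l)))) := C :* con 2 :* (b :* (x :* l :* q))) refl q C₂ (2 ^ L) (L ^ r) (suc l′) ⟩
        C₂ * 2 * (2 ^ L * (L ^ r * suc l′ * q))           ≤⟨ ℕ.*-monoʳ-≤ (C₂ * 2) (ℕ.*-monoʳ-≤ (2 ^ L) (ℕ.m≤n+m _ (L ^ suc r))) ⟩
        C₂ * 2 * (2 ^ L * (L ^ suc r + L ^ r * suc l′ * q)) ∎)
        (mass-scale q (mass-fibre (Vec.≡-dec ℕ._≟_) (λ ks → ∃[ ρ₀ ] Bad rank L K ρ₀ ks) (λ ks X → Box ks X) {1} {L * L} {1} {C₂ * (2 ^ L * L ^ r * K)}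
          (λ { (ks , bad , b) → ks , bad , b })
          (λ {ks} _ → mass-≤ (ℕ.≤-reflexive (sym (ℕ.*-identityˡ _))) (mass-box ks))
          (bad L K 1≤L (s≤s z≤n) 2^K≤))))
      go : Mass one (Target N L) (q * (L * L)) ((C₁ * 2 ^ suc n * 2 ^ r + C₂ * 2) * (2 ^ L * (L ^ suc r + L ^ r * suc l′ * q)))
      go = mass-≤ (ℕ.≤-reflexive (sym (ℕ.*-distribʳ-+ _ (C₁ * 2 ^ suc n * 2 ^ r) (C₂ * 2))))
        (mass-⊎ {S′ = Good N L K} {Small L K} (good-or-small K) good small)

⌜_⌝ : ℕ → ℚ
⌜ n ⌝ = (+ n) /1

⌜⌝-+ : ∀ m n → ⌜ m + n ⌝ ≡ ⌜ m ⌝ ℚ.+ ⌜ n ⌝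
⌜⌝-+ m n = trans (cong _/1 (ℤ.pos-+ m n)) (/1-+ (+ m) (+ n))

⌜⌝-* : ∀ m n → ⌜ m * n ⌝ ≡ ⌜ m ⌝ ℚ.* ⌜ n ⌝
⌜⌝-* m n = trans (cong _/1 (ℤ.pos-* m n)) (/1-* (+ m) (+ n))

⌜⌝-mono : ∀ {m n} → m ≤ n → ⌜ m ⌝ ℚ.≤ ⌜ n ⌝
⌜⌝-mono m≤n = /1-mono-≤ (ℤ.+≤+ m≤n)

0≤⌜⌝ : ∀ n → 0ℚ ℚ.≤ ⌜ n ⌝
0≤⌜⌝ n = ⌜⌝-mono {0} {n} z≤n

*-monoʳ : ∀ {p q r} → 0ℚ ℚ.≤ r → p ℚ.≤ q → r ℚ.* p ℚ.≤ r ℚ.* q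
*-monoʳ {r = r} 0≤r = ℚ.*-monoˡ-≤-nonNeg r {{ℚ.nonNegative 0≤r}}

*-monoˡ : ∀ {p q r} → 0ℚ ℚ.≤ r → p ℚ.≤ q → p ℚ.* r ℚ.≤ q ℚ.* r
*-monoˡ {r = r} 0≤r = ℚ.*-monoʳ-≤-nonNeg r {{ℚ.nonNegative 0≤r}}

*-mono : ∀ {p q r s} → 0ℚ ℚ.≤ p → 0ℚ ℚ.≤ s → p ℚ.≤ q → r ℚ.≤ s → p ℚ.* r ℚ.≤ q ℚ.* s
*-mono 0≤p 0≤s p≤q r≤s = ℚ.≤-trans (*-monoʳ 0≤p r≤s) (*-monoˡ 0≤s p≤q)

0≤* : ∀ {p q} → 0ℚ ℚ.≤ p → 0ℚ ℚ.≤ q → 0ℚ ℚ.≤ p ℚ.* q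
0≤* {p} {q} 0≤p 0≤q = ℚ.≤-trans (ℚ.≤-reflexive (sym (ℚ.*-zeroʳ p))) (*-monoʳ 0≤p 0≤q)

0≤+ : ∀ {p q} → 0ℚ ℚ.≤ p → 0ℚ ℚ.≤ q → 0ℚ ℚ.≤ p ℚ.+ q
0≤+ 0≤p 0≤q = ℚ.≤-trans (ℚ.≤-reflexive (sym (ℚ.+-identityʳ 0ℚ))) (ℚ.+-mono-≤ 0≤p 0≤q)

p≤p+q : ∀ {p q} → 0ℚ ℚ.≤ q → p ℚ.≤ p ℚ.+ q
p≤p+q {p} 0≤q = ℚ.≤-trans (ℚ.≤-reflexive (sym (ℚ.+-identityʳ p))) (ℚ.+-monoʳ-≤ p 0≤q)

+-cancelʳ-≤ : ∀ {p q} r → p ℚ.+ r ℚ.≤ q ℚ.+ r → p ℚ.≤ q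
+-cancelʳ-≤ {p} {q} r le = subst₂ ℚ._≤_ (eq p) (eq q) (ℚ.+-monoˡ-≤ (ℚ.- r) le)
  where
  eq : ∀ x → x ℚ.+ r ℚ.+ ℚ.- r ≡ x
  eq x = trans (ℚ.+-assoc x r (ℚ.- r)) (trans (cong (x ℚ.+_) (ℚ.+-inverseʳ r)) (ℚ.+-identityʳ x))

^ℚ-mono : ∀ {p q} k → 0ℚ ℚ.≤ p → p ℚ.≤ q → p ^ℚ k ℚ.≤ q ^ℚ k
0≤^ℚ : ∀ {p} k → 0ℚ ℚ.≤ p → 0ℚ ℚ.≤ p ^ℚ k
0≤^ℚ zero    0≤p = toWitness {a? = 0ℚ ℚ.≤? 1ℚ} _
0≤^ℚ (suc k) 0≤p = 0≤* 0≤p (0≤^ℚ k 0≤p)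
^ℚ-mono zero    0≤p p≤q = ℚ.≤-refl
^ℚ-mono (suc k) 0≤p p≤q = *-mono 0≤p (0≤^ℚ k (ℚ.≤-trans 0≤p p≤q)) p≤q (^ℚ-mono k 0≤p p≤q)

inv-inverse : ∀ {q} → 0ℚ ℚ.< q → q ℚ.* inv q ≡ 1ℚ
inv-inverse {q} 0<q with q ℚ.≟ 0ℚ
... | yes refl = ⊥-elim (ℚ.<-irrefl refl 0<q)
... | no q≢0   = ℚ.*-inverseʳ q {{ℚ.≢-nonZero q≢0}}

0≤inv : ∀ {q} → 0ℚ ℚ.< q → 0ℚ ℚ.≤ inv q
0≤inv {q} 0<q = ℚ.*-cancelˡ-≤-pos q {{ℚ.positive 0<q}} (ℚ.≤-trans (ℚ.≤-reflexive (ℚ.*-zeroʳ q))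
  (ℚ.≤-trans (toWitness {a? = 0ℚ ℚ.≤? 1ℚ} _) (ℚ.≤-reflexive (sym (inv-inverse 0<q)))))

1≤*inv : ∀ {p q} → 0ℚ ℚ.< q → q ℚ.≤ p → 1ℚ ℚ.≤ p ℚ.* inv q
1≤*inv 0<q q≤p = ℚ.≤-trans (ℚ.≤-reflexive (sym (inv-inverse 0<q))) (*-monoˡ (0≤inv 0<q) q≤p)

inv-≤ : ∀ {p q} → 0ℚ ℚ.< q → 1ℚ ℚ.≤ q ℚ.* p → inv q ℚ.≤ p
inv-≤ {p} {q} 0<q le = ℚ.*-cancelˡ-≤-pos q {{ℚ.positive 0<q}} (ℚ.≤-trans (ℚ.≤-reflexive (inv-inverse 0<q)) le)

inv-anti : ∀ {p q} → 0ℚ ℚ.< p → p ℚ.≤ q → inv q ℚ.≤ inv p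
inv-anti {p} {q} 0<p p≤q = inv-≤ (ℚ.<-≤-trans 0<p p≤q) (1≤*inv 0<p p≤q)

inv-* : ∀ {p q} → 0ℚ ℚ.< p → 0ℚ ℚ.< q → inv (p ℚ.* q) ≡ inv p ℚ.* inv q
inv-* {p} {q} 0<p 0<q = ℚ.≤-antisym (inv-≤ 0<pq (ℚ.≤-reflexive (sym cancels)))
  (ℚ.*-cancelˡ-≤-pos (p ℚ.* q) {{ℚ.positive 0<pq}} (ℚ.≤-reflexive (trans cancels (sym (inv-inverse 0<pq)))))
  where
  0<pq : 0ℚ ℚ.< p ℚ.* q
  0<pq = ℚ.positive⁻¹ (p ℚ.* q) {{ℚ.pos*pos⇒pos p {{ℚ.positive 0<p}} q {{ℚ.positive 0<q}}}}
  cancels : p ℚ.* q ℚ.* (inv p ℚ.* inv q) ≡ 1ℚ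
  cancels = trans (solve 4 (λ p q r s → p :* q :* (r :* s) := (p :* r) :* (q :* s)) refl p q (inv p) (inv q))
    (trans (cong₂ ℚ._*_ (inv-inverse 0<p) (inv-inverse 0<q)) refl)
    where open ℚ.+-*-Solver

0<⌜suc⌝ : ∀ n → 0ℚ ℚ.< ⌜ suc n ⌝
0<⌜suc⌝ n = ℚ.<-≤-trans (toWitness {a? = 0ℚ ℚ.<? ⌜ 1 ⌝} _) (⌜⌝-mono {1} {suc n} (s≤s z≤n))

-- Reciprocals of odd numbers, and the partial sums of the artanh series

odd⁻¹ : ℕ → ℚ
odd⁻¹ i = + 1 ℚ./ suc (2 * i)

odd⁻¹-inv : ∀ i → odd⁻¹ i ≡ inv ⌜ suc (2 * i) ⌝
odd⁻¹-inv i = ℚ.≤-antisym (cancel (ℚ.≤-reflexive (trans cancels (sym (inv-inverse 0<)))))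
  (cancel (ℚ.≤-reflexive (trans (inv-inverse 0<) (sym cancels))))
  where
  0< = 0<⌜suc⌝ (2 * i)
  cancel : ∀ {p q} → ⌜ suc (2 * i) ⌝ ℚ.* p ℚ.≤ ⌜ suc (2 * i) ⌝ ℚ.* q → p ℚ.≤ q
  cancel = ℚ.*-cancelˡ-≤-pos ⌜ suc (2 * i) ⌝ {{ℚ.positive 0<}}
  cancels : ⌜ suc (2 * i) ⌝ ℚ.* odd⁻¹ i ≡ 1ℚ
  cancels = ℚ.toℚᵘ-injective (ℚᵘ.≃-trans (ℚ.toℚᵘ-homo-* ⌜ suc (2 * i) ⌝ (odd⁻¹ i))
    (ℚᵘ.≃-trans (ℚᵘ.*-cong (ℚ.toℚᵘ-fromℚᵘ (ℚᵘ.mkℚᵘ (+ suc (2 * i)) 0)) (ℚ.toℚᵘ-fromℚᵘ (ℚᵘ.mkℚᵘ (+ 1) (2 * i))))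
      (ℚᵘ.*≡* (cong +_ (solve 1 (λ x → (con 1 :+ x) :* con 1 :* con 1 := con 1 :* (con 1 :* (con 1 :+ x))) refl (2 * i))))))
    where
    open +-*-Solver

0≤odd⁻¹ : ∀ i → 0ℚ ℚ.≤ odd⁻¹ i
0≤odd⁻¹ i = subst (0ℚ ℚ.≤_) (sym (odd⁻¹-inv i)) (0≤inv (0<⌜suc⌝ (2 * i)))

artanh : ℕ → ℚ → ℚ
artanh zero    z = 0ℚ
artanh (suc k) z = artanh k z ℚ.+ z ^ℚ suc (2 * k) ℚ.* odd⁻¹ k

artanh-∑ : ∀ k z → ∑ℚ {k} (λ i → z ^ℚ suc (2 * Fin.toℕ i) ℚ.* odd⁻¹ (Fin.toℕ i)) ≡ artanh k z
artanh-∑ zero    z = refl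
artanh-∑ (suc k) z = trans (∑ᵘ.sum-init-last {k} (λ i → summand (Fin.toℕ i))) (cong₂ ℚ._+_
  (trans (∑ᵘ.sum-cong-≗ {k} λ i → cong summand (Fin.toℕ-inject₁ i)) (artanh-∑ k z)) (cong summand (Fin.toℕ-fromℕ k)))
  where
  summand : ℕ → ℚ
  summand i = z ^ℚ suc (2 * i) ℚ.* odd⁻¹ i

ratio : ℚ → ℚ
ratio q = (q ℚ.- 1ℚ) ℚ.* inv (q ℚ.+ 1ℚ)

logSum-artanh : ∀ k q → logSum k q ≡ ⌜ 2 ⌝ ℚ.* artanh k (ratio q)
logSum-artanh k q = cong (⌜ 2 ⌝ ℚ.*_) (artanh-∑ k (ratio q))

artanh-mono : ∀ k {z w} → 0ℚ ℚ.≤ z → z ℚ.≤ w → artanh k z ℚ.≤ artanh k w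
artanh-mono zero    0≤z z≤w = ℚ.≤-refl
artanh-mono (suc k) 0≤z z≤w = ℚ.+-mono-≤ (artanh-mono k 0≤z z≤w) (*-monoˡ (0≤odd⁻¹ k) (^ℚ-mono (suc (2 * k)) 0≤z z≤w))

artanh-monoˡ : ∀ {k k′ z} → 0ℚ ℚ.≤ z → k ≤ k′ → artanh k z ℚ.≤ artanh k′ z
artanh-monoˡ {k} {k′} {z} 0≤z k≤k′ = subst (λ j → artanh k z ℚ.≤ artanh j z) (ℕ.m+[n∸m]≡n k≤k′) (go (k′ ∸ k))
  where
  go : ∀ j → artanh k z ℚ.≤ artanh (k + j) z
  go zero    = ℚ.≤-reflexive (cong (λ j → artanh j z) (sym (ℕ.+-identityʳ k)))
  go (suc j) = ℚ.≤-trans (go j) (ℚ.≤-trans (p≤p+q (0≤* (0≤^ℚ (suc (2 * (k + j))) 0≤z) (0≤odd⁻¹ (k + j))))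
    (ℚ.≤-reflexive (cong (λ j → artanh j z) (sym (ℕ.+-suc k j)))))

1-ratio : ∀ {q} → 0ℚ ℚ.< q ℚ.+ 1ℚ → ratio q ℚ.+ ⌜ 2 ⌝ ℚ.* inv (q ℚ.+ 1ℚ) ≡ 1ℚ
1-ratio {q} 0< = trans (solve 2 (λ q i → (q :- con 1ℚ) :* i :+ con ⌜ 2 ⌝ :* i := (q :+ con 1ℚ) :* i) refl q (inv (q ℚ.+ 1ℚ))) (inv-inverse 0<)
  where open ℚ.+-*-Solver

0<q+1 : ∀ {q} → 0ℚ ℚ.≤ q → 0ℚ ℚ.< q ℚ.+ 1ℚ
0<q+1 0≤q = ℚ.<-≤-trans (toWitness {a? = 0ℚ ℚ.<? 0ℚ ℚ.+ 1ℚ} _) (ℚ.+-monoˡ-≤ 1ℚ 0≤q)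

ratio-mono : ∀ {p q} → 0ℚ ℚ.≤ p → p ℚ.≤ q → ratio p ℚ.≤ ratio q
ratio-mono {p} {q} 0≤p p≤q = +-cancelʳ-≤ (⌜ 2 ⌝ ℚ.* inv (p ℚ.+ 1ℚ)) (begin
  ratio p ℚ.+ ⌜ 2 ⌝ ℚ.* inv (p ℚ.+ 1ℚ)  ≡⟨ 1-ratio {p} (0<q+1 0≤p) ⟩
  1ℚ                                    ≡⟨ 1-ratio {q} (0<q+1 (ℚ.≤-trans 0≤p p≤q)) ⟨
  ratio q ℚ.+ ⌜ 2 ⌝ ℚ.* inv (q ℚ.+ 1ℚ)  ≤⟨ ℚ.+-monoʳ-≤ (ratio q) (*-monoʳ (0≤⌜⌝ 2) (inv-anti (0<q+1 0≤p) (ℚ.+-monoˡ-≤ 1ℚ p≤q))) ⟩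
  ratio q ℚ.+ ⌜ 2 ⌝ ℚ.* inv (p ℚ.+ 1ℚ)  ∎)
  where open ℚ.≤-Reasoning

0≤ratio : ∀ {q} → 1ℚ ℚ.≤ q → 0ℚ ℚ.≤ ratio q
0≤ratio {q} 1≤q = ratio-mono {1ℚ} {q} (toWitness {a? = 0ℚ ℚ.≤? 1ℚ} _) 1≤q

logSum-mono : ∀ k {p q} → 1ℚ ℚ.≤ p → p ℚ.≤ q → logSum k p ℚ.≤ logSum k q
logSum-mono k {p} {q} 1≤p p≤q = subst₂ ℚ._≤_ (sym (logSum-artanh k p)) (sym (logSum-artanh k q))
  (*-monoʳ (0≤⌜⌝ 2) (artanh-mono k (0≤ratio 1≤p) (ratio-mono (ℚ.≤-trans (toWitness {a? = 0ℚ ℚ.≤? 1ℚ} _) 1≤p) p≤q)))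

logSum-≥ : ∀ {k} k₀ {q} q₀ → 1ℚ ℚ.≤ q₀ → k₀ ≤ k → q₀ ℚ.≤ q → logSum k₀ q₀ ℚ.≤ logSum k q
logSum-≥ {k} k₀ {q} q₀ 1≤q₀ k₀≤k q₀≤q = ℚ.≤-trans (logSum-mono k₀ 1≤q₀ q₀≤q)
  (subst₂ ℚ._≤_ (sym (logSum-artanh k₀ q)) (sym (logSum-artanh k q))
    (*-monoʳ (0≤⌜⌝ 2) (artanh-monoˡ (0≤ratio (ℚ.≤-trans 1≤q₀ q₀≤q)) k₀≤k)))

log-3 : ∀ {k q} → 2 ≤ k → (+ 29 ℚ./ 10) ℚ.≤ q → (+ 21 ℚ./ 20) ℚ.≤ logSum k q
log-3 2≤k le = ℚ.≤-trans (toWitness {a? = (+ 21 ℚ./ 20) ℚ.≤? logSum 2 (+ 29 ℚ./ 10)} _)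
  (logSum-≥ 2 (+ 29 ℚ./ 10) (toWitness {a? = 1ℚ ℚ.≤? + 29 ℚ./ 10} _) 2≤k le)

loglog-3 : ∀ {k q} → 1 ≤ k → (+ 21 ℚ./ 20) ℚ.≤ q → (+ 2 ℚ./ 41) ℚ.≤ logSum k q
loglog-3 1≤k le = ℚ.≤-trans (toWitness {a? = (+ 2 ℚ./ 41) ℚ.≤? logSum 1 (+ 21 ℚ./ 20)} _)
  (logSum-≥ 1 (+ 21 ℚ./ 20) (toWitness {a? = 1ℚ ℚ.≤? + 21 ℚ./ 20} _) 1≤k le)

log-2 : ∀ {k q} → 1 ≤ k → (+ 19 ℚ./ 10) ℚ.≤ q → 0ℚ ℚ.< logSum k q
log-2 1≤k le = ℚ.<-≤-trans (toWitness {a? = 0ℚ ℚ.<? logSum 1 (+ 19 ℚ./ 10)} _)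
  (logSum-≥ 1 (+ 19 ℚ./ 10) (toWitness {a? = 1ℚ ℚ.≤? + 19 ℚ./ 10} _) 1≤k le)

0≤1 : 0ℚ ℚ.≤ 1ℚ
0≤1 = toWitness {a? = 0ℚ ℚ.≤? 1ℚ} _

oddHarmonic : ℕ → ℚ
oddHarmonic zero    = 0ℚ
oddHarmonic (suc k) = oddHarmonic k ℚ.+ odd⁻¹ k

odd⁻¹-anti : ∀ {i j} → i ≤ j → odd⁻¹ j ℚ.≤ odd⁻¹ i
odd⁻¹-anti {i} {j} i≤j = subst₂ ℚ._≤_ (sym (odd⁻¹-inv j)) (sym (odd⁻¹-inv i))
  (inv-anti (0<⌜suc⌝ (2 * i)) (⌜⌝-mono (s≤s (ℕ.*-monoʳ-≤ 2 i≤j))))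

1≤*odd⁻¹ : ∀ {a i} → suc (2 * i) ≤ a → 1ℚ ℚ.≤ ⌜ a ⌝ ℚ.* odd⁻¹ i
1≤*odd⁻¹ {a} {i} le = ℚ.≤-trans (1≤*inv (0<⌜suc⌝ (2 * i)) (⌜⌝-mono le)) (ℚ.≤-reflexive (cong (⌜ a ⌝ ℚ.*_) (sym (odd⁻¹-inv i))))

*odd⁻¹≤1 : ∀ {a i} → a ≤ suc (2 * i) → ⌜ a ⌝ ℚ.* odd⁻¹ i ℚ.≤ 1ℚ
*odd⁻¹≤1 {a} {i} le = ℚ.≤-trans (*-monoˡ (0≤odd⁻¹ i) (⌜⌝-mono le))
  (ℚ.≤-reflexive (trans (cong (⌜ suc (2 * i) ⌝ ℚ.*_) (odd⁻¹-inv i)) (inv-inverse (0<⌜suc⌝ (2 * i)))))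

⌜suc⌝ : ∀ n → ⌜ suc n ⌝ ≡ 1ℚ ℚ.+ ⌜ n ⌝
⌜suc⌝ n = ⌜⌝-+ 1 n

block-≥ : ∀ a b {c} → (∀ i → a + i < a + b → c ℚ.≤ odd⁻¹ (a + i)) → oddHarmonic a ℚ.+ ⌜ b ⌝ ℚ.* c ℚ.≤ oddHarmonic (a + b)
block-≥ a zero    {c} le = ℚ.≤-reflexive (trans (cong (oddHarmonic a ℚ.+_) (ℚ.*-zeroˡ c)) (trans (ℚ.+-identityʳ _) (cong oddHarmonic (sym (ℕ.+-identityʳ a)))))
block-≥ a (suc b) {c} le = begin
  oddHarmonic a ℚ.+ ⌜ suc b ⌝ ℚ.* c              ≡⟨ cong (λ z → oddHarmonic a ℚ.+ z ℚ.* c) (⌜suc⌝ b) ⟩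
  oddHarmonic a ℚ.+ (1ℚ ℚ.+ ⌜ b ⌝) ℚ.* c         ≡⟨ solve 3 (λ h b c → h :+ (con 1ℚ :+ b) :* c := h :+ b :* c :+ c) refl (oddHarmonic a) ⌜ b ⌝ c ⟩
  oddHarmonic a ℚ.+ ⌜ b ⌝ ℚ.* c ℚ.+ c            ≤⟨ ℚ.+-mono-≤ (block-≥ a b λ i i< → le i (ℕ.≤-trans i< (ℕ.+-monoʳ-≤ a (ℕ.n≤1+n b)))) (le b (ℕ.+-monoʳ-< a (ℕ.n<1+n b))) ⟩
  oddHarmonic (a + b) ℚ.+ odd⁻¹ (a + b)          ≡⟨ cong oddHarmonic (ℕ.+-suc a b) ⟨
  oddHarmonic (a + suc b)                        ∎
  where
  open ℚ.≤-Reasoning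
  open ℚ.+-*-Solver

block-≤ : ∀ a b → oddHarmonic (a + b) ℚ.≤ oddHarmonic a ℚ.+ ⌜ b ⌝ ℚ.* odd⁻¹ a
block-≤ a zero    = ℚ.≤-reflexive (sym (trans (cong (oddHarmonic a ℚ.+_) (ℚ.*-zeroˡ (odd⁻¹ a))) (trans (ℚ.+-identityʳ _) (cong oddHarmonic (sym (ℕ.+-identityʳ a))))))
block-≤ a (suc b) = begin
  oddHarmonic (a + suc b)                        ≡⟨ cong oddHarmonic (ℕ.+-suc a b) ⟩
  oddHarmonic (a + b) ℚ.+ odd⁻¹ (a + b)          ≤⟨ ℚ.+-mono-≤ (block-≤ a b) (odd⁻¹-anti (ℕ.m≤m+n a b)) ⟩
  oddHarmonic a ℚ.+ ⌜ b ⌝ ℚ.* odd⁻¹ a ℚ.+ odd⁻¹ a ≡⟨ solve 3 (λ h b c → h :+ (con 1ℚ :+ b) :* c := h :+ b :* c :+ c) refl (oddHarmonic a) ⌜ b ⌝ (odd⁻¹ a) ⟨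
  oddHarmonic a ℚ.+ (1ℚ ℚ.+ ⌜ b ⌝) ℚ.* odd⁻¹ a   ≡⟨ cong (λ z → oddHarmonic a ℚ.+ z ℚ.* odd⁻¹ a) (⌜suc⌝ b) ⟨
  oddHarmonic a ℚ.+ ⌜ suc b ⌝ ℚ.* odd⁻¹ a        ∎
  where
  open ℚ.≤-Reasoning
  open ℚ.+-*-Solver

2^suc : ∀ t → 2 ^ suc t ≡ 2 ^ t + 2 ^ t
2^suc t = cong (_+_ (2 ^ t)) (ℕ.+-identityʳ (2 ^ t))

oddHarmonic-≥ : ∀ t → ⌜ t ⌝ ℚ.≤ ⌜ 5 ⌝ ℚ.* oddHarmonic (2 ^ t)
oddHarmonic-≥ zero    = toWitness {a? = ⌜ 0 ⌝ ℚ.≤? ⌜ 5 ⌝ ℚ.* oddHarmonic 1} _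
oddHarmonic-≥ (suc t) = begin
  ⌜ suc t ⌝                                                 ≡⟨ trans (⌜suc⌝ t) (ℚ.+-comm 1ℚ ⌜ t ⌝) ⟩
  ⌜ t ⌝ ℚ.+ 1ℚ                                              ≤⟨ ℚ.+-mono-≤ (oddHarmonic-≥ t) (1≤*odd⁻¹ {5 * x} {x + x} five) ⟩
  ⌜ 5 ⌝ ℚ.* oddHarmonic x ℚ.+ ⌜ 5 * x ⌝ ℚ.* odd⁻¹ (x + x)   ≡⟨ cong (λ z → ⌜ 5 ⌝ ℚ.* oddHarmonic x ℚ.+ z ℚ.* odd⁻¹ (x + x)) (⌜⌝-* 5 x) ⟩
  ⌜ 5 ⌝ ℚ.* oddHarmonic x ℚ.+ ⌜ 5 ⌝ ℚ.* ⌜ x ⌝ ℚ.* odd⁻¹ (x + x) ≡⟨ factor ⌜ 5 ⌝ (oddHarmonic x) ⌜ x ⌝ (odd⁻¹ (x + x)) ⟩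
  ⌜ 5 ⌝ ℚ.* (oddHarmonic x ℚ.+ ⌜ x ⌝ ℚ.* odd⁻¹ (x + x))     ≤⟨ *-monoʳ (0≤⌜⌝ 5) (block-≥ x x λ i i< → odd⁻¹-anti (ℕ.<⇒≤ i<)) ⟩
  ⌜ 5 ⌝ ℚ.* oddHarmonic (x + x)                             ≡⟨ cong (λ z → ⌜ 5 ⌝ ℚ.* oddHarmonic z) (2^suc t) ⟨
  ⌜ 5 ⌝ ℚ.* oddHarmonic (2 ^ suc t)                         ∎
  where
  open ℚ.≤-Reasoning
  x = 2 ^ t
  factor : ∀ a b c d → a ℚ.* b ℚ.+ a ℚ.* c ℚ.* d ≡ a ℚ.* (b ℚ.+ c ℚ.* d)
  factor = solve 4 (λ a b c d → a :* b :+ a :* c :* d := a :* (b :+ c :* d)) refl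
    where open ℚ.+-*-Solver
  five : suc (2 * (x + x)) ≤ 5 * x
  five = ℕ.≤-trans (ℕ.+-monoˡ-≤ (2 * (x + x)) (1≤2^ t)) (ℕ.≤-reflexive (solve 1 (λ x → x :+ con 2 :* (x :+ x) := con 5 :* x) refl x))
    where
    open +-*-Solver

oddHarmonic-≤ : ∀ t → oddHarmonic (2 ^ t) ℚ.≤ ⌜ suc t ⌝
oddHarmonic-≤ zero    = toWitness {a? = oddHarmonic 1 ℚ.≤? ⌜ 1 ⌝} _
oddHarmonic-≤ (suc t) = begin
  oddHarmonic (2 ^ suc t)                 ≡⟨ cong oddHarmonic (2^suc t) ⟩
  oddHarmonic (x + x)                     ≤⟨ block-≤ x x ⟩
  oddHarmonic x ℚ.+ ⌜ x ⌝ ℚ.* odd⁻¹ x     ≤⟨ ℚ.+-mono-≤ (oddHarmonic-≤ t) (*odd⁻¹≤1 {x} {x} (ℕ.m≤n⇒m≤1+n (ℕ.m≤n*m x 2))) ⟩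
  ⌜ suc t ⌝ ℚ.+ 1ℚ                        ≡⟨ trans (⌜suc⌝ (suc t)) (ℚ.+-comm 1ℚ ⌜ suc t ⌝) ⟨
  ⌜ suc (suc t) ⌝                         ∎
  where
  open ℚ.≤-Reasoning
  x = 2 ^ t

bernoulli : ∀ {z y} m → 0ℚ ℚ.≤ z → z ℚ.+ y ≡ 1ℚ → 1ℚ ℚ.≤ z ^ℚ m ℚ.+ ⌜ m ⌝ ℚ.* y
bernoulli {z} {y} zero    0≤z e = ℚ.≤-reflexive (sym (trans (cong (1ℚ ℚ.+_) (ℚ.*-zeroˡ y)) (ℚ.+-identityʳ 1ℚ)))
bernoulli {z} {y} (suc m) 0≤z e = begin
  1ℚ                                                  ≡⟨ e ⟨
  z ℚ.+ y                                             ≤⟨ p≤p+q (0≤* (0≤⌜⌝ m) square) ⟩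
  z ℚ.+ y ℚ.+ ⌜ m ⌝ ℚ.* (y ℚ.* y)                     ≡⟨ cong (λ w → w ℚ.+ y ℚ.+ ⌜ m ⌝ ℚ.* (y ℚ.* y)) (ℚ.*-identityʳ z) ⟨
  z ℚ.* 1ℚ ℚ.+ y ℚ.+ ⌜ m ⌝ ℚ.* (y ℚ.* y)              ≤⟨ ℚ.+-monoˡ-≤ _ (ℚ.+-monoˡ-≤ y (*-monoʳ 0≤z (bernoulli m 0≤z e))) ⟩
  z ℚ.* (z ^ℚ m ℚ.+ ⌜ m ⌝ ℚ.* y) ℚ.+ y ℚ.+ ⌜ m ⌝ ℚ.* (y ℚ.* y)
    ≡⟨ solve 4 (λ z w m y → z :* (w :+ m :* y) :+ y :+ m :* (y :* y) := z :* w :+ (m :* y :* (z :+ y) :+ y)) refl z (z ^ℚ m) ⌜ m ⌝ y ⟩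
  z ^ℚ suc m ℚ.+ (⌜ m ⌝ ℚ.* y ℚ.* (z ℚ.+ y) ℚ.+ y)    ≡⟨ cong (λ s → z ^ℚ suc m ℚ.+ (⌜ m ⌝ ℚ.* y ℚ.* s ℚ.+ y)) e ⟩
  z ^ℚ suc m ℚ.+ (⌜ m ⌝ ℚ.* y ℚ.* 1ℚ ℚ.+ y)           ≡⟨ cong (z ^ℚ suc m ℚ.+_) (solve 2 (λ m y → m :* y :* con 1ℚ :+ y := (con 1ℚ :+ m) :* y) refl ⌜ m ⌝ y) ⟩
  z ^ℚ suc m ℚ.+ (1ℚ ℚ.+ ⌜ m ⌝) ℚ.* y                 ≡⟨ cong (λ s → z ^ℚ suc m ℚ.+ s ℚ.* y) (⌜suc⌝ m) ⟨
  z ^ℚ suc m ℚ.+ ⌜ suc m ⌝ ℚ.* y                      ∎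
  where
  open ℚ.≤-Reasoning
  open ℚ.+-*-Solver
  square : 0ℚ ℚ.≤ y ℚ.* y
  square with ℚ.≤-total 0ℚ y
  ... | inj₁ 0≤y = 0≤* 0≤y 0≤y
  ... | inj₂ y≤0 = ℚ.≤-trans (0≤* 0≤-y 0≤-y) (ℚ.≤-reflexive (solve 1 (λ y → :- y :* :- y := y :* y) refl y))
    where
    0≤-y : 0ℚ ℚ.≤ ℚ.- y
    0≤-y = ℚ.neg-antimono-≤ y≤0

module _ {q : ℚ} (1≤q : 1ℚ ℚ.≤ q) where
  private
    z = ratio q
    y = ⌜ 2 ⌝ ℚ.* inv (q ℚ.+ 1ℚ)
    0<q+1′ : 0ℚ ℚ.< q ℚ.+ 1ℚ
    0<q+1′ = 0<q+1 (ℚ.≤-trans 0≤1 1≤q)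
    0≤z : 0ℚ ℚ.≤ z
    0≤z = 0≤ratio 1≤q
    z+y : z ℚ.+ y ≡ 1ℚ
    z+y = 1-ratio {q} 0<q+1′
    0≤y : 0ℚ ℚ.≤ y
    0≤y = 0≤* (0≤⌜⌝ 2) (0≤inv 0<q+1′)
    z≤1 : z ℚ.≤ 1ℚ
    z≤1 = ℚ.≤-trans (p≤p+q 0≤y) (ℚ.≤-reflexive z+y)

  -- For i < 2ᵗ and q ≥ 2ᵗ⁺³ the powers z²ⁱ⁺¹ in the series are at least 1/2.
  log-lower : ∀ {k} t → 2 ^ t ≤ k → ⌜ 2 ^ (3 + t) ⌝ ℚ.≤ q → ⌜ t ⌝ ℚ.≤ ⌜ 5 ⌝ ℚ.* logSum k q
  log-lower {k} t 2^t≤k ≤q = ℚ.≤-trans (oddHarmonic-≥ t) (*-monoʳ (0≤⌜⌝ 5) (ℚ.≤-trans (go (2 ^ t) ℕ.≤-refl)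
    (ℚ.≤-trans (*-monoʳ (0≤⌜⌝ 2) (artanh-monoˡ 0≤z 2^t≤k)) (ℚ.≤-reflexive (sym (logSum-artanh k q))))))
    where
    open ℚ.≤-Reasoning
    open ℚ.+-*-Solver
    half : ∀ {m} → m ≤ 2 ^ suc t → 1ℚ ℚ.≤ ⌜ 2 ⌝ ℚ.* z ^ℚ m
    half {m} m≤ = +-cancelʳ-≤ 1ℚ (begin
      1ℚ ℚ.+ 1ℚ                                        ≡⟨⟩
      ⌜ 2 ⌝ ℚ.* 1ℚ                                     ≤⟨ *-monoʳ (0≤⌜⌝ 2) (bernoulli m 0≤z z+y) ⟩
      ⌜ 2 ⌝ ℚ.* (z ^ℚ m ℚ.+ ⌜ m ⌝ ℚ.* y)               ≡⟨ solve 3 (λ w m i → con ⌜ 2 ⌝ :* (w :+ m :* (con ⌜ 2 ⌝ :* i)) := con ⌜ 2 ⌝ :* w :+ con ⌜ 4 ⌝ :* m :* i) refl (z ^ℚ m) ⌜ m ⌝ (inv (q ℚ.+ 1ℚ)) ⟩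
      ⌜ 2 ⌝ ℚ.* z ^ℚ m ℚ.+ ⌜ 4 ⌝ ℚ.* ⌜ m ⌝ ℚ.* inv (q ℚ.+ 1ℚ)
        ≤⟨ ℚ.+-monoʳ-≤ (⌜ 2 ⌝ ℚ.* z ^ℚ m) (ℚ.≤-trans (*-monoˡ (0≤inv 0<q+1′) 4m≤) (ℚ.≤-reflexive (inv-inverse 0<q+1′))) ⟩
      ⌜ 2 ⌝ ℚ.* z ^ℚ m ℚ.+ 1ℚ                          ∎)
      where
      4m≤ : ⌜ 4 ⌝ ℚ.* ⌜ m ⌝ ℚ.≤ q ℚ.+ 1ℚ
      4m≤ = begin
        ⌜ 4 ⌝ ℚ.* ⌜ m ⌝        ≡⟨ ⌜⌝-* 4 m ⟨
        ⌜ 4 * m ⌝              ≤⟨ ⌜⌝-mono (ℕ.≤-trans (ℕ.*-monoʳ-≤ 4 m≤) (ℕ.≤-reflexive (ℕ.*-assoc 2 2 (2 ^ suc t)))) ⟩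
        ⌜ 2 ^ (3 + t) ⌝        ≤⟨ ≤q ⟩
        q                      ≤⟨ p≤p+q 0≤1 ⟩
        q ℚ.+ 1ℚ               ∎
    go : ∀ j → j ≤ 2 ^ t → oddHarmonic j ℚ.≤ ⌜ 2 ⌝ ℚ.* artanh j z
    go zero    j≤ = ℚ.≤-reflexive (sym (ℚ.*-zeroʳ ⌜ 2 ⌝))
    go (suc j) j≤ = begin
      oddHarmonic j ℚ.+ odd⁻¹ j                                   ≡⟨ cong (oddHarmonic j ℚ.+_) (ℚ.*-identityˡ (odd⁻¹ j)) ⟨
      oddHarmonic j ℚ.+ 1ℚ ℚ.* odd⁻¹ j                            ≤⟨ ℚ.+-mono-≤ (go j (ℕ.<⇒≤ j≤)) (*-monoˡ (0≤odd⁻¹ j) (half {suc (2 * j)} m≤)) ⟩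
      ⌜ 2 ⌝ ℚ.* artanh j z ℚ.+ ⌜ 2 ⌝ ℚ.* z ^ℚ suc (2 * j) ℚ.* odd⁻¹ j ≡⟨ solve 4 (λ a b c d → a :* b :+ a :* c :* d := a :* (b :+ c :* d)) refl ⌜ 2 ⌝ (artanh j z) (z ^ℚ suc (2 * j)) (odd⁻¹ j) ⟩
      ⌜ 2 ⌝ ℚ.* artanh (suc j) z                                  ∎
      where
      m≤ : suc (2 * j) ≤ 2 ^ suc t
      m≤ = ℕ.≤-trans (ℕ.n≤1+n _) (ℕ.≤-trans (ℕ.≤-reflexive (sym (ℕ.*-suc 2 j))) (ℕ.*-monoʳ-≤ 2 j≤))

  -- The first 2ᵗ terms are at most a harmonic sum, the others are dominated by
  -- a geometric series.
  log-upper : ∀ k t → q ℚ.≤ ⌜ 2 ^ suc t ⌝ → logSum k q ℚ.≤ ⌜ 2 * (2 + t) ⌝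
  log-upper k t q≤ = begin
    logSum k q                       ≡⟨ logSum-artanh k q ⟩
    ⌜ 2 ⌝ ℚ.* artanh k z             ≤⟨ *-monoʳ (0≤⌜⌝ 2) (ℚ.≤-trans (artanh-monoˡ 0≤z (ℕ.m≤n+m k x)) (tail k)) ⟩
    ⌜ 2 ⌝ ℚ.* (oddHarmonic x ℚ.+ odd⁻¹ x ℚ.* G k) ≤⟨ *-monoʳ (0≤⌜⌝ 2) (ℚ.+-mono-≤ (oddHarmonic-≤ t) (ℚ.≤-trans (*-monoˡ (0≤G k) odd⁻¹≤y) (yG≤1 k))) ⟩
    ⌜ 2 ⌝ ℚ.* (⌜ suc t ⌝ ℚ.+ 1ℚ)     ≡⟨ cong (⌜ 2 ⌝ ℚ.*_) (trans (⌜suc⌝ (suc t)) (ℚ.+-comm 1ℚ ⌜ suc t ⌝)) ⟨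
    ⌜ 2 ⌝ ℚ.* ⌜ 2 + t ⌝              ≡⟨ ⌜⌝-* 2 (2 + t) ⟨
    ⌜ 2 * (2 + t) ⌝                  ∎
    where
    open ℚ.≤-Reasoning
    open ℚ.+-*-Solver
    x = 2 ^ t
    G : ℕ → ℚ
    G zero    = 0ℚ
    G (suc j) = G j ℚ.+ z ^ℚ j
    0≤G : ∀ j → 0ℚ ℚ.≤ G j
    0≤G zero    = ℚ.≤-refl
    0≤G (suc j) = 0≤+ (0≤G j) (0≤^ℚ j 0≤z)
    yG : ∀ j → y ℚ.* G j ℚ.+ z ^ℚ j ≡ 1ℚ
    yG zero    = trans (cong (ℚ._+ 1ℚ) (ℚ.*-zeroʳ y)) (ℚ.+-identityˡ 1ℚ)
    yG (suc j) = trans (solve 4 (λ y g w z → y :* (g :+ w) :+ z :* w := y :* g :+ (z :+ y) :* w) refl y (G j) (z ^ℚ j) z)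
      (trans (cong (λ s → y ℚ.* G j ℚ.+ s ℚ.* z ^ℚ j) z+y) (trans (cong (y ℚ.* G j ℚ.+_) (ℚ.*-identityˡ _)) (yG j)))
    yG≤1 : ∀ j → y ℚ.* G j ℚ.≤ 1ℚ
    yG≤1 j = ℚ.≤-trans (p≤p+q (0≤^ℚ j 0≤z)) (ℚ.≤-reflexive (yG j))
    odd⁻¹≤y : odd⁻¹ x ℚ.≤ y
    odd⁻¹≤y = subst (ℚ._≤ y) (sym (odd⁻¹-inv x)) (inv-≤ (0<⌜suc⌝ (2 * x)) (begin
      1ℚ                                              ≤⟨ 1≤*inv 0<q+1′ q+1≤ ⟩
      ⌜ 2 * suc (2 * x) ⌝ ℚ.* inv (q ℚ.+ 1ℚ)          ≡⟨ cong (ℚ._* inv (q ℚ.+ 1ℚ)) (⌜⌝-* 2 (suc (2 * x))) ⟩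
      ⌜ 2 ⌝ ℚ.* ⌜ suc (2 * x) ⌝ ℚ.* inv (q ℚ.+ 1ℚ)    ≡⟨ solve 3 (λ a b c → a :* b :* c := b :* (a :* c)) refl ⌜ 2 ⌝ ⌜ suc (2 * x) ⌝ (inv (q ℚ.+ 1ℚ)) ⟩
      ⌜ suc (2 * x) ⌝ ℚ.* y                           ∎))
      where
      q+1≤ : q ℚ.+ 1ℚ ℚ.≤ ⌜ 2 * suc (2 * x) ⌝
      q+1≤ = ℚ.≤-trans (ℚ.+-monoˡ-≤ 1ℚ q≤) (ℚ.≤-trans (ℚ.≤-reflexive (sym (⌜⌝-+ (2 ^ suc t) 1)))
        (⌜⌝-mono (ℕ.≤-trans (ℕ.≤-reflexive (ℕ.+-comm (2 * x) 1)) (ℕ.m≤n*m (suc (2 * x)) 2))))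
    power-≤1 : ∀ i → z ^ℚ i ℚ.≤ 1ℚ
    power-≤1 zero    = ℚ.≤-refl
    power-≤1 (suc i) = ℚ.≤-trans (*-mono 0≤z 0≤1 z≤1 (power-≤1 i)) (ℚ.≤-reflexive (ℚ.*-identityʳ 1ℚ))
    power-anti : ∀ {i j} → j ≤ i → z ^ℚ i ℚ.≤ z ^ℚ j
    power-anti {i} {j} j≤i = begin
      z ^ℚ i                        ≡⟨ cong (z ^ℚ_) (ℕ.m+[n∸m]≡n j≤i) ⟨
      z ^ℚ (j + (i ∸ j))            ≡⟨ ^ℚ-homo-* z j (i ∸ j) ⟩
      z ^ℚ j ℚ.* z ^ℚ (i ∸ j)       ≤⟨ *-monoʳ (0≤^ℚ j 0≤z) (power-≤1 (i ∸ j)) ⟩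
      z ^ℚ j ℚ.* 1ℚ                 ≡⟨ ℚ.*-identityʳ _ ⟩
      z ^ℚ j                        ∎
    first : ∀ j → artanh j z ℚ.≤ oddHarmonic j
    first zero    = ℚ.≤-refl
    first (suc j) = ℚ.+-mono-≤ (first j) (ℚ.≤-trans (*-monoˡ (0≤odd⁻¹ j) (power-≤1 (suc (2 * j)))) (ℚ.≤-reflexive (ℚ.*-identityˡ (odd⁻¹ j))))
    tail : ∀ j → artanh (x + j) z ℚ.≤ oddHarmonic x ℚ.+ odd⁻¹ x ℚ.* G j
    tail zero    = ℚ.≤-trans (ℚ.≤-reflexive (cong (λ i → artanh i z) (ℕ.+-identityʳ x))) (ℚ.≤-trans (first x)
      (ℚ.≤-reflexive (sym (trans (cong (oddHarmonic x ℚ.+_) (ℚ.*-zeroʳ (odd⁻¹ x))) (ℚ.+-identityʳ _)))))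
    tail (suc j) = begin
      artanh (x + suc j) z                                                     ≡⟨ cong (λ i → artanh i z) (ℕ.+-suc x j) ⟩
      artanh (x + j) z ℚ.+ z ^ℚ suc (2 * (x + j)) ℚ.* odd⁻¹ (x + j)            ≤⟨ ℚ.+-mono-≤ (tail j) (*-mono (0≤^ℚ (suc (2 * (x + j))) 0≤z) (0≤odd⁻¹ x)
                                                                                    (power-anti {suc (2 * (x + j))} {j} j≤) (odd⁻¹-anti (ℕ.m≤m+n x j))) ⟩
      oddHarmonic x ℚ.+ odd⁻¹ x ℚ.* G j ℚ.+ z ^ℚ j ℚ.* odd⁻¹ x                 ≡⟨ solve 4 (λ h o g w → h :+ o :* g :+ w :* o := h :+ o :* (g :+ w)) refl (oddHarmonic x) (odd⁻¹ x) (G j) (z ^ℚ j) ⟩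
      oddHarmonic x ℚ.+ odd⁻¹ x ℚ.* G (suc j)                                  ∎
      where
      j≤ : j ≤ suc (2 * (x + j))
      j≤ = ℕ.≤-trans (ℕ.m≤n+m j x) (ℕ.m≤n⇒m≤1+n (ℕ.m≤n*m (x + j) 2))

ℚ-<⇒≱ : ∀ {p q} → p ℚ.< q → ¬ q ℚ.≤ p
ℚ-<⇒≱ p<q q≤p = ℚ.<-irrefl refl (ℚ.<-≤-trans p<q q≤p)

p≤∣p∣ : ∀ p → p ℚ.≤ ℚ.∣ p ∣
p≤∣p∣ p with ℚ.≤-total 0ℚ p
... | inj₁ 0≤p = ℚ.≤-reflexive (sym (ℚ.0≤p⇒∣p∣≡p 0≤p))
... | inj₂ p≤0 = ℚ.≤-trans p≤0 (ℚ.0≤∣p∣ p)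

floor-≥0 : ∀ q → 0ℚ ℚ.≤ q → ∃[ M ] ⌜ M ⌝ ℚ.≤ q × q ℚ.< ⌜ suc M ⌝
floor-≥0 q 0≤q = search (suc ℤ.∣ ℚ.↥ q ∣) (ℚ.≤-<-trans q≤ (ℚ.<-≤-trans (ℚ.≤-<-trans (ℚ.≤-reflexive (sym (ℚ.+-identityˡ _)))
    (ℚ.+-monoˡ-< ⌜ ℤ.∣ ℚ.↥ q ∣ ⌝ (toWitness {a? = 0ℚ ℚ.<? 1ℚ} _))) (ℚ.≤-reflexive (sym (⌜suc⌝ ℤ.∣ ℚ.↥ q ∣)))))
  where
  open ℚ.≤-Reasoning
  search : ∀ n → q ℚ.< ⌜ n ⌝ → ∃[ M ] ⌜ M ⌝ ℚ.≤ q × q ℚ.< ⌜ suc M ⌝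
  search zero    q< = ⊥-elim (ℚ-<⇒≱ q< 0≤q)
  search (suc n) q< with ⌜ n ⌝ ℚ.≤? q
  ... | yes n≤ = n , n≤ , q<
  ... | no n≰  = search n (ℚ.≰⇒> n≰)
  ↧q*q : ⌜ suc (ℚ.denominator-1 q) ⌝ ℚ.* q ≡ (ℚ.↥ q) /1
  ↧q*q = ↧/1-* q
  0≤↥ : 0ℤ ℤ.≤ ℚ.↥ q
  0≤↥ = /1-cancel-≤ (ℚ.≤-trans (0≤* (0≤⌜⌝ (suc (ℚ.denominator-1 q))) 0≤q) (ℚ.≤-reflexive ↧q*q))
  q≤ : q ℚ.≤ ⌜ ℤ.∣ ℚ.↥ q ∣ ⌝
  q≤ = begin
    q                                             ≡⟨ ℚ.*-identityˡ q ⟨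
    ⌜ 1 ⌝ ℚ.* q                                   ≤⟨ *-monoˡ 0≤q (⌜⌝-mono {1} {suc (ℚ.denominator-1 q)} (s≤s z≤n)) ⟩
    ⌜ suc (ℚ.denominator-1 q) ⌝ ℚ.* q             ≡⟨ ↧q*q ⟩
    (ℚ.↥ q) /1                                    ≡⟨ cong _/1 (ℤ.0≤i⇒+∣i∣≡i 0≤↥) ⟨
    ⌜ ℤ.∣ ℚ.↥ q ∣ ⌝                               ∎

⅒ : ℚ
⅒ = + 1 ℚ./ 10

0<⅒ : 0ℚ ℚ.< ⅒
0<⅒ = toWitness {a? = 0ℚ ℚ.<? ⅒} _

⌜⌝-≤-+⅕ : ∀ {h m x} → ⌜ h ⌝ ℚ.≤ x ℚ.+ ⅒ → x ℚ.≤ ⌜ m ⌝ ℚ.+ ⅒ → h ≤ m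
⌜⌝-≤-+⅕ {h} {m} {x} h≤ x≤ = ℕ.≮⇒≥ λ m<h → ℚ-<⇒≱ (toWitness {a? = (⅒ ℚ.+ ⅒) ℚ.<? 1ℚ} _) (+-cancelʳ-≤ ⌜ m ⌝ (begin
  1ℚ ℚ.+ ⌜ m ⌝               ≡⟨ ⌜suc⌝ m ⟨
  ⌜ suc m ⌝                  ≤⟨ ⌜⌝-mono m<h ⟩
  ⌜ h ⌝                      ≤⟨ h≤ ⟩
  x ℚ.+ ⅒                    ≤⟨ ℚ.+-monoˡ-≤ ⅒ x≤ ⟩
  ⌜ m ⌝ ℚ.+ ⅒ ℚ.+ ⅒          ≡⟨ trans (ℚ.+-assoc ⌜ m ⌝ ⅒ ⅒) (ℚ.+-comm ⌜ m ⌝ _) ⟩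
  (⅒ ℚ.+ ⅒) ℚ.+ ⌜ m ⌝        ∎))
  where
  open ℚ.≤-Reasoning

record Located (x : ℝ) (b : ℕ) : Set where
  field
    M K     : ℕ
    above   : ∀ {k} → K ≤ k → ⌜ M ⌝ ℚ.≤ seq x k ℚ.+ ⅒
    below   : ∀ {k} → K ≤ k → seq x k ℚ.≤ ⌜ suc M ⌝ ℚ.+ ⅒
    minimum : ∀ {k} → K ≤ k → ⌜ suc b ⌝ ℚ.≤ seq x k ℚ.+ ⅒

  ≤-suc-M : ∀ {h} → ι h ≤ℝ seq x → h ≤ suc M
  ≤-suc-M h≤ with h≤ ⅒ 0<⅒
  ... | K′ , le = ⌜⌝-≤-+⅕ (le (K ℕ.⊔ K′) (ℕ.m≤n⊔m K K′)) (below (ℕ.m≤m⊔n K K′))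

  M-≤ : ∀ {p} → seq x ≤ℝ ι p → M ≤ p
  M-≤ ≤p with ≤p ⅒ 0<⅒
  ... | K′ , le = ⌜⌝-≤-+⅕ (above (ℕ.m≤m⊔n K K′)) (le (K ℕ.⊔ K′) (ℕ.m≤n⊔m K K′))

located : ∀ x b → ι (suc b) ≤ℝ seq x → Located x b
located x b b≤x with cauchy x ⅒ 0<⅒ | b≤x ⅒ 0<⅒
... | K₁ , close | K₂ , le = record
  { M = M ; K = K
  ; above   = λ K≤k → ℚ.≤-trans M≤ (near (close K _ K₁≤K (ℕ.≤-trans K₁≤K K≤k)))
  ; below   = λ K≤k → ℚ.≤-trans (near (close _ K (ℕ.≤-trans K₁≤K K≤k) K₁≤K)) (ℚ.+-monoˡ-≤ ⅒ (ℚ.<⇒≤ <M))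
  ; minimum = λ K≤k → le _ (ℕ.≤-trans K₂≤K K≤k) }
  where
  K = K₁ ℕ.⊔ K₂
  K₁≤K = ℕ.m≤m⊔n K₁ K₂
  K₂≤K = ℕ.m≤n⊔m K₁ K₂
  near : ∀ {p q} → ℚ.∣ p ℚ.- q ∣ ℚ.≤ ⅒ → p ℚ.≤ q ℚ.+ ⅒
  near {p} {q} le = ℚ.≤-trans (ℚ.≤-reflexive (solve 2 (λ p q → p := q :+ (p :- q)) refl p q))
    (ℚ.+-monoʳ-≤ q (ℚ.≤-trans (p≤∣p∣ (p ℚ.- q)) le))
    where open ℚ.+-*-Solver
  0≤x : 0ℚ ℚ.≤ seq x K
  0≤x = +-cancelʳ-≤ ⅒ (ℚ.≤-trans (toWitness {a? = 0ℚ ℚ.+ ⅒ ℚ.≤? ⌜ 1 ⌝} _)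
    (ℚ.≤-trans (⌜⌝-mono {1} {suc b} (s≤s z≤n)) (le K K₂≤K)))
  M = floor-≥0 (seq x K) 0≤x .proj₁
  M≤ = floor-≥0 (seq x K) 0≤x .proj₂ .proj₁
  <M = floor-≥0 (seq x K) 0≤x .proj₂ .proj₂

abstract
  locate : ∀ x b → ι (suc b) ≤ℝ seq x → Located x b
  locate = located

log-lower′ : ∀ {k q} j → 1ℚ ℚ.≤ q → 2 ^ j ≤ k → ⌜ 2 ^ j ⌝ ℚ.≤ q → ⌜ j ∸ 3 ⌝ ℚ.≤ ⌜ 5 ⌝ ℚ.* logSum k q
log-lower′ {k} {q} j 1≤q 2^j≤k ≤q with 3 ℕ.≤? j
... | yes 3≤j = log-lower 1≤q (j ∸ 3) (ℕ.≤-trans (ℕ.^-monoʳ-≤ 2 (ℕ.m∸n≤m j 3)) 2^j≤k)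
  (subst (λ i → ⌜ 2 ^ i ⌝ ℚ.≤ q) (sym (ℕ.m+[n∸m]≡n 3≤j)) ≤q)
... | no 3≰j  = ℚ.≤-trans (ℚ.≤-reflexive (cong ⌜_⌝ (ℕ.m≤n⇒m∸n≡0 (ℕ.<⇒≤ (ℕ.≰⇒> 3≰j)))))
  (0≤* (0≤⌜⌝ 5) (logSum-≥ {k} 0 {q} 1ℚ ℚ.≤-refl z≤n 1≤q))

private
  reduce-power : ∀ {x} w → 0ℚ ℚ.< x → w ≡ x ℚ.* (x ℚ.* w) ℚ.* (inv x ℚ.* inv x)
  reduce-power {x} w 0<x = sym (trans (solve 3 (λ x w i → x :* (x :* w) :* (i :* i) := w :* ((x :* i) :* (x :* i))) refl x w (inv x))
    (trans (cong (w ℚ.*_) (trans (cong₂ ℚ._*_ (inv-inverse 0<x) (inv-inverse 0<x)) refl)) (ℚ.*-identityʳ w)))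
    where open ℚ.+-*-Solver
  reduce-inv : ∀ {x} → 0ℚ ℚ.< x → inv (x ℚ.* 1ℚ) ≡ x ℚ.* 1ℚ ℚ.* (inv x ℚ.* inv x)
  reduce-inv {x} 0<x = sym (trans (solve 2 (λ x i → x :* con 1ℚ :* (i :* i) := (x :* i) :* i) refl x (inv x))
    (trans (cong (ℚ._* inv x) (inv-inverse 0<x)) (trans (ℚ.*-identityˡ _) (cong inv (sym (ℚ.*-identityʳ x))))))
    where open ℚ.+-*-Solver

^ℤ-shift₁ : ∀ {x} r → 0ℚ ℚ.< x → x ^ℤ (r ℤ.⊖ 1) ≡ x ^ℚ suc r ℚ.* (inv x ℚ.* inv x)
^ℤ-shift₁ zero          0<x = reduce-inv 0<x
^ℤ-shift₁ {x} (suc r)   0<x = reduce-power (x ^ℚ r) 0<x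

^ℤ-shift₂ : ∀ {x} r → 0ℚ ℚ.< x → x ^ℤ (r ℤ.⊖ 2) ≡ x ^ℚ r ℚ.* (inv x ℚ.* inv x)
^ℤ-shift₂ {x} zero      0<x = trans (cong inv (cong (x ℚ.*_) (ℚ.*-identityʳ x))) (trans (inv-* 0<x 0<x) (sym (ℚ.*-identityˡ _)))
^ℤ-shift₂ (suc zero)    0<x = reduce-inv 0<x
^ℤ-shift₂ {x} (suc (suc r)) 0<x = reduce-power (x ^ℚ r) 0<x

-- The comparison of the integral bound of `mass-target` with the real one:
-- 2ᴸ, L, suc l′ and Q are within constant factors of B, x = log B, z = log x
-- and w = N log N.
compare : ∀ {n C r Q L l′} {B x z w : ℚ} → 1 ≤ Q → 1 ≤ L → 0ℚ ℚ.< x → 0ℚ ℚ.< w → 0ℚ ℚ.≤ B → 0ℚ ℚ.≤ z →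
  ⌜ 2 ^ L ⌝ ℚ.≤ ⌜ 2 ⌝ ℚ.* B → x ℚ.≤ ⌜ 8 ⌝ ℚ.* ⌜ L ⌝ → ⌜ L ⌝ ℚ.≤ ⌜ 9 ⌝ ℚ.* x → ⌜ suc l′ ⌝ ℚ.≤ ⌜ 169 ⌝ ℚ.* z → w ℚ.≤ ⌜ 32 ⌝ ℚ.* ⌜ Q ⌝ →
  n * (Q * (L * L)) ≤ C * (2 ^ L * (L ^ suc r + L ^ r * suc l′ * Q)) →
  ⌜ n ⌝ ℚ.≤ ⌜ C * (21632 * 9 ^ suc r) ⌝ ℚ.* (B ℚ.* x ^ℤ (r ℤ.⊖ 1) ℚ.* inv w ℚ.+ B ℚ.* x ^ℤ (r ℤ.⊖ 2) ℚ.* z)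
compare {n} {C} {r} {Q} {L} {l′} {B} {x} {z} {w} 1≤Q 1≤L 0<x 0<w 0≤B 0≤z 2^L≤ x≤ L≤ l′≤ w≤ count = begin
  ⌜ n ⌝
    ≡⟨ trans (cong (⌜ n ⌝ ℚ.*_) (trans (cong₂ ℚ._*_ (inv-inverse 0<Q) (trans (cong₂ ℚ._*_ (inv-inverse 0<L) (inv-inverse 0<L)) refl)) refl)) (ℚ.*-identityʳ ⌜ n ⌝) ⟨
  ⌜ n ⌝ ℚ.* (⌜ Q ⌝ ℚ.* iQ ℚ.* (⌜ L ⌝ ℚ.* iL ℚ.* (⌜ L ⌝ ℚ.* iL)))
    ≡⟨ solve 5 (λ n Q iQ L iL → n :* (Q :* iQ :* (L :* iL :* (L :* iL))) := n :* (Q :* (L :* L)) :* (iQ :* (iL :* iL))) refl ⌜ n ⌝ ⌜ Q ⌝ iQ ⌜ L ⌝ iL ⟩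
  ⌜ n ⌝ ℚ.* (⌜ Q ⌝ ℚ.* (⌜ L ⌝ ℚ.* ⌜ L ⌝)) ℚ.* (iQ ℚ.* (iL ℚ.* iL))
    ≡⟨ cong (ℚ._* (iQ ℚ.* (iL ℚ.* iL))) (trans (⌜⌝-* n (Q * (L * L))) (cong (⌜ n ⌝ ℚ.*_) (trans (⌜⌝-* Q (L * L)) (cong (⌜ Q ⌝ ℚ.*_) (⌜⌝-* L L))))) ⟨
  ⌜ n * (Q * (L * L)) ⌝ ℚ.* (iQ ℚ.* (iL ℚ.* iL))
    ≤⟨ *-monoˡ (0≤* 0≤iQ (0≤* 0≤iL 0≤iL)) (⌜⌝-mono count) ⟩
  ⌜ C * (2 ^ L * (L ^ suc r + L ^ r * suc l′ * Q)) ⌝ ℚ.* (iQ ℚ.* (iL ℚ.* iL))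
    ≡⟨ cong (ℚ._* (iQ ℚ.* (iL ℚ.* iL))) casts ⟩
  ⌜ C ⌝ ℚ.* (⌜ 2 ^ L ⌝ ℚ.* (ℓ₁ ℚ.+ ℓ₀ ℚ.* ⌜ suc l′ ⌝ ℚ.* ⌜ Q ⌝)) ℚ.* (iQ ℚ.* (iL ℚ.* iL))
    ≡⟨ solve 8 (λ C e p₁ p₀ λ′ Q iQ iL → C :* (e :* (p₁ :+ p₀ :* λ′ :* Q)) :* (iQ :* (iL :* iL)) := C :* (e :* p₁ :* iQ :* (iL :* iL) :+ e :* p₀ :* λ′ :* (iL :* iL) :* (Q :* iQ)))
         refl ⌜ C ⌝ ⌜ 2 ^ L ⌝ ℓ₁ ℓ₀ ⌜ suc l′ ⌝ ⌜ Q ⌝ iQ iL ⟩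
  ⌜ C ⌝ ℚ.* (⌜ 2 ^ L ⌝ ℚ.* ℓ₁ ℚ.* iQ ℚ.* (iL ℚ.* iL) ℚ.+ ⌜ 2 ^ L ⌝ ℚ.* ℓ₀ ℚ.* ⌜ suc l′ ⌝ ℚ.* (iL ℚ.* iL) ℚ.* (⌜ Q ⌝ ℚ.* iQ))
    ≡⟨ cong (λ s → ⌜ C ⌝ ℚ.* (⌜ 2 ^ L ⌝ ℚ.* ℓ₁ ℚ.* iQ ℚ.* (iL ℚ.* iL) ℚ.+ s)) (trans (cong ((⌜ 2 ^ L ⌝ ℚ.* ℓ₀ ℚ.* ⌜ suc l′ ⌝ ℚ.* (iL ℚ.* iL)) ℚ.*_) (inv-inverse 0<Q)) (ℚ.*-identityʳ _)) ⟩
  ⌜ C ⌝ ℚ.* (⌜ 2 ^ L ⌝ ℚ.* ℓ₁ ℚ.* iQ ℚ.* (iL ℚ.* iL) ℚ.+ ⌜ 2 ^ L ⌝ ℚ.* ℓ₀ ℚ.* ⌜ suc l′ ⌝ ℚ.* (iL ℚ.* iL))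
    ≤⟨ *-monoʳ (0≤⌜⌝ C) (ℚ.+-mono-≤
         (*-mono (0≤* (0≤* 0≤2^L 0≤ℓ₁) 0≤iQ) 0≤ii (*-mono (0≤* 0≤2^L 0≤ℓ₁) 0≤32iw (*-mono 0≤2^L (0≤* (0≤⌜⌝ (9 ^ suc r)) (0≤^ℚ (suc r) 0≤x)) 2^L≤ ℓ₁≤) iQ≤) ii≤)
         (*-mono (0≤* (0≤* 0≤2^L 0≤ℓ₀) (0≤⌜⌝ (suc l′))) 0≤ii (*-mono (0≤* 0≤2^L 0≤ℓ₀) (0≤* (0≤⌜⌝ 169) 0≤z) (*-mono 0≤2^L (0≤* (0≤⌜⌝ (9 ^ r)) (0≤^ℚ r 0≤x)) 2^L≤ ℓ₀≤) l′≤) ii≤)) ⟩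
  ⌜ C ⌝ ℚ.* (⌜ 2 ⌝ ℚ.* B ℚ.* (⌜ 9 ^ suc r ⌝ ℚ.* x ^ℚ suc r) ℚ.* (⌜ 32 ⌝ ℚ.* inv w) ℚ.* (⌜ 8 ⌝ ℚ.* ix ℚ.* (⌜ 8 ⌝ ℚ.* ix))
       ℚ.+ ⌜ 2 ⌝ ℚ.* B ℚ.* (⌜ 9 ^ r ⌝ ℚ.* x ^ℚ r) ℚ.* (⌜ 169 ⌝ ℚ.* z) ℚ.* (⌜ 8 ⌝ ℚ.* ix ℚ.* (⌜ 8 ⌝ ℚ.* ix)))
    ≡⟨ cong (⌜ C ⌝ ℚ.*_) (cong₂ ℚ._+_
         (solve 5 (λ B n p iw ix → con ⌜ 2 ⌝ :* B :* (n :* p) :* (con ⌜ 32 ⌝ :* iw) :* (con ⌜ 8 ⌝ :* ix :* (con ⌜ 8 ⌝ :* ix)) := con ⌜ 4096 ⌝ :* n :* (B :* (p :* (ix :* ix)) :* iw))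
            refl B ⌜ 9 ^ suc r ⌝ (x ^ℚ suc r) (inv w) ix)
         (solve 5 (λ B n p z ix → con ⌜ 2 ⌝ :* B :* (n :* p) :* (con ⌜ 169 ⌝ :* z) :* (con ⌜ 8 ⌝ :* ix :* (con ⌜ 8 ⌝ :* ix)) := con ⌜ 21632 ⌝ :* n :* (B :* (p :* (ix :* ix)) :* z))
            refl B ⌜ 9 ^ r ⌝ (x ^ℚ r) z ix)) ⟩
  ⌜ C ⌝ ℚ.* (⌜ 4096 ⌝ ℚ.* ⌜ 9 ^ suc r ⌝ ℚ.* (B ℚ.* (x ^ℚ suc r ℚ.* (ix ℚ.* ix)) ℚ.* inv w)
       ℚ.+ ⌜ 21632 ⌝ ℚ.* ⌜ 9 ^ r ⌝ ℚ.* (B ℚ.* (x ^ℚ r ℚ.* (ix ℚ.* ix)) ℚ.* z))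
    ≤⟨ *-monoʳ (0≤⌜⌝ C) (ℚ.+-mono-≤
         (*-monoˡ (0≤* (0≤* 0≤B (0≤* (0≤^ℚ (suc r) 0≤x) (0≤* 0≤ix 0≤ix))) (0≤inv 0<w)) (*-monoˡ (0≤⌜⌝ (9 ^ suc r)) (toWitness {a? = ⌜ 4096 ⌝ ℚ.≤? ⌜ 21632 ⌝} _)))
         (*-monoˡ (0≤* (0≤* 0≤B (0≤* (0≤^ℚ r 0≤x) (0≤* 0≤ix 0≤ix))) 0≤z) (*-monoʳ (0≤⌜⌝ 21632) (⌜⌝-mono (ℕ.m≤n*m (9 ^ r) 9))))) ⟩
  ⌜ C ⌝ ℚ.* (D ℚ.* (B ℚ.* (x ^ℚ suc r ℚ.* (ix ℚ.* ix)) ℚ.* inv w) ℚ.+ D ℚ.* (B ℚ.* (x ^ℚ r ℚ.* (ix ℚ.* ix)) ℚ.* z))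
    ≡⟨ trans (cong (⌜ C ⌝ ℚ.*_) (sym (ℚ.*-distribˡ-+ D t₁ t₂))) (trans (sym (ℚ.*-assoc ⌜ C ⌝ D (t₁ ℚ.+ t₂))) (cong₂ ℚ._*_ (sym coefficient)
         (cong₂ (λ u v → B ℚ.* u ℚ.* inv w ℚ.+ B ℚ.* v ℚ.* z) (sym (^ℤ-shift₁ r 0<x)) (sym (^ℤ-shift₂ r 0<x))))) ⟩
  ⌜ C * (21632 * 9 ^ suc r) ⌝ ℚ.* (B ℚ.* x ^ℤ (r ℤ.⊖ 1) ℚ.* inv w ℚ.+ B ℚ.* x ^ℤ (r ℤ.⊖ 2) ℚ.* z)  ∎
  where
  open ℚ.≤-Reasoning
  open ℚ.+-*-Solver
  iQ = inv ⌜ Q ⌝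
  iL = inv ⌜ L ⌝
  ix = inv x
  D = ⌜ 21632 ⌝ ℚ.* ⌜ 9 ^ suc r ⌝
  t₁ = B ℚ.* (x ^ℚ suc r ℚ.* (ix ℚ.* ix)) ℚ.* inv w
  t₂ = B ℚ.* (x ^ℚ r ℚ.* (ix ℚ.* ix)) ℚ.* z
  ℓ₁ = ⌜ L ^ suc r ⌝
  ℓ₀ = ⌜ L ^ r ⌝
  0<⌜⌝ : ∀ {m} → 1 ≤ m → 0ℚ ℚ.< ⌜ m ⌝
  0<⌜⌝ (s≤s {n = m} _) = 0<⌜suc⌝ m
  0<Q = 0<⌜⌝ 1≤Q
  0<L = 0<⌜⌝ 1≤L
  0≤x = ℚ.<⇒≤ 0<x
  0≤2^L = 0≤⌜⌝ (2 ^ L)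
  0≤iQ = 0≤inv 0<Q
  0≤iL = 0≤inv 0<L
  0≤ix = 0≤inv 0<x
  0≤ℓ₁ = 0≤⌜⌝ (L ^ suc r)
  0≤ℓ₀ = 0≤⌜⌝ (L ^ r)
  0≤32iw : 0ℚ ℚ.≤ ⌜ 32 ⌝ ℚ.* inv w
  0≤32iw = 0≤* (0≤⌜⌝ 32) (0≤inv 0<w)
  0≤ii : 0ℚ ℚ.≤ ⌜ 8 ⌝ ℚ.* ix ℚ.* (⌜ 8 ⌝ ℚ.* ix)
  0≤ii = 0≤* (0≤* (0≤⌜⌝ 8) 0≤ix) (0≤* (0≤⌜⌝ 8) 0≤ix)
  scaled-inv : ∀ {u v c} → 0ℚ ℚ.< u → 0ℚ ℚ.< v → v ℚ.≤ c ℚ.* u → inv u ℚ.≤ c ℚ.* inv v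
  scaled-inv {u} {v} {c} 0<u 0<v v≤ = inv-≤ 0<u (ℚ.≤-trans (1≤*inv 0<v v≤)
    (ℚ.≤-reflexive (solve 3 (λ c u i → c :* u :* i := u :* (c :* i)) refl c u (inv v))))
  iQ≤ : iQ ℚ.≤ ⌜ 32 ⌝ ℚ.* inv w
  iQ≤ = scaled-inv {c = ⌜ 32 ⌝} 0<Q 0<w w≤
  iL≤ : iL ℚ.≤ ⌜ 8 ⌝ ℚ.* ix
  iL≤ = scaled-inv {c = ⌜ 8 ⌝} 0<L 0<x x≤
  ii≤ : iL ℚ.* iL ℚ.≤ ⌜ 8 ⌝ ℚ.* ix ℚ.* (⌜ 8 ⌝ ℚ.* ix)
  ii≤ = *-mono 0≤iL (0≤* (0≤⌜⌝ 8) 0≤ix) iL≤ iL≤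
  L^≤ : ∀ j → ⌜ L ^ j ⌝ ℚ.≤ ⌜ 9 ^ j ⌝ ℚ.* x ^ℚ j
  L^≤ zero    = ℚ.≤-reflexive (sym (ℚ.*-identityʳ 1ℚ))
  L^≤ (suc j) = ℚ.≤-trans (ℚ.≤-reflexive (⌜⌝-* L (L ^ j))) (ℚ.≤-trans
    (*-mono (0≤⌜⌝ L) (0≤* (0≤⌜⌝ (9 ^ j)) (0≤^ℚ j 0≤x)) L≤ (L^≤ j))
    (ℚ.≤-reflexive (trans (solve 4 (λ a x b y → a :* x :* (b :* y) := a :* b :* (x :* y)) refl ⌜ 9 ⌝ x ⌜ 9 ^ j ⌝ (x ^ℚ j)) (cong (ℚ._* x ^ℚ suc j) (sym (⌜⌝-* 9 (9 ^ j)))))))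
  ℓ₁≤ = L^≤ (suc r)
  ℓ₀≤ = L^≤ r
  casts : ⌜ C * (2 ^ L * (L ^ suc r + L ^ r * suc l′ * Q)) ⌝ ≡ ⌜ C ⌝ ℚ.* (⌜ 2 ^ L ⌝ ℚ.* (ℓ₁ ℚ.+ ℓ₀ ℚ.* ⌜ suc l′ ⌝ ℚ.* ⌜ Q ⌝))
  casts = trans (⌜⌝-* C (2 ^ L * (L ^ suc r + L ^ r * suc l′ * Q))) (cong (⌜ C ⌝ ℚ.*_) (trans (⌜⌝-* (2 ^ L) (L ^ suc r + L ^ r * suc l′ * Q)) (cong (⌜ 2 ^ L ⌝ ℚ.*_) (trans (⌜⌝-+ (L ^ suc r) (L ^ r * suc l′ * Q))
    (cong (ℓ₁ ℚ.+_) (trans (⌜⌝-* (L ^ r * suc l′) Q) (cong (ℚ._* ⌜ Q ⌝) (⌜⌝-* (L ^ r) (suc l′)))))))))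
  coefficient : ⌜ C * (21632 * 9 ^ suc r) ⌝ ≡ ⌜ C ⌝ ℚ.* D
  coefficient = trans (⌜⌝-* C (21632 * 9 ^ suc r)) (cong (⌜ C ⌝ ℚ.*_) (⌜⌝-* 21632 (9 ^ suc r)))

module Estimates (B N : ℝ) (3≤B : ι 3 ≤ℝ seq B) (2≤N : ι 2 ≤ℝ seq N) where
  private
    module B = Located (locate B 2 3≤B)
    module N = Located (locate N 1 2≤N)

  b N₀ : ℕ
  b  = suc B.M
  N₀ = N.M ℕ.⊔ 2

  private
    3≤b : 3 ≤ b
    3≤b = ⌜⌝-≤-+⅕ (B.minimum ℕ.≤-refl) (B.below ℕ.≤-refl)
    2≤N₀ : 2 ≤ N₀
    2≤N₀ = ℕ.m≤n⊔m N.M 2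
    dyadic-b = dyadic b (s≤s z≤n)
    dyadic-N₀ = dyadic N₀ (ℕ.<⇒≤ 2≤N₀)

  L l : ℕ
  L = dyadic-b .proj₁
  l = dyadic-N₀ .proj₁

  dyL : Dyadic L b
  dyL = dyadic-b .proj₂

  dyl : Dyadic l N₀
  dyl = dyadic-N₀ .proj₂

  private
    1≤exponent : ∀ {k x} → 2 ≤ x → Dyadic k x → 1 ≤ k
    1≤exponent {zero}  2≤x (_ , x<) = ⊥-elim (ℕ.<⇒≱ x< 2≤x)
    1≤exponent {suc k} 2≤x _        = s≤s z≤n

  1≤L : 1 ≤ L
  1≤L = 1≤exponent (ℕ.<⇒≤ 3≤b) dyL

  1≤l : 1 ≤ l
  1≤l = 1≤exponent 2≤N₀ dyl

  private
    dyadic-L = dyadic L 1≤L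

  l′ : ℕ
  l′ = dyadic-L .proj₁

  dyl′ : Dyadic l′ L
  dyl′ = dyadic-L .proj₂

  height-< : ∀ {h} → ι h ≤ℝ seq B → h < 2 ^ suc L
  height-< h≤ = ℕ.≤-<-trans (B.≤-suc-M h≤) (dyL .proj₂)

  prime-≥ : ∀ {p} → Prime p → seq N ≤ℝ ι p → N₀ ≤ p
  prime-≥ {p} prime-p N≤p = ℕ.⊔-lub (N.M-≤ N≤p) (ℕ.nonTrivial⇒n>1 p {{prime⇒nonTrivial prime-p}})

  threshold : ℕ
  threshold = B.K + N.K + 2 ^ suc L

  module At {k : ℕ} (late : threshold ≤ k) where
    private
      B≤k : B.K ≤ k
      B≤k = ℕ.≤-trans (ℕ.≤-trans (ℕ.m≤m+n B.K N.K) (ℕ.m≤m+n _ (2 ^ suc L))) late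
      N≤k : N.K ≤ k
      N≤k = ℕ.≤-trans (ℕ.≤-trans (ℕ.m≤n+m N.K B.K) (ℕ.m≤m+n _ (2 ^ suc L))) late
      2^≤k : ∀ {j} → j ≤ suc L → 2 ^ j ≤ k
      2^≤k j≤ = ℕ.≤-trans (ℕ.^-monoʳ-≤ 2 j≤) (ℕ.≤-trans (ℕ.m≤n+m (2 ^ suc L) (B.K + N.K)) late)
      1≤k : 1 ≤ k
      1≤k = 2^≤k {0} z≤n
      2≤k : 2 ≤ k
      2≤k = 2^≤k {1} (s≤s z≤n)
      open ℚ.≤-Reasoning
      open ℚ.+-*-Solver

    β ν x y z : ℚ
    β = seq B k
    ν = seq N k
    x = log (seq B) k
    y = log (seq N) k
    z = log (log (seq B)) k

    private
      29/10≤β : + 29 ℚ./ 10 ℚ.≤ β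
      29/10≤β = +-cancelʳ-≤ ⅒ (ℚ.≤-trans (toWitness {a? = (+ 29 ℚ./ 10) ℚ.+ ⅒ ℚ.≤? ⌜ 3 ⌝} _) (B.minimum B≤k))
      1≤β : 1ℚ ℚ.≤ β
      1≤β = ℚ.≤-trans (toWitness {a? = 1ℚ ℚ.≤? + 29 ℚ./ 10} _) 29/10≤β
      19/10≤ν : + 19 ℚ./ 10 ℚ.≤ ν
      19/10≤ν = +-cancelʳ-≤ ⅒ (ℚ.≤-trans (toWitness {a? = (+ 19 ℚ./ 10) ℚ.+ ⅒ ℚ.≤? ⌜ 2 ⌝} _) (N.minimum N≤k))
      1≤ν : 1ℚ ℚ.≤ ν
      1≤ν = ℚ.≤-trans (toWitness {a? = 1ℚ ℚ.≤? + 19 ℚ./ 10} _) 19/10≤ν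
      21/20≤x : + 21 ℚ./ 20 ℚ.≤ x
      21/20≤x = log-3 2≤k 29/10≤β
      1≤x : 1ℚ ℚ.≤ x
      1≤x = ℚ.≤-trans (toWitness {a? = 1ℚ ℚ.≤? + 21 ℚ./ 20} _) 21/20≤x
      2/41≤z : + 2 ℚ./ 41 ℚ.≤ z
      2/41≤z = loglog-3 1≤k 21/20≤x
      0<y : 0ℚ ℚ.< y
      0<y = log-2 1≤k 19/10≤ν
      0<1 : 0ℚ ℚ.< 1ℚ
      0<1 = toWitness {a? = 0ℚ ℚ.<? 1ℚ} _
      0<ν : 0ℚ ℚ.< ν
      0<ν = ℚ.<-≤-trans 0<1 1≤ν
      b≤2β : ⌜ b ⌝ ℚ.≤ ⌜ 2 ⌝ ℚ.* β
      b≤2β = begin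
        ⌜ b ⌝                    ≡⟨ ⌜suc⌝ B.M ⟩
        1ℚ ℚ.+ ⌜ B.M ⌝           ≤⟨ ℚ.+-monoʳ-≤ 1ℚ (B.above B≤k) ⟩
        1ℚ ℚ.+ (β ℚ.+ ⅒)         ≡⟨ solve 1 (λ b → con 1ℚ :+ (b :+ con ⅒) := con (1ℚ ℚ.+ ⅒) :+ b) refl β ⟩
        (1ℚ ℚ.+ ⅒) ℚ.+ β         ≤⟨ ℚ.+-monoˡ-≤ β (ℚ.≤-trans (toWitness {a? = 1ℚ ℚ.+ ⅒ ℚ.≤? + 29 ℚ./ 10} _) 29/10≤β) ⟩
        β ℚ.+ β                  ≡⟨ solve 1 (λ b → b :+ b := con ⌜ 2 ⌝ :* b) refl β ⟩
        ⌜ 2 ⌝ ℚ.* β              ∎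
      +⅒≤2* : ∀ {q m n} → q ℚ.≤ ⌜ suc m ⌝ ℚ.+ ⅒ → m ≤ n → 2 ≤ n → q ℚ.≤ ⌜ 2 * n ⌝
      +⅒≤2* {q} {m} {n} q≤ m≤n 2≤n = begin
        q                        ≤⟨ q≤ ⟩
        ⌜ suc m ⌝ ℚ.+ ⅒          ≤⟨ ℚ.+-monoʳ-≤ ⌜ suc m ⌝ (toWitness {a? = ⅒ ℚ.≤? ⌜ 1 ⌝} _) ⟩
        ⌜ suc m ⌝ ℚ.+ ⌜ 1 ⌝      ≡⟨ ⌜⌝-+ (suc m) 1 ⟨
        ⌜ suc m + 1 ⌝            ≤⟨ ⌜⌝-mono (ℕ.≤-trans (ℕ.≤-reflexive (ℕ.+-comm (suc m) 1)) (ℕ.+-mono-≤ 2≤n (ℕ.≤-trans m≤n (ℕ.≤-reflexive (sym (ℕ.+-identityʳ n)))))) ⟩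
        ⌜ 2 * n ⌝                ∎
      2*<-dyadic : ∀ {q j n} → q ℚ.≤ ⌜ 2 * n ⌝ → Dyadic j n → q ℚ.≤ ⌜ 2 ^ suc (suc j) ⌝
      2*<-dyadic q≤ (_ , n<) = ℚ.≤-trans q≤ (⌜⌝-mono (ℕ.*-monoʳ-≤ 2 (ℕ.<⇒≤ n<)))
      six+2*≤8* : ∀ {j} → 1 ≤ j → 2 * (2 + suc j) ≤ 8 * j
      six+2*≤8* {j} 1≤j = ℕ.≤-trans (ℕ.≤-reflexive (ℕ.*-distribˡ-+ 2 3 j)) (ℕ.≤-trans (ℕ.+-monoˡ-≤ (2 * j) (ℕ.*-monoʳ-≤ 6 1≤j))
        (ℕ.≤-reflexive (sym (ℕ.*-distribʳ-+ j 6 2))))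
      ν≤ : ν ℚ.≤ ⌜ 2 ^ suc (suc l) ⌝
      ν≤ = 2*<-dyadic {ν} {l} (+⅒≤2* (N.below N≤k) (ℕ.m≤m⊔n N.M 2) 2≤N₀) dyl
      y≤ : y ℚ.≤ ⌜ 8 * l ⌝
      y≤ = ℚ.≤-trans (log-upper 1≤ν k (suc l) ν≤) (⌜⌝-mono (six+2*≤8* 1≤l))

    0<x : 0ℚ ℚ.< x
    0<x = ℚ.<-≤-trans 0<1 1≤x

    0<w : 0ℚ ℚ.< ν ℚ.* y
    0<w = ℚ.positive⁻¹ (ν ℚ.* y) {{ℚ.pos*pos⇒pos ν {{ℚ.positive 0<ν}} y {{ℚ.positive 0<y}}}}

    0≤β : 0ℚ ℚ.≤ β
    0≤β = ℚ.≤-trans 0≤1 1≤β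

    0≤z : 0ℚ ℚ.≤ z
    0≤z = ℚ.≤-trans (toWitness {a? = 0ℚ ℚ.≤? + 2 ℚ./ 41} _) 2/41≤z

    2^L≤ : ⌜ 2 ^ L ⌝ ℚ.≤ ⌜ 2 ⌝ ℚ.* β
    2^L≤ = ℚ.≤-trans (⌜⌝-mono (dyL .proj₁)) b≤2β

    x≤ : x ℚ.≤ ⌜ 8 ⌝ ℚ.* ⌜ L ⌝
    x≤ = ℚ.≤-trans (log-upper 1≤β k (suc L) (2*<-dyadic {β} {L} (+⅒≤2* (B.below B≤k) (ℕ.n≤1+n B.M) (ℕ.<⇒≤ 3≤b)) dyL))
      (ℚ.≤-trans (⌜⌝-mono (six+2*≤8* 1≤L)) (ℚ.≤-reflexive (⌜⌝-* 8 L)))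

    L≤ : ⌜ L ⌝ ℚ.≤ ⌜ 9 ⌝ ℚ.* x
    L≤ = begin
      ⌜ L ⌝                            ≤⟨ ⌜⌝-mono (ℕ.≤-trans (ℕ.m≤n+m∸n L 4) (ℕ.≤-reflexive (cong (_+_ 4) (sym (ℕ.∸-+-assoc L 1 3))))) ⟩
      ⌜ 4 + (L ∸ 1 ∸ 3) ⌝              ≡⟨ ⌜⌝-+ 4 (L ∸ 1 ∸ 3) ⟩
      ⌜ 4 ⌝ ℚ.+ ⌜ L ∸ 1 ∸ 3 ⌝          ≤⟨ ℚ.+-mono-≤ (ℚ.≤-trans (ℚ.≤-reflexive (sym (ℚ.*-identityʳ ⌜ 4 ⌝))) (*-monoʳ (0≤⌜⌝ 4) 1≤x))
                                            (log-lower′ (L ∸ 1) 1≤β (2^≤k (ℕ.≤-trans (ℕ.m∸n≤m L 1) (ℕ.n≤1+n L))) half) ⟩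
      ⌜ 4 ⌝ ℚ.* x ℚ.+ ⌜ 5 ⌝ ℚ.* x      ≡⟨ solve 1 (λ x → con ⌜ 4 ⌝ :* x :+ con ⌜ 5 ⌝ :* x := con ⌜ 9 ⌝ :* x) refl x ⟩
      ⌜ 9 ⌝ ℚ.* x                      ∎
      where
      exponent : 2 * 2 ^ (L ∸ 1) ≡ 2 ^ L
      exponent = cong (2 ^_) (ℕ.m+[n∸m]≡n 1≤L)
      half : ⌜ 2 ^ (L ∸ 1) ⌝ ℚ.≤ β
      half = ℚ.*-cancelˡ-≤-pos ⌜ 2 ⌝ (ℚ.≤-trans (ℚ.≤-reflexive (trans (sym (⌜⌝-* 2 (2 ^ (L ∸ 1)))) (cong ⌜_⌝ exponent))) 2^L≤)

    l′≤ : ⌜ suc l′ ⌝ ℚ.≤ ⌜ 169 ⌝ ℚ.* z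
    l′≤ = begin
      ⌜ suc l′ ⌝                       ≤⟨ ⌜⌝-mono (ℕ.≤-trans (s≤s (ℕ.m≤n+m∸n l′ 7)) (ℕ.≤-reflexive (cong (_+_ 8) (sym (ℕ.∸-+-assoc l′ 4 3))))) ⟩
      ⌜ 8 + (l′ ∸ 4 ∸ 3) ⌝             ≡⟨ ⌜⌝-+ 8 (l′ ∸ 4 ∸ 3) ⟩
      ⌜ 8 ⌝ ℚ.+ ⌜ l′ ∸ 4 ∸ 3 ⌝         ≤⟨ ℚ.+-mono-≤ (ℚ.≤-trans (toWitness {a? = ⌜ 8 ⌝ ℚ.≤? ⌜ 164 ⌝ ℚ.* (+ 2 ℚ./ 41)} _) (*-monoʳ (0≤⌜⌝ 164) 2/41≤z))
                                            (log-lower′ (l′ ∸ 4) 1≤x (2^≤k (ℕ.≤-trans (ℕ.m∸n≤m l′ 4) (ℕ.≤-trans l′≤L (ℕ.n≤1+n L)))) small) ⟩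
      ⌜ 164 ⌝ ℚ.* z ℚ.+ ⌜ 5 ⌝ ℚ.* z    ≡⟨ solve 1 (λ z → con ⌜ 164 ⌝ :* z :+ con ⌜ 5 ⌝ :* z := con ⌜ 169 ⌝ :* z) refl z ⟩
      ⌜ 169 ⌝ ℚ.* z                    ∎
      where
      l′≤L : l′ ≤ L
      l′≤L = ℕ.≤-trans (ℕ.<⇒≤ (n<2^n l′)) (dyl′ .proj₁)
      sixteen : 4 ≤ l′ → 16 * 2 ^ (l′ ∸ 4) ≡ 2 ^ l′
      sixteen 4≤l′ = trans (sym (ℕ.^-distribˡ-+-* 2 4 (l′ ∸ 4))) (cong (2 ^_) (ℕ.m+[n∸m]≡n 4≤l′))
      small : ⌜ 2 ^ (l′ ∸ 4) ⌝ ℚ.≤ x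
      small = cases (4 ℕ.≤? l′)
        where
        cases : Dec (4 ≤ l′) → ⌜ 2 ^ (l′ ∸ 4) ⌝ ℚ.≤ x
        cases (no 4≰l′) = subst (λ j → ⌜ 2 ^ j ⌝ ℚ.≤ x) (sym (ℕ.m≤n⇒m∸n≡0 (ℕ.<⇒≤ (ℕ.≰⇒> 4≰l′)))) 1≤x
        cases (yes 4≤l′) = ℚ.*-cancelˡ-≤-pos ⌜ 16 ⌝ (begin
          ⌜ 16 ⌝ ℚ.* ⌜ 2 ^ (l′ ∸ 4) ⌝    ≡⟨ ⌜⌝-* 16 (2 ^ (l′ ∸ 4)) ⟨
          ⌜ 16 * 2 ^ (l′ ∸ 4) ⌝          ≡⟨ cong ⌜_⌝ (sixteen 4≤l′) ⟩
          ⌜ 2 ^ l′ ⌝                     ≤⟨ ⌜⌝-mono (dyl′ .proj₁) ⟩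
          ⌜ L ⌝                          ≤⟨ L≤ ⟩
          ⌜ 9 ⌝ ℚ.* x                    ≤⟨ *-monoˡ (ℚ.<⇒≤ 0<x) (toWitness {a? = ⌜ 9 ⌝ ℚ.≤? ⌜ 16 ⌝} _) ⟩
          ⌜ 16 ⌝ ℚ.* x                   ∎)

    w≤ : ν ℚ.* y ℚ.≤ ⌜ 32 ⌝ ℚ.* ⌜ 2 ^ l * l ⌝
    w≤ = begin
      ν ℚ.* y                              ≤⟨ *-mono (ℚ.<⇒≤ 0<ν) (0≤⌜⌝ (8 * l)) ν≤ y≤ ⟩
      ⌜ 2 ^ suc (suc l) ⌝ ℚ.* ⌜ 8 * l ⌝    ≡⟨ ⌜⌝-* (2 ^ suc (suc l)) (8 * l) ⟨
      ⌜ 2 ^ suc (suc l) * (8 * l) ⌝        ≡⟨ cong ⌜_⌝ rearranged ⟩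
      ⌜ 32 * (2 ^ l * l) ⌝                 ≡⟨ ⌜⌝-* 32 (2 ^ l * l) ⟩
      ⌜ 32 ⌝ ℚ.* ⌜ 2 ^ l * l ⌝             ∎
      where
      rearranged : 2 ^ suc (suc l) * (8 * l) ≡ 32 * (2 ^ l * l)
      rearranged = regroup-factors (2 ^ l) l
        where
        regroup-factors : ∀ e l → 2 * (2 * e) * (8 * l) ≡ 32 * (e * l)
        regroup-factors e l = trans (ℕ.*-assoc 2 (2 * e) (8 * l)) (trans (cong (2 *_) (ℕ.*-assoc 2 e (8 * l))) (trans (sym (ℕ.*-assoc 2 2 (e * (8 * l))))
            (trans (cong (4 *_) (trans (sym (ℕ.*-assoc e 8 l)) (trans (cong (_* l) (ℕ.*-comm e 8)) (ℕ.*-assoc 8 e l)))) (sym (ℕ.*-assoc 4 8 (e * l))))))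

theorem8p1 : ∀ {d n} (Δ : CompleteRegularFan d n) →
    Projective Δ →
    GloballyGenerated Δ (-K Δ) →
    (m : Vector (Lattice d) (CompleteRegularFan.numMax Δ)) →
    IsDualFamily Δ m →
    (r : ℕ) → RankPic Δ r →
    (f g : Poly ℤ n) → Coprime f g →
    ∃[ C ] ∀ (B N : ℝ) → ι 3 ≤ℝ seq B → ι 2 ≤ℝ seq N →
    Card≤ (λ X → 𝓐 Δ m B X × LargeCommonPrime f g N X)
    (bound C r (seq B) (seq N))
theorem8p1 {d} {n} Δ _ gg m dual r rank f g cop = C * (21632 * 9 ^ suc r) , card≤
  where
  F = dense f ∷ dense g ∷ []
  module T = Total Δ gg m dual rank F (coprime⇒jointlyCoprime f g cop)
  C = T.mass-target .proj₁
  count = T.mass-target .proj₂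
  divides : ∀ {p} h X → + p ℤᵈ.∣ eval h X → p ∣ᶻ ev n (dense h) X
  divides {p} h X d = mk (subst (λ v → + p ℤᵈ.∣ v) (sym (ev-dense h X)) d)
  target : ∀ {B N N₀ L} → (∀ {h} → ι h ≤ℝ seq B → h < 2 ^ suc L) → (∀ {p} → Prime p → seq N ≤ℝ ι p → N₀ ≤ p) →
    ∀ {X} → 𝓐 Δ m B X × LargeCommonPrime f g N X → T.Target N₀ L X
  target height-< prime-≥ {X} ((pos , h≤) , p , prime-p , N≤p , d) = pos , height-< h≤ , p , (prime-p , prime-≥ prime-p N≤p) ,
    divides {p} f X (∣-trans d (ℤᵍ.gcd[i,j]∣i (eval f X) (eval g X))) ∷ divides {p} g X (∣-trans d (ℤᵍ.gcd[i,j]∣j (eval f X) (eval g X))) ∷ []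
  card≤ : ∀ (B N : ℝ) → ι 3 ≤ℝ seq B → ι 2 ≤ℝ seq N →
    Card≤ (λ X → 𝓐 Δ m B X × LargeCommonPrime f g N X) (bound (C * (21632 * 9 ^ suc r)) r (seq B) (seq N))
  card≤ B N 3≤B 2≤N as unique all ε 0<ε = threshold , λ k late → ℚ.≤-trans (eventually late) (p≤p+q (ℚ.<⇒≤ 0<ε))
    where
    open Estimates B N 3≤B 2≤N
    total : length as * (2 ^ l * l * (L * L)) ≤ C * (2 ^ L * (L ^ suc r + L ^ r * suc l′ * (2 ^ l * l)))
    total = subst (λ len → len * (2 ^ l * l * (L * L)) ≤ C * (2 ^ L * (L ^ suc r + L ^ r * suc l′ * (2 ^ l * l)))) (weight-one as)
      (count N₀ l L l′ 1≤l dyl 1≤L dyl′ as unique (All.map (target {B} {N} {N₀} {L} height-< prime-≥) all))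
    eventually : ∀ {k} → threshold ≤ k → ι (length as) k ℚ.≤ bound (C * (21632 * 9 ^ suc r)) r (seq B) (seq N) k
    eventually late = compare {length as} {C} {r} {2 ^ l * l} {L} {l′} {β} {x} {z} {ν ℚ.* y}
      (ℕ.*-mono-≤ (1≤2^ l) 1≤l) 1≤L 0<x 0<w 0≤β 0≤z 2^L≤ x≤ L≤ l′≤ w≤ total
      where open At late
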